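{- For every $\alpha>0$ there is a constant $C=C(\alpha)$ such that the following holds. If $D_0$ is an $n$-vertex digraph on vertex set $[n]$ with minimum semi-degree $\delta^0(D_0)\ge \alpha n$, then asymptotically almost surely (i.e., with probability tending to $1$ as $n\to\infty$) the digraph $D_0\cup D(n,C/n)$ contains every orientation of a cycle of every length between $2$ and $n$ (simultaneously).
   Context: A digraph is a loop-free set of vertices with a set of ordered pairs of distinct vertices (edges); between two vertices there is at most one edge in each direction. The minimum semi-degree $\delta^0(D)$ is the minimum over all vertices of all in- and outdegrees. $D(n,p)$ is the random digraph on $[n]$ in which each of the $n(n-1)$ possible directed edges is present independently with probability $p$; $D_0\cup D(n,p)$ is the digraph on $[n]$ whose edge set is the union of the two edge sets. An orientation of a cycle of length $\ell\ge 3$ is a digraph obtained from the undirected cycle on $\ell$ vertices by replacing each edge $uv$ by exactly one of the directed edges $uv$ or $vu$; a cycle of length $2$ consists of two vertices $u,v$ with both edges $uv$ and $vu$. "Contains" means contains a subdigraph isomorphic to it. -}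

module Defs where

open import Data.Bool using (Bool; true; false; T; _∧_; _∨_; if_then_else_; T?)
open import Data.Nat as ℕ using (ℕ; zero; suc; _≤_; _<_; s≤s; z≤n)
open import Data.Nat.Properties as ℕP using ()
open import Data.Fin as Fin using (Fin; toℕ; fromℕ<)
open import Data.Fin.Properties using (any?; all?; toℕ-fromℕ<; toℕ<n)
open import Data.Vec using (Vec; []; _∷_; lookup)
open import Data.List using (List; []; _∷_; map; allFin; concatMap; filter)
open import Data.Nat.ListAction using (sum)
open import Data.Integer using (+_)
open import Data.Rational using (ℚ; 0ℚ; 1ℚ; _/_; _+_; _*_; _-_; _⊓_)
import Data.Sum
open import Data.Product using (Σ; ∃; ∃-syntax; _×_; _,_; proj₁; proj₂)
open import Relation.Nullary using (¬_; Dec; yes; no; ¬?)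
open import Relation.Nullary.Decidable using (⌊_⌋; map′; _×-dec_; _→-dec_)
open import Relation.Binary.PropositionalEquality using (_≡_; _≢_; refl; subst; sym)

record Digraph (n : ℕ) : Set where
  field
    adj      : Fin n → Fin n → Bool
    loopless : ∀ v → adj v v ≡ false
open Digraph public

Rel : ℕ → Set
Rel n = Fin n → Fin n → Bool

ℕtoℚ : ℕ → ℚ
ℕtoℚ k = + k / 1

outdeg : ∀ {n} → Digraph n → Fin n → ℕ
outdeg {n} D v = sum (map (λ u → if ⌊ ¬? (u Fin.≟ v) ⌋ ∧ adj D v u then 1 else 0) (allFin n))

indeg : ∀ {n} → Digraph n → Fin n → ℕ
indeg {n} D v = sum (map (λ u → if ⌊ ¬? (u Fin.≟ v) ⌋ ∧ adj D u v then 1 else 0) (allFin n))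

MinSemiDegreeAtLeast : ∀ {n} → Digraph n → ℚ → Set
MinSemiDegreeAtLeast D x =
  ∀ v → (x Data.Rational.≤ ℕtoℚ (outdeg D v)) × (x Data.Rational.≤ ℕtoℚ (indeg D v))

next : ∀ {k} → Fin (suc k) → Fin (suc k)
next {k} i with suc (toℕ i) ℕ.<? suc k
... | yes p = fromℕ< p
... | no _  = Fin.zero

-- The cycle position i is joined to position (i+1 mod ℓ); an orientation
-- o : Vec Bool ℓ says the edge goes forward (i → i+1) if o[i] = true and
-- backward (i+1 → i) otherwise.  f lists the images of the cycle vertices.
EdgeOK : ∀ {n k} → Rel n → Vec Bool (suc k) → Vec (Fin n) (suc k) → Fin (suc k) → Bool
EdgeOK G o f i =
  if lookup o i then G (lookup f i) (lookup f (next i))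
                else G (lookup f (next i)) (lookup f i)

InjectiveVec : ∀ {n ℓ} → Vec (Fin n) ℓ → Set
InjectiveVec {n} {ℓ} f = ∀ (i j : Fin ℓ) → lookup f i ≡ lookup f j → i ≡ j

ContainsOrientedCycle : ∀ {n k} → Rel n → Vec Bool (suc k) → Set
ContainsOrientedCycle {n} {k} G o =
  ∃[ f ] (InjectiveVec {n} {suc k} f × (∀ i → T (EdgeOK G o f i)))

Contains2Cycle : ∀ {n} → Rel n → Set
Contains2Cycle {n} G = ∃[ a ] ∃[ b ] (a ≢ b × T (G a b) × T (G b a))

ContainsAllOrientedCycles : ∀ {n} → Rel n → Set
ContainsAllOrientedCycles {n} G =
  Contains2Cycle G ×
  (∀ k → 3 ≤ suc k → suc k ≤ n → (o : Vec Bool (suc k)) → ContainsOrientedCycle G o)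

∃Vec? : ∀ {n} ℓ (P : Vec (Fin n) ℓ → Set) → (∀ v → Dec (P v)) → Dec (∃ P)
∃Vec? zero P P? with P? []
... | yes p = yes ([] , p)
... | no ¬p = no λ { ([] , p) → ¬p p }
∃Vec? (suc ℓ) P P? =
  map′ (λ { (i , v , p) → (i ∷ v , p) }) (λ { (i ∷ v , p) → i , v , p })
       (any? (λ i → ∃Vec? ℓ (λ v → P (i ∷ v)) (λ v → P? (i ∷ v))))

∀BoolVec? : ∀ ℓ (P : Vec Bool ℓ → Set) → (∀ v → Dec (P v)) → Dec (∀ v → P v)
∀BoolVec? zero P P? = map′ (λ { p [] → p }) (λ h → h []) (P? [])
∀BoolVec? (suc ℓ) P P? =
  map′ (λ { (t , f) (true ∷ v) → t v ; (t , f) (false ∷ v) → f v })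
       (λ h → (λ v → h (true ∷ v)) , (λ v → h (false ∷ v)))
       (∀BoolVec? ℓ (λ v → P (true ∷ v)) (λ v → P? (true ∷ v)) ×-dec
        ∀BoolVec? ℓ (λ v → P (false ∷ v)) (λ v → P? (false ∷ v)))

∀<? : ∀ m (R : ℕ → Set) → (∀ k → Dec (R k)) → Dec (∀ k → k < m → R k)
∀<? zero R R? = yes λ k ()
∀<? (suc m) R R? =
  map′ (λ { (h , r) k k<sm → go h r k (ℕP.m≤n⇒m<n∨m≡n (ℕP.≤-pred k<sm)) })
       (λ h → (λ k k<m → h k (ℕP.m<n⇒m<1+n k<m)) , h m ℕP.≤-refl)
       (∀<? m R R? ×-dec R? m)
  where
  go : (∀ k → k < m → R k) → R m → ∀ k → (k < m Data.Sum.⊎ k ≡ m) → R k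
  go h r k (Data.Sum.inj₁ p) = h k p
  go h r k (Data.Sum.inj₂ refl) = r

injective? : ∀ {n ℓ} (f : Vec (Fin n) ℓ) → Dec (InjectiveVec f)
injective? f = all? (λ i → all? (λ j → (lookup f i Fin.≟ lookup f j) →-dec (i Fin.≟ j)))

containsOrientedCycle? : ∀ {n k} (G : Rel n) (o : Vec Bool (suc k)) → Dec (ContainsOrientedCycle G o)
containsOrientedCycle? {n} {k} G o =
  ∃Vec? (suc k) _ (λ f → injective? f ×-dec all? (λ i → T? (EdgeOK G o f i)))

contains2Cycle? : ∀ {n} (G : Rel n) → Dec (Contains2Cycle G)
contains2Cycle? G =
  any? (λ a → any? (λ b → ¬? (a Fin.≟ b) ×-dec (T? (G a b) ×-dec T? (G b a))))

containsAll? : ∀ {n} (G : Rel n) → Dec (ContainsAllOrientedCycles G)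
containsAll? {n} G =
  contains2Cycle? G ×-dec
  map′ (λ h k p q → h k q p) (λ h k q p → h k p q)
       (∀<? n (λ k → 3 ≤ suc k → (o : Vec Bool (suc k)) → ContainsOrientedCycle G o)
            (λ k → (3 ℕ.≤? suc k) →-dec
                   ∀BoolVec? (suc k) _ (λ o → containsOrientedCycle? G o)))

potentialEdges : (n : ℕ) → List (Fin n × Fin n)
potentialEdges n =
  filter (λ e → ¬? (proj₁ e Fin.≟ proj₂ e))
         (concatMap (λ u → map (λ v → (u , v)) (allFin n)) (allFin n))

setEdge : ∀ {n} → Rel n → Fin n → Fin n → Bool → Rel n
setEdge G u v b x y = if ⌊ x Fin.≟ u ⌋ ∧ ⌊ y Fin.≟ v ⌋ then b else G x y

emptyRel : ∀ {n} → Rel n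
emptyRel _ _ = false

-- Expectation of f(G) where, starting from G, each pair in the list is
-- independently set to be an edge with probability p (and a non-edge otherwise).
expect : ∀ {n} → ℚ → List (Fin n × Fin n) → Rel n → (Rel n → ℚ) → ℚ
expect p [] G f = f G
expect p ((u , v) ∷ es) G f =
  p * expect p es (setEdge G u v true) f + (1ℚ - p) * expect p es (setEdge G u v false) f

Pr : ∀ n → ℚ → (E : Rel n → Set) → (∀ G → Dec (E G)) → ℚ
Pr n p E E? = expect p (potentialEdges n) emptyRel (λ G → if ⌊ E? G ⌋ then 1ℚ else 0ℚ)

-- the edge probability C/n (capped at 1; C/n ≤ 1 for all large n anyway)
edgeProb : ℚ → ℕ → ℚ
edgeProb C zero = 0ℚ
edgeProb C (suc m) = 1ℚ ⊓ (C * (+ 1 / suc m))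

_∪_ : ∀ {n} → Digraph n → Rel n → Rel n
(D ∪ G) u v = adj D u v ∨ G u v

PrAllCycles : ∀ {n} → Digraph n → ℚ → ℚ
PrAllCycles {n} D₀ C =
  Pr n (edgeProb C n) (λ G → ContainsAllOrientedCycles (D₀ ∪ G))
       (λ G → containsAll? (D₀ ∪ G))

{-# OPTIONS --safe #-}
module Submission where

-- Let G be the random digraph. If C is large, then with high probability any two sets of at
-- least m = Θ(n) vertices are joined by an edge of G in either direction, and some edge of G
-- reverses an edge of D₀: there are at most 4ⁿ + 1 events, each failing with probability
-- (1 - C/n)^Ω(n²). The rest is deterministic. Any two vertices are linked by a walk with two new
-- inner vertices and any prescribed orientation: take large neighbourhoods of the two in D₀ and an
-- edge of G between them. A depth-first search finds walks of any orientation on all but O(m) of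
-- the vertices of a set. It remains to absorb the left-over vertices.
--
-- A gap from a to b with a missing inner vertex accepts the common neighbours of a and b. If y
-- fits two gaps of a walk, then y may fill either one and leave the other open; so the walk
-- accepts what one of the two gaps accepts. Gaps are chained in this way, each time accepting a
-- constant fraction of the vertices refused so far, until only κ are refused. Taking 2κ such
-- chains with one hole each, only O(κ) vertices are refused by at least half of the chains; these
-- are inserted in the walk one by one. Any 2κ of the other vertices can then be matched to the holes,
-- since every hole refuses at most κ vertices and every vertex is refused by fewer than κ holes.

open import Data.Bool using (Bool; true; false; T; _∧_; _∨_; not; if_then_else_; T?)
open import Data.Bool.Properties using (T-∧; T-∨; ∧-zeroʳ; ∧-identityʳ)
open import Data.Empty using (⊥; ⊥-elim)
open import Data.Fin as Fin using (Fin; zero; suc; toℕ; fromℕ<)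
open import Data.Fin.Permutation.Components using (transpose; transpose-inverse)
open import Data.Fin.Properties using (any?)
import Data.Fin.Properties as Fin
open import Data.List using (List; []; _∷_; _++_; length; map; tabulate; allFin; filter; concatMap; cartesianProduct; cartesianProductWith)
open import Data.List.Membership.Propositional using (_∈_; _∉_)
import Data.List.Membership.DecPropositional as DecMembership
open import Data.List.Membership.Propositional.Properties
  using (∈-++⁻; ∈-++⁺ˡ; ∈-++⁺ʳ; ∈-map⁺; ∈-filter⁻; ∈-tabulate⁺; ∈-tabulate⁻; ∈-cartesianProductWith⁺; ∈-cartesianProductWith⁻)
open import Data.List.Properties using (length-map; length-tabulate; length-++; ++-assoc)
open import Data.List.Relation.Binary.Permutation.Propositional using (_↭_; ↭-sym; ↭-trans; ↭-refl; ↭⇒↭ₛ)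
open import Data.List.Relation.Binary.Permutation.Propositional.Properties using (shift; ++-commutativeMonoid; ++⁺ʳ)
import Data.List.Relation.Binary.Permutation.Setoid.Properties as Permₛ
open import Data.List.Relation.Unary.All as All using (All; []; _∷_)
import Data.List.Relation.Unary.All.Properties as All
open import Data.List.Relation.Unary.AllPairs using ([]; _∷_)
open import Data.List.Relation.Unary.Any using (Any; here; there)
open import Data.List.Relation.Unary.Unique.Propositional using (Unique)
import Data.List.Relation.Unary.Unique.Propositional.Properties as Unique
open import Data.Nat.DivMod using (m≡m%n+[m/n]*n; m/n*n≤m; m*n/n≡m; /-monoˡ-≤; m%n<n)
open import Data.Nat.ListAction using (sum)
open import Data.Nat.Properties
open import Data.Nat.Tactic.RingSolver using (solve-∀)
open import Data.Product using (∃-syntax; _×_; _,_; proj₁; proj₂)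
import Data.Rational.Properties as ℚ
import Data.Rational.Solver as ℚSolver
open import Data.Sum using (_⊎_; inj₁; inj₂; [_,_]′)
open import Data.Unit using (tt)
open import Data.Vec using (Vec; lookup)
import Data.Vec as Vec
import Data.Vec.Properties as Vec
open import Function using (_∘_; id; Equivalence)
open import Relation.Binary.PropositionalEquality hiding (J)
open import Relation.Nullary using (¬_; Dec; yes; no; does; contradiction; ¬?)
open import Relation.Nullary.Decidable using (⌊_⌋; dec-true)
import Algebra.Solver.CommutativeMonoid as CMSolver
open import Defs

-- The events imposed on the random digraph mention neither an orientation nor a length, so one good
-- outcome serves all cycles at once. Three obstacles shape the rest. Since `m` is linear in n,
-- linearly many vertices are left over, while a single gap may accept only a constant fraction of
-- the vertices; holes that refuse few vertices must be manufactured before any matching argument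
-- can work. Next, the dense digraph may be disconnected, so the gap that accepts many refused
-- vertices may share no vertex with what a chain accepts so far. An intermediate gap, obtained from
-- two edges of G, carries the exchange across. Finally, the constants look circular. A chain of s
-- rounds needs about 10s vertices and there are 2κ chains, so κ is at most of order n/s; yet s
-- rounds must bring the number of refused vertices from n down to κ. This is consistent because a
-- round shrinks that number by a fixed factor, and exponential decay in s beats the linear loss.

module Combinatorics where

  open import Data.Nat using (ℕ; zero; suc; _+_; _*_; _∸_; _^_; _/_; _%_; _≤_; _<_; _≤ᵇ_; z≤n; s≤s; NonZero; >-nonZero)

  -- A linear inequality a ≤ b follows from X ≤ Y once b - a - (Y - X) is exhibited as s ≥ 0.
  lin : ∀ {a b X Y} s → X ≤ Y → b + X ≡ a + Y + s → a ≤ b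
  lin {a} {b} {X} {Y} s X≤Y eq = +-cancelʳ-≤ Y a b (begin
    a + Y      ≤⟨ m≤m+n (a + Y) s ⟩
    a + Y + s  ≡⟨ sym eq ⟩
    b + X      ≤⟨ +-monoʳ-≤ b X≤Y ⟩
    b + Y      ∎)
    where open ≤-Reasoning

  infixl 6 _⊕_
  _⊕_ : ∀ {a b c d} → a ≤ b → c ≤ d → a + c ≤ b + d
  _⊕_ = +-mono-≤

  ∧⁺ : ∀ {a b} → T a → T b → T (a ∧ b)
  ∧⁺ p q = Equivalence.from T-∧ (p , q)

  ∧⁻ : ∀ {a b} → T (a ∧ b) → T a × T b
  ∧⁻ = Equivalence.to T-∧

  T-not⁺ : ∀ {b} → ¬ T b → T (not b)
  T-not⁺ {true}  f = f tt
  T-not⁺ {false} f = tt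

  T-not⁻ : ∀ {b} → T (not b) → ¬ T b
  T-not⁻ {false} _ ()

  does⁺ : ∀ {p} {P : Set p} (d : Dec P) → P → T (does d)
  does⁺ d p = subst T (sym (dec-true d p)) tt

  does⁻ : ∀ {p} {P : Set p} (d : Dec P) → T (does d) → P
  does⁻ (yes p) _ = p

  -- Finite sums, cardinalities of decidable subsets, and lists without repetition.

  ∑ : ∀ {p} → (Fin p → ℕ) → ℕ
  ∑ {zero}  f = 0
  ∑ {suc p} f = f zero + ∑ (f ∘ suc)

  ∑-mono : ∀ {p} {f g : Fin p → ℕ} → (∀ i → f i ≤ g i) → ∑ f ≤ ∑ g
  ∑-mono {zero}  h = z≤n
  ∑-mono {suc p} h = h zero ⊕ ∑-mono (h ∘ suc)

  ∑-+ : ∀ {p} (f g : Fin p → ℕ) → ∑ (λ i → f i + g i) ≡ ∑ f + ∑ g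
  ∑-+ {zero}  f g = refl
  ∑-+ {suc p} f g = trans (cong ((f zero + g zero) +_) (∑-+ (f ∘ suc) (g ∘ suc)))
                          (interchange (f zero) (g zero) (∑ (f ∘ suc)) (∑ (g ∘ suc)))
    where
    interchange : ∀ a b c d → a + b + (c + d) ≡ a + c + (b + d)
    interchange = solve-∀

  ∑-const : ∀ {p} c → ∑ {p} (λ _ → c) ≡ p * c
  ∑-const {zero}  c = refl
  ∑-const {suc p} c = cong (c +_) (∑-const {p} c)

  ∑-*ˡ : ∀ {p} c (f : Fin p → ℕ) → ∑ (λ i → c * f i) ≡ c * ∑ f
  ∑-*ˡ {zero}  c f = sym (*-zeroʳ c)
  ∑-*ˡ {suc p} c f = trans (cong (c * f zero +_) (∑-*ˡ c (f ∘ suc))) (sym (*-distribˡ-+ c _ _))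

  ∑-swap : ∀ {p q} (f : Fin p → Fin q → ℕ) → ∑ (λ i → ∑ (f i)) ≡ ∑ (λ j → ∑ (λ i → f i j))
  ∑-swap {zero}  {q} f = sym (trans (∑-const {q} 0) (*-zeroʳ q))
  ∑-swap {suc p} f = trans (cong (∑ (f zero) +_) (∑-swap (f ∘ suc)))
                           (sym (∑-+ (f zero) (λ j → ∑ (λ i → f (suc i) j))))

  ind : Bool → ℕ
  ind true  = 1
  ind false = 0

  ind-mono : ∀ {a b} → (T a → T b) → ind a ≤ ind b
  ind-mono {true}  {true}  h = ≤-refl
  ind-mono {true}  {false} h = ⊥-elim (h tt)
  ind-mono {false}         h = z≤n

  opaque
    # : ∀ {p} → (Fin p → Bool) → ℕ
    # P = ∑ (ind ∘ P)

    #-mono : ∀ {p} {P Q : Fin p → Bool} → (∀ i → T (P i) → T (Q i)) → # P ≤ # Q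
    #-mono {P = P} {Q} h = ∑-mono (λ i → ind-mono (h i))

    #-true : ∀ {p} → # {p} (λ _ → true) ≡ p
    #-true {p} = trans (∑-const {p} 1) (*-identityʳ p)

    #-witness : ∀ {p} {P : Fin p → Bool} → 1 ≤ # P → ∃[ i ] T (P i)
    #-witness {suc p} {P} h with P zero in eq
    ... | true  = zero , subst T (sym eq) tt
    ... | false = let i , q = #-witness {p} h in suc i , q

    #-∨ : ∀ {p} {P Q R : Fin p → Bool} → (∀ i → T (P i) → T (Q i) ⊎ T (R i)) → # P ≤ # Q + # R
    #-∨ {P = P} {Q} {R} h = subst (# P ≤_) (∑-+ (ind ∘ Q) (ind ∘ R)) (∑-mono pt)
      where
      pt : ∀ i → ind (P i) ≤ ind (Q i) + ind (R i)
      pt i with P i | Q i | R i | h i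
      ... | false | _     | _     | _ = z≤n
      ... | true  | true  | _     | _ = s≤s z≤n
      ... | true  | false | true  | _ = s≤s z≤n
      ... | true  | false | false | k = ⊥-elim ([ id , id ]′ (k tt))

    #-split : ∀ {p} {P Q R : Fin p → Bool} → (∀ i → T (Q i) → T (P i)) → (∀ i → T (R i) → T (P i)) →
      (∀ i → T (Q i) → T (R i) → ⊥) → # Q + # R ≤ # P
    #-split {P = P} {Q} {R} hq hr dis = subst (_≤ # P) (∑-+ (ind ∘ Q) (ind ∘ R)) (∑-mono pt)
      where
      pt : ∀ i → ind (Q i) + ind (R i) ≤ ind (P i)
      pt i with P i | Q i | R i | hq i | hr i | dis i
      ... | true  | true  | false | _ | _ | _ = ≤-refl
      ... | true  | false | true  | _ | _ | _ = ≤-refl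
      ... | true  | true  | true  | _ | _ | d = ⊥-elim (d tt tt)
      ... | true  | false | false | _ | _ | _ = z≤n
      ... | false | true  | _     | a | _ | _ = ⊥-elim (a tt)
      ... | false | false | true  | _ | a | _ = ⊥-elim (a tt)
      ... | false | false | false | _ | _ | _ = z≤n

    #-singleton : ∀ {p} (x : Fin p) → # (λ i → does (i Fin.≟ x)) ≡ 1
    #-singleton {suc p} zero    = cong suc (trans (∑-const {p} 0) (*-zeroʳ p))
    #-singleton {suc p} (suc x) = #-singleton x

  #-bound : ∀ {p} (P : Fin p → Bool) → # P ≤ p
  #-bound P = subst (# P ≤_) #-true (#-mono λ _ _ → tt)

  infix 6 _∈ᵇ_
  _∈ᵇ_ : ∀ {p} → Fin p → List (Fin p) → Bool
  v ∈ᵇ []       = false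
  v ∈ᵇ (x ∷ xs) = does (v Fin.≟ x) ∨ (v ∈ᵇ xs)

  ∈ᵇ⁺ : ∀ {p} {v : Fin p} {xs} → v ∈ xs → T (v ∈ᵇ xs)
  ∈ᵇ⁺ {v = v} {x ∷ xs} (here px)  = Equivalence.from T-∨ (inj₁ (does⁺ (v Fin.≟ x) px))
  ∈ᵇ⁺ {v = v} {x ∷ xs} (there pf) = Equivalence.from (T-∨ {does (v Fin.≟ x)}) (inj₂ (∈ᵇ⁺ pf))

  ∈ᵇ⁻ : ∀ {p} {v : Fin p} {xs} → T (v ∈ᵇ xs) → v ∈ xs
  ∈ᵇ⁻ {v = v} {x ∷ xs} h with Equivalence.to (T-∨ {does (v Fin.≟ x)}) h
  ... | inj₁ p = here (does⁻ (v Fin.≟ x) p)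
  ... | inj₂ q = there (∈ᵇ⁻ q)

  infixl 7 _∖_

  opaque
    _∖_ : ∀ {p} → (Fin p → Bool) → List (Fin p) → Fin p → Bool
    (P ∖ F) v = P v ∧ not (v ∈ᵇ F)

    ∖⁺ : ∀ {p} {P : Fin p → Bool} {F v} → T (P v) → v ∉ F → T ((P ∖ F) v)
    ∖⁺ {P = P} {F} p v∉F = ∧⁺ p (T-not⁺ (v∉F ∘ ∈ᵇ⁻))

    ∖⁻ : ∀ {p} {P : Fin p → Bool} {F v} → T ((P ∖ F) v) → T (P v) × v ∉ F
    ∖⁻ {P = P} {F} {v} h = let a , b = ∧⁻ {P v} h in a , T-not⁻ b ∘ ∈ᵇ⁺

    ∖[] : ∀ {p} {P : Fin p → Bool} {v} → T (P v) → T ((P ∖ []) v)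
    ∖[] p = ∧⁺ p tt

  #-∖ : ∀ {p} (P : Fin p → Bool) F → # P ≤ length F + # (P ∖ F)
  #-∖ P []      = #-mono (λ i → ∖[])
  #-∖ P (x ∷ F) = begin
    # P                              ≤⟨ #-∖ P F ⟩
    length F + # (P ∖ F)             ≤⟨ +-monoʳ-≤ (length F) (#-∨ split) ⟩
    length F + (# (λ i → does (i Fin.≟ x)) + # (P ∖ (x ∷ F)))
                                     ≡⟨ cong (λ z → length F + (z + # (P ∖ (x ∷ F)))) (#-singleton x) ⟩
    length F + suc (# (P ∖ (x ∷ F))) ≡⟨ +-suc _ _ ⟩
    suc (length F + # (P ∖ (x ∷ F))) ∎
    where
    open ≤-Reasoning
    split : ∀ i → T ((P ∖ F) i) → T (does (i Fin.≟ x)) ⊎ T ((P ∖ (x ∷ F)) i)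
    split i h with i Fin.≟ x
    ... | yes _  = inj₁ tt
    ... | no i≢x = let a , b = ∖⁻ h in inj₂ (∖⁺ a λ { (here e) → i≢x e ; (there q) → b q })

  #-remove : ∀ {p} {P : Fin p → Bool} {x} → T (P x) → suc (# (P ∖ (x ∷ []))) ≤ # P
  #-remove {P = P} {x} px = subst (λ z → z + # (P ∖ (x ∷ [])) ≤ # P) (#-singleton x)
    (#-split (λ i e → subst (T ∘ P) (sym (does⁻ (i Fin.≟ x) e)) px)
             (λ i h → proj₁ (∖⁻ {P = P} h))
             (λ i e h → proj₂ (∖⁻ {P = P} h) (here (does⁻ (i Fin.≟ x) e))))

  length≤# : ∀ {p} {P : Fin p → Bool} {xs} → Unique xs → (∀ {v} → v ∈ xs → T (P v)) → length xs ≤ # P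
  length≤# {xs = []}     _        _ = z≤n
  length≤# {P = P} {xs = x ∷ xs} (ux ∷ u) h = ≤-trans
    (s≤s (length≤# {P = P ∖ (x ∷ [])} u
       (λ v∈ → ∖⁺ {P = P} (h (there v∈)) λ { (here refl) → All.lookup ux v∈ refl ; (there ()) })))
    (#-remove (h (here refl)))

  Injective : ∀ {k p} → (Fin k → Fin p) → Set
  Injective σ = ∀ {i j} → σ i ≡ σ j → i ≡ j

  pick : ∀ {p} k {P : Fin p → Bool} → k ≤ # P → ∃[ σ ] (Injective {k} σ × (∀ i → T (P (σ i))))
  pick zero    h = (λ ()) , (λ { {()} }) , λ ()
  pick {p} (suc k) {P} h = σ , inj , mem
    where
    w = #-witness (≤-trans (s≤s z≤n) h)
    x = proj₁ w
    r = pick k {P ∖ (x ∷ [])} (≤-pred (≤-trans h (#-∖ P (x ∷ []))))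
    σ' = proj₁ r
    σ : Fin (suc k) → Fin p
    σ zero    = x
    σ (suc i) = σ' i
    notx : ∀ i → σ' i ≢ x
    notx i e = proj₂ (∖⁻ {P = P} (proj₂ (proj₂ r) i)) (here e)
    inj : Injective σ
    inj {zero}  {zero}  e = refl
    inj {zero}  {suc j} e = contradiction (sym e) (notx j)
    inj {suc i} {zero}  e = contradiction e (notx i)
    inj {suc i} {suc j} e = cong suc (proj₁ (proj₂ r) e)
    mem : ∀ i → T (P (σ i))
    mem zero    = proj₂ w
    mem (suc i) = proj₁ (∖⁻ {P = P} (proj₂ (proj₂ r) i))

  injective≤# : ∀ {k p} {σ : Fin k → Fin p} {P : Fin p → Bool} → Injective σ → (∀ i → T (P (σ i))) → k ≤ # P
  injective≤# {k} {σ = σ} {P} inj h = subst (_≤ # P) (length-tabulate σ)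
    (length≤# (Unique.tabulate⁺ inj) λ v∈ → let i , e = ∈-tabulate⁻ v∈ in subst (T ∘ P) (sym e) (h i))

  #-injective : ∀ {k p} {σ : Fin k → Fin p} {P : Fin k → Bool} {Q : Fin p → Bool} → Injective σ →
    (∀ i → T (P i) → T (Q (σ i))) → # P ≤ # Q
  #-injective {P = P} inj h =
    let τ , τ-inj , τ-mem = pick (# P) {P} ≤-refl
    in injective≤# (τ-inj ∘ inj) (λ i → h (τ i) (τ-mem i))

  -- Counts the pairs of R with first entry in X from either side.
  opaque
    unfolding #

    heavy : ∀ {p q} (R : Fin p → Fin q → Bool) (X : Fin p → Bool) {δ t} →
      (∀ i → T (X i) → δ ≤ # (R i)) →
      # X * δ ≤ q * t + # (λ j → t ≤ᵇ # (λ i → X i ∧ R i j)) * # X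
    heavy {p} {q} R X {δ} {t} deg = begin
      # X * δ                                      ≡⟨ *-comm (# X) δ ⟩
      δ * # X                                      ≡⟨ sym (∑-*ˡ δ (ind ∘ X)) ⟩
      ∑ (λ i → δ * ind (X i))                      ≤⟨ ∑-mono row ⟩
      ∑ (λ i → # (λ j → X i ∧ R i j))              ≡⟨ ∑-swap (λ i j → ind (X i ∧ R i j)) ⟩
      ∑ c                                          ≤⟨ ∑-mono col ⟩
      ∑ (λ j → t + # X * ind (H j))                ≡⟨ ∑-+ (λ _ → t) (λ j → # X * ind (H j)) ⟩
      ∑ {q} (λ _ → t) + ∑ (λ j → # X * ind (H j))  ≡⟨ cong₂ _+_ (∑-const {q} t) (∑-*ˡ (# X) (ind ∘ H)) ⟩
      q * t + # X * # H                            ≡⟨ cong (q * t +_) (*-comm (# X) (# H)) ⟩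
      q * t + # H * # X                            ∎
      where
      open ≤-Reasoning
      c : Fin q → ℕ
      c j = # (λ i → X i ∧ R i j)
      H : Fin q → Bool
      H j = t ≤ᵇ c j
      row : ∀ i → δ * ind (X i) ≤ # (λ j → X i ∧ R i j)
      row i with X i | deg i
      ... | true  | d = ≤-trans (≤-reflexive (*-identityʳ δ)) (d tt)
      ... | false | _ = ≤-trans (≤-reflexive (*-zeroʳ δ)) z≤n
      col : ∀ j → c j ≤ t + # X * ind (H j)
      col j with t ≤ᵇ c j in eq
      ... | true  = ≤-trans (#-mono (λ i → proj₁ ∘ ∧⁻ {X i}))
                            (≤-trans (≤-reflexive (sym (*-identityʳ (# X)))) (m≤n+m _ t))
      ... | false = ≤-trans (<⇒≤ (≰⇒> λ t≤c → subst T eq (≤⇒≤ᵇ t≤c))) (m≤m+n t _)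

  avoid-both : ∀ {p} {P Q : Fin p → Bool} → # P + # Q < p → ∃[ i ] (¬ T (P i) × ¬ T (Q i))
  avoid-both {p} {P} {Q} h with any? (λ i → T? (not (P i) ∧ not (Q i)))
  ... | yes (i , w) = i , T-not⁻ (proj₁ (∧⁻ w)) , T-not⁻ (proj₂ (∧⁻ {not (P i)} w))
  ... | no none = contradiction h (≤⇒≯ (subst (_≤ # P + # Q) #-true (#-∨ cover)))
    where
    cover : ∀ i → T true → T (P i) ⊎ T (Q i)
    cover i _ with P i in eP | Q i in eQ
    ... | true  | _     = inj₁ tt
    ... | false | true  = inj₂ tt
    ... | false | false = ⊥-elim (none (i , subst T (sym (cong₂ (λ a b → not a ∧ not b) eP eQ)) tt))

  dir : ∀ {n} → (Fin n → Fin n → Bool) → Bool → Fin n → Fin n → Bool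
  dir R true  u v = R u v
  dir R false u v = R v u

  dir-not : ∀ {n} (R : Fin n → Fin n → Bool) e u v → dir R (not e) u v ≡ dir R e v u
  dir-not R true  u v = refl
  dir-not R false u v = refl

  unique-↭ : ∀ {A : Set} {xs ys : List A} → xs ↭ ys → Unique xs → Unique ys
  unique-↭ {A} p = Permₛ.Unique-resp-↭ (setoid A) (↭⇒↭ₛ p)

  unique-++ʳ : ∀ {A : Set} (xs : List A) {ys} → Unique (xs ++ ys) → Unique ys
  unique-++ʳ []       u       = u
  unique-++ʳ (x ∷ xs) (_ ∷ u) = unique-++ʳ xs u

  unique-++ˡ : ∀ {A : Set} (xs : List A) {ys} → Unique (xs ++ ys) → Unique xs
  unique-++ˡ []       u       = []
  unique-++ˡ (x ∷ xs) (a ∷ u) = All.++⁻ˡ xs a ∷ unique-++ˡ xs u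

  unique-∷ : ∀ {A : Set} {x : A} {xs} → x ∉ xs → Unique xs → Unique (x ∷ xs)
  unique-∷ x∉ u = All.¬Any⇒All¬ _ x∉ ∷ u

  ∉-++ : ∀ {A : Set} {x : A} xs {ys} → x ∉ xs → x ∉ ys → x ∉ xs ++ ys
  ∉-++ xs p q h = [ p , q ]′ (∈-++⁻ xs h)

  ∉-∷ : ∀ {A : Set} {x y : A} {xs} → x ≢ y → x ∉ xs → x ∉ y ∷ xs
  ∉-∷ p q (here e)  = p e
  ∉-∷ p q (there h) = q h

  unique-++ : ∀ {A : Set} {xs ys : List A} → Unique xs → Unique ys → (∀ {v} → v ∈ xs → v ∉ ys) → Unique (xs ++ ys)
  unique-++ {xs = []}     u v h = v
  unique-++ {xs = x ∷ xs} (a ∷ u) v h =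
    unique-∷ (∉-++ xs (λ x∈ → All.lookup a x∈ refl) (h (here refl))) (unique-++ u v (h ∘ there))

  infixr 5 _◂_
  _◂_ : ∀ {k} {A : Set} → A → (Fin k → A) → Fin (suc k) → A
  (x ◂ f) zero    = x
  (x ◂ f) (suc i) = f i

  -- The deterministic setting: `R` is dense and `G` joins large sets.

  module Perturbed {n : ℕ} (R G : Fin n → Fin n → Bool) (w A m : ℕ)
    (1≤A : 1 ≤ A) (1≤m : 1 ≤ m) (m≤w : m ≤ w) (n≤Aw : n ≤ A * w)
    -- Five units: the forbidden sets below have at most `4 * w` members, and the remaining `w ≥ m`
    -- neighbours are enough for `joined`.
    (degree : ∀ e v → 5 * w ≤ # (dir R e v))
    (joined : ∀ P Q → m ≤ # P → m ≤ # Q → ∃[ u ] ∃[ v ] (u ≢ v × T (P u) × T (Q v) × T (G u v)))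
    where

    V = Fin n

    opaque
      E : Bool → V → V → Bool
      E e u v = dir R e u v ∨ dir G e u v

      fromR : ∀ {e u v} → T (dir R e u v) → T (E e u v)
      fromR = Equivalence.from T-∨ ∘ inj₁

      fromG : ∀ {e u v} → T (dir G e u v) → T (E e u v)
      fromG {e} {u} {v} = Equivalence.from (T-∨ {dir R e u v}) ∘ inj₂

    opaque
      unfolding E
      toUnion : ∀ {e u v} → T (E e u v) → T (dir R e u v ∨ dir G e u v)
      toUnion h = h

    joined-dir : ∀ e P Q → m ≤ # P → m ≤ # Q →
      ∃[ u ] ∃[ v ] (u ≢ v × T (P u) × T (Q v) × T (dir G e u v))
    joined-dir true  P Q p q = joined P Q p q
    joined-dir false P Q p q with joined Q P q p
    ... | v , u , v≢u , qv , pu , g = u , v , v≢u ∘ sym , pu , qv , g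

    codegree : ∀ e v → 5 * w ≤ # (λ x → dir R e x v)
    codegree e v = ≤-trans (degree (not e) v)
      (#-mono λ x → subst T (dir-not R e v x))

    budget : ∀ {P : V → Bool} {F} r s → length F ≤ r * w → (s + r) * w ≤ # P → s * w ≤ # (P ∖ F)
    budget {P} {F} r s lF h = lin 0 (h ⊕ lF ⊕ #-∖ P F) (eq w s r (# P) (length F) (# (P ∖ F)))
      where
      eq : ∀ w s r p f x → x + ((s + r) * w + f + p) ≡ s * w + (p + r * w + (f + x)) + 0
      eq = solve-∀

    -- Each vertex of `X` has at least 3w neighbours outside `F`. If fewer than m vertices received
    -- t of these pairs, there would be at most nt + w|X| pairs, and nt ≤ Awt ≤ w|X|; so 3w|X| ≤
    -- 2w|X|, although w|X| is positive.
    dense : ∀ e {X t F} → 1 ≤ t → length F ≤ 2 * w → A * t ≤ # X →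
      m ≤ # ((λ d → t ≤ᵇ # (λ x → X x ∧ dir R e x d)) ∖ F)
    dense e {X} {t} {F} 1≤t lF At≤X with m ≤? # (λ d → t ≤ᵇ # (λ x → X x ∧ (dir R e x ∖ F) d))
    ... | yes m≤H = ≤-trans m≤H (#-mono sub)
      where
      c : V → V → Bool
      c d x = X x ∧ (dir R e x ∖ F) d
      sub : ∀ d → T (t ≤ᵇ # (c d)) → T (((λ d → t ≤ᵇ # (λ x → X x ∧ dir R e x d)) ∖ F) d)
      sub d h = ∖⁺ (≤⇒≤ᵇ (≤-trans (≤ᵇ⇒≤ t _ h)
                     (#-mono {P = c d} λ x z → let a , b = ∧⁻ {X x} z in ∧⁺ a (proj₁ (∖⁻ b)))))
                   (proj₂ (∖⁻ (proj₂ (∧⁻ {X (proj₁ wit)} (proj₂ wit)))))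
        where wit = #-witness {P = c d} (≤-trans 1≤t (≤ᵇ⇒≤ t _ h))
    ... | no m≰H = contradiction chain (<⇒≱ 0<wX)
      where
      X# = # X
      H# = # (λ d → t ≤ᵇ # (λ x → X x ∧ (dir R e x ∖ F) d))
      h₁ : X# * (3 * w) ≤ n * t + H# * X#
      h₁ = heavy (λ x → dir R e x ∖ F) X {3 * w} {t} (λ x _ → budget 2 3 lF (degree e x))
      0<wX : 0 < w * X#
      0<wX = *-mono-≤ (≤-trans 1≤m m≤w) (≤-trans (*-mono-≤ 1≤A 1≤t) At≤X)
      chain : w * X# ≤ 0
      chain = lin 0 (h₁ ⊕ *-monoˡ-≤ t n≤Aw ⊕ *-monoʳ-≤ w At≤X ⊕ *-monoˡ-≤ X# (≤-trans (<⇒≤ (≰⇒> m≰H)) m≤w))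
        (eq w X# n t A H#)
        where
        eq : ∀ w x n t A H → 0 + (x * (3 * w) + n * t + w * (A * t) + H * x)
             ≡ w * x + (n * t + H * x + A * w * t + w * x + w * x) + 0
        eq = solve-∀

    -- Two uses of `dense`, each costing a factor `A`: `a` is chosen with `A * t` neighbours in `X`,
    -- then `b` with `t` neighbours among those.
    good-gap : ∀ {F X t} e f → 1 ≤ t → suc (length F) ≤ 2 * w → A * (A * t) ≤ # X →
      ∃[ a ] ∃[ b ] (a ∉ F × b ∉ (a ∷ F) × t ≤ # (λ v → X v ∧ (dir R e a v ∧ dir R f v b)))
    good-gap {F} {X} {t} e f 1≤t lF At≤X =
      a , b , proj₂ (∖⁻ (proj₂ wa)) , proj₂ (∖⁻ (proj₂ wb)) ,
      ≤-trans (≤ᵇ⇒≤ t _ (proj₁ (∖⁻ (proj₂ wb)))) (#-mono λ v z →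
        let p , r = ∧⁻ {X v ∧ dir R (not e) v a} z ; p₁ , p₂ = ∧⁻ {X v} p
        in ∧⁺ p₁ (∧⁺ (subst T (dir-not R e v a) p₂) r))
      where
      wa = #-witness (≤-trans 1≤m (dense (not e) {X} {A * t} {F} (*-mono-≤ 1≤A 1≤t) (≤-trans (n≤1+n _) lF) At≤X))
      a = proj₁ wa
      X₁ : V → Bool
      X₁ v = X v ∧ dir R (not e) v a
      wb = #-witness (≤-trans 1≤m (dense f {X₁} {t} {a ∷ F} 1≤t lF (≤ᵇ⇒≤ (A * t) _ (proj₁ (∖⁻ (proj₂ wa))))))
      b = proj₁ wb

    module Pattern (o : ℕ → Bool) where
      open CMSolver (++-commutativeMonoid {A = V}) using () renaming (solve to solve↭; _⊕_ to _⊞_; _⊜_ to _⊜↭_)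

      -- The vertices u ∷ xs sit at the positions i, …, j of the pattern o, ending with v.
      infixr 5 _∷_
      data Walk : ℕ → V → List V → ℕ → V → Set where
        []  : ∀ {i u} → Walk i u [] i u
        _∷_ : ∀ {i u x xs j v} → T (E (o i) u x) → Walk (suc i) x xs j v → Walk i u (x ∷ xs) j v

      infixr 5 _++ʷ_
      _++ʷ_ : ∀ {i u xs j v ys k z} → Walk i u xs j v → Walk j v ys k z → Walk i u (xs ++ ys) k z
      []       ++ʷ q = q
      (e ∷ p) ++ʷ q = e ∷ (p ++ʷ q)

      walk-length : ∀ {i u xs j v} → Walk i u xs j v → j ≡ length xs + i
      walk-length []      = refl
      walk-length {i} {xs = x ∷ xs} (e ∷ p) = trans (walk-length p) (+-suc (length xs) i)

      link : ∀ F i u v → length F ≤ 4 * w →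
        ∃[ x ] ∃[ y ] (x ∉ F × y ∉ (x ∷ F) × Walk i u (x ∷ y ∷ v ∷ []) (3 + i) v)
      link F i u v lF with joined-dir (o (1 + i)) (dir R (o i) u ∖ F) ((λ y → dir R (o (2 + i)) y v) ∖ F)
          (≤-trans m≤w (subst (_≤ _) (*-identityˡ w) (budget 4 1 lF (degree (o i) u))))
          (≤-trans m≤w (subst (_≤ _) (*-identityˡ w) (budget 4 1 lF (codegree (o (2 + i)) v))))
      ... | x , y , x≢y , px , py , g =
        let a , x∉F = ∖⁻ px ; b , y∉F = ∖⁻ py
        in x , y , x∉F , ∉-∷ (x≢y ∘ sym) y∉F ,
           (fromR a ∷ fromG g ∷ fromR b ∷ [])

      -- Depth-first search for long walks of a prescribed orientation.

      module DepthFirst (i ℓ : ℕ) (M : V → Bool) (large : suc ℓ + 3 * m ≤ # M) where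

        -- `r` positions are still open in front of the stack. As the last position is fixed from
        -- the outset, a push is a cons of `Walk` and the search succeeds when `r` reaches zero.
        Stack : ℕ → List V → Set
        Stack r []       = r ≡ suc ℓ
        Stack r (v ∷ vs) = ∃[ q ] Walk (r + i) v vs (ℓ + i) q

        Found : Set
        Found = ∃[ v ] ∃[ vs ] ∃[ q ] (Walk i v vs (ℓ + i) q × Unique (v ∷ vs) × (∀ {x} → x ∈ v ∷ vs → T (M x)))

        Dead : Bool → List V → (V → Bool) → Set
        Dead e D U = ∀ {v} → v ∈ D → ∀ {u} → T (U u) → ¬ T (dir G e u v)

        -- U holds the unvisited vertices, and the walk on the stack grows backwards from its last
        -- vertex. A vertex is dropped into D₁ or D₂, according to the orientation required at that
        -- moment, once it has no suitable neighbour in U: no edge of G leads from U to D₁, and none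
        -- from D₂ to U. As U only shrinks, this persists.
        record State (c₁ c₂ r : ℕ) (st D₁ D₂ : List V) (U : V → Bool) : Set where
          field
            stack : Stack r st
            len   : r + length st ≡ suc ℓ
            -- `c₁` and `c₂` count the drops left before a dead set has `m` members, which is
            -- impossible; they bound the number of backtracking steps.
            len₁  : c₁ + length D₁ ≡ m
            len₂  : c₂ + length D₂ ≡ m
            uniq₁ : Unique (st ++ D₁)
            uniq₂ : Unique (st ++ D₂)
            fresh : ∀ {v} → T (U v) → v ∉ st × v ∉ D₁ × v ∉ D₂
            dead₁ : Dead true D₁ U
            dead₂ : Dead false D₂ U
            stM   : ∀ {v} → v ∈ st → T (M v)
            UM    : ∀ {v} → T (U v) → T (M v)
            count : # M ≤ # U + (length st + (length D₁ + length D₂))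

          -- This is what the margin `3 * m` buys: the stack takes at most ℓ + 1 vertices and the
          -- dead sets 2m, so `U` stays large enough for `joined`.
          unvisited : m ≤ # U
          unvisited = lin r (large ⊕ count ⊕ ≤-reflexive len ⊕ ≤-reflexive len₁ ⊕ ≤-reflexive len₂ ⊕ z≤n {c₁ + c₂})
            (eq m (# U) ℓ (# M) (length st) (length D₁) (length D₂) r c₁ c₂)
            where
            eq : ∀ m u ℓ M s a b r c d →
              u + (suc ℓ + 3 * m + M + (r + s) + (c + a) + (d + b) + 0)
              ≡ m + (M + (u + (s + (a + b))) + suc ℓ + m + m + (c + d)) + r
            eq = solve-∀

          no-dead : ∀ e D → Unique D → length D ≡ m → Dead e D U → ⊥
          no-dead e D u lD dead with joined-dir e U (_∈ᵇ D) unvisited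
              (subst (_≤ # (_∈ᵇ D)) lD (length≤# u ∈ᵇ⁺))
          ... | x , y , _ , ux , yD , g = dead (∈ᵇ⁻ yD) ux g

        push : ∀ {c₁ c₂ r st D₁ D₂ U v} → State c₁ c₂ (suc r) st D₁ D₂ U → T (U v) →
          Stack r (v ∷ st) → State c₁ c₂ r (v ∷ st) D₁ D₂ (U ∖ (v ∷ []))
        push {r = r} {st} {D₁} {D₂} {U} {v} s uv stk = record
          { stack = stk
          ; len   = trans (+-suc r (length st)) len
          ; len₁ = len₁ ; len₂ = len₂
          ; uniq₁ = unique-∷ (∉-++ st (proj₁ (fresh uv)) (proj₁ (proj₂ (fresh uv)))) uniq₁
          ; uniq₂ = unique-∷ (∉-++ st (proj₁ (fresh uv)) (proj₂ (proj₂ (fresh uv)))) uniq₂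
          ; fresh = λ h → let a , b = ∖⁻ h ; c , d = fresh a in ∉-∷ (b ∘ here) c , d
          ; dead₁ = λ h k → dead₁ h (proj₁ (∖⁻ k))
          ; dead₂ = λ h k → dead₂ h (proj₁ (∖⁻ k))
          ; stM   = λ { (here refl) → UM uv ; (there h) → stM h }
          ; UM    = UM ∘ proj₁ ∘ ∖⁻
          ; count = lin 0 (count ⊕ #-∖ U (v ∷ [])) (eq (# M) (# U) _ (length st) (length D₁) (length D₂))
          }
          where
          open State s
          eq : ∀ M u u' s a b → u' + (suc s + (a + b)) + (M + u) ≡ M + (u + (s + (a + b)) + (1 + u')) + 0
          eq = solve-∀

        popped : ∀ {r t st} → suc r + length (t ∷ st) ≡ suc ℓ → Stack (suc r) (t ∷ st) → Stack (suc (suc r)) st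
        popped {r} {st = []}      l _           = trans (sym (+-comm (suc r) 1)) l
        popped {st = x ∷ st}      l (q , e ∷ p) = q , p

        pop₁ : ∀ {c₁ c₂ r t st D₁ D₂ U} → State (suc c₁) c₂ (suc r) (t ∷ st) D₁ D₂ U →
          Dead true (t ∷ []) U → State c₁ c₂ (suc (suc r)) st (t ∷ D₁) D₂ U
        pop₁ {c₁} {r = r} {t} {st} {D₁} {D₂} {U} s d = record
          { stack = popped len stack
          ; len   = trans (sym (+-suc (suc r) (length st))) len
          ; len₁  = trans (+-suc c₁ (length D₁)) len₁ ; len₂ = len₂
          ; uniq₁ = unique-↭ (↭-sym (shift t st D₁)) uniq₁
          ; uniq₂ = unique-++ʳ (t ∷ []) uniq₂
          ; fresh = λ h → let a , b , c = fresh h in a ∘ there , ∉-∷ (a ∘ here) b , c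
          ; dead₁ = λ { (here refl) → d (here refl) ; (there h) → dead₁ h }
          ; dead₂ = dead₂
          ; stM   = stM ∘ there
          ; UM    = UM
          ; count = subst (# M ≤_) (eq (# U) (length st) (length D₁) (length D₂)) count
          }
          where
          open State s
          eq : ∀ u s a b → u + (suc s + (a + b)) ≡ u + (s + (suc a + b))
          eq = solve-∀

        pop₂ : ∀ {c₁ c₂ r t st D₁ D₂ U} → State c₁ (suc c₂) (suc r) (t ∷ st) D₁ D₂ U →
          Dead false (t ∷ []) U → State c₁ c₂ (suc (suc r)) st D₁ (t ∷ D₂) U
        pop₂ {c₂ = c₂} {r} {t} {st} {D₁} {D₂} {U} s d = record
          { stack = popped len stack
          ; len   = trans (sym (+-suc (suc r) (length st))) len
          ; len₁  = len₁ ; len₂ = trans (+-suc c₂ (length D₂)) len₂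
          ; uniq₁ = unique-++ʳ (t ∷ []) uniq₁
          ; uniq₂ = unique-↭ (↭-sym (shift t st D₂)) uniq₂
          ; fresh = λ h → let a , b , c = fresh h in a ∘ there , b , ∉-∷ (a ∘ here) c
          ; dead₁ = dead₁
          ; dead₂ = λ { (here refl) → d (here refl) ; (there h) → dead₂ h }
          ; stM   = stM ∘ there
          ; UM    = UM
          ; count = subst (# M ≤_) (eq (# U) (length st) (length D₁) (length D₂)) count
          }
          where
          open State s
          eq : ∀ u s a b → u + (suc s + (a + b)) ≡ u + (s + (a + suc b))
          eq = solve-∀

        Reachable : ℕ → ℕ → ℕ → Set
        Reachable c₁ c₂ r = ∃[ st ] ∃[ D₁ ] ∃[ D₂ ] ∃[ U ] State c₁ c₂ r st D₁ D₂ U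

        step : ∀ {c₁ c₂ r} → Reachable (suc c₁) (suc c₂) (suc r) →
          Reachable (suc c₁) (suc c₂) r ⊎ Reachable c₁ (suc c₂) (suc (suc r)) ⊎ Reachable (suc c₁) c₂ (suc (suc r))
        step ([] , _ , _ , _ , s) with #-witness (≤-trans 1≤m (State.unvisited s))
        ... | v , uv = inj₁ (_ , _ , _ , _ , push s uv
            (v , subst (λ z → Walk (z + i) v [] (ℓ + i) v) (sym (suc-injective (State.stack s))) []))
        step {r = r} (t ∷ st , _ , _ , U , s) with any? (λ v → T? (U v ∧ dir G (o (r + i)) v t))
        ... | yes (v , h) = let a , b = ∧⁻ {U v} h in
          inj₁ (_ , _ , _ , _ , push s a (proj₁ (State.stack s) , fromG b ∷ proj₂ (State.stack s)))
        -- Lacking an unvisited neighbour in one direction says nothing about the other, so the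
        -- orientation required here decides which dead set receives `t`.
        ... | no none with o (r + i)
        ... | true  = inj₂ (inj₁ (_ , _ , _ , _ , pop₁ s λ { (here refl) {u} uu g → none (u , ∧⁺ uu g) }))
        ... | false = inj₂ (inj₂ (_ , _ , _ , _ , pop₂ s λ { (here refl) {u} uu g → none (u , ∧⁺ uu g) }))

        -- Terminates lexicographically in the three numbers: a drop raises `r` but lowers a
        -- counter, a push lowers `r`. A counter at zero means `m` dead vertices, which `G` would
        -- join to `U`.
        loop : ∀ c₁ c₂ r → Reachable c₁ c₂ r → Found
        loop zero c₂ r (st , D₁ , _ , _ , s) = ⊥-elim (no-dead true D₁ (unique-++ʳ st uniq₁) len₁ dead₁)
          where open State s
        loop (suc c₁) zero r (st , _ , D₂ , _ , s) = ⊥-elim (no-dead false D₂ (unique-++ʳ st uniq₂) len₂ dead₂)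
          where open State s
        loop (suc c₁) (suc c₂) zero (v ∷ st , _ , _ , _ , s) =
          v , st , proj₁ stack , proj₂ stack , unique-++ˡ (v ∷ st) uniq₁ , stM
          where open State s
        loop (suc c₁) (suc c₂) (suc r) s =
          [ loop (suc c₁) (suc c₂) r
          , [ loop c₁ (suc c₂) (suc (suc r)) , loop (suc c₁) c₂ (suc (suc r)) ]′
          ]′ (step s)

        opaque
          long-walk : Found
          long-walk = loop m m (suc ℓ) ([] , [] , [] , M , record
            { stack = refl ; len = +-identityʳ _ ; len₁ = +-identityʳ m ; len₂ = +-identityʳ m
            ; uniq₁ = [] ; uniq₂ = [] ; fresh = λ _ → (λ ()) , (λ ()) , (λ ())
            ; dead₁ = λ () ; dead₂ = λ () ; stM = λ () ; UM = id
            ; count = ≤-reflexive (sym (+-identityʳ (# M))) })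

      -- Closing a walk by a stretch of prescribed length.

      avoid₄ : ∀ P F → 5 * w ≤ # P → length F ≤ 4 * w → m ≤ # (P ∖ F)
      avoid₄ P F h l = ≤-trans m≤w (subst (_≤ # (P ∖ F)) (*-identityˡ w) (budget {P} {F} 4 1 l h))

      opaque
        near : Bool → (Fin m → V) → V → Bool
        near e σ v = does (any? λ k → T? (dir G e (σ k) v))

        near⁻ : ∀ {e σ v} → T (near e σ v) → ∃[ k ] T (dir G e (σ k) v)
        near⁻ {e} {σ} {v} = does⁻ (any? λ k → T? (dir G e (σ k) v))

        near⁺ : ∀ {e σ v} k → T (dir G e (σ k) v) → T (near e σ v)
        near⁺ {e} {σ} {v} k g = does⁺ (any? λ k → T? (dir G e (σ k) v)) (k , g)

      -- The image of `σ` has `m` members and sends no edge of `G` in direction `e` to the far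
      -- vertices, so `joined-dir` keeps the latter few.
      few-far : ∀ e σ → Injective σ → # (not ∘ near e σ) ≤ m
      few-far e σ inj with # (not ∘ near e σ) ≤? m
      ... | yes h = h
      ... | no  h with joined-dir e (_∈ᵇ tabulate σ) (not ∘ near e σ)
                       (injective≤# {P = _∈ᵇ tabulate σ} inj (λ i → ∈ᵇ⁺ (∈-tabulate⁺ i))) (<⇒≤ (≰⇒> h))
      ... | x , v , _ , x∈ , far , g with ∈-tabulate⁻ (∈ᵇ⁻ {xs = tabulate σ} x∈)
      ... | k , refl = ⊥-elim (T-not⁻ far (near⁺ k g))

      -- The offset in `2 + L` is the two inner vertices of a bare `link`, the case `L = 0`.
      Closing : List V → ℕ → V → V → ℕ → Set
      Closing F i u v L = ∃[ zs ] ∃[ j ] (length zs ≡ 2 + L × Walk i u (zs ++ v ∷ []) j v × Unique (zs ++ F))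

      last∈ : ∀ {i u xs j v} → Walk i u xs j v → v ∈ u ∷ xs
      last∈ []      = here refl
      last∈ (e ∷ w) = there (last∈ w)

      glue : ∀ {F i u v ℓ x p ps q y} → Unique F → Walk (2 + i) p ps (ℓ + (2 + i)) q → Unique (p ∷ ps) →
        T (E (o i) u x) → T (E (o (1 + i)) x p) → T (E (o (ℓ + (2 + i))) q y) → T (E (o (suc (ℓ + (2 + i)))) y v) →
        x ∉ F → y ∉ F → y ≢ x → (∀ {z} → z ∈ p ∷ ps → z ∉ y ∷ x ∷ F) → Closing F i u v (suc ℓ)
      glue {F} {i} {u} {v} {ℓ} {x} {p} {ps} {q} {y} uF mid upq ux xp qy yv x∉ y∉ y≢x path∉ =
        x ∷ p ∷ (ps ++ y ∷ []) , _ , len , walk , uniq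
        where
        walk : Walk i u (x ∷ p ∷ (ps ++ y ∷ []) ++ v ∷ []) _ v
        walk = ux ∷ xp ∷ subst (λ l → Walk (2 + i) p l _ v) (sym (++-assoc ps (y ∷ []) (v ∷ []))) (mid ++ʷ qy ∷ yv ∷ [])
        len : 2 + length (ps ++ y ∷ []) ≡ 2 + suc ℓ
        len = cong (2 +_) (trans (length-++ ps) (trans (+-comm (length ps) 1)
                (cong (1 +_) (sym (+-cancelʳ-≡ (2 + i) ℓ (length ps) (walk-length mid))))))
        uniq : Unique (x ∷ p ∷ (ps ++ y ∷ []) ++ F)
        uniq = unique-↭
          (solve↭ 5 (λ p ps y x F → ((p ⊞ ps) ⊞ (y ⊞ (x ⊞ F))) ⊜↭ ((x ⊞ (p ⊞ (ps ⊞ y))) ⊞ F)) ↭-refl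
            (p ∷ []) ps (y ∷ []) (x ∷ []) F)
          (unique-++ upq (unique-∷ (∉-∷ y≢x y∉) (unique-∷ x∉ uF)) path∉)

      near-both : ∀ e e′ σ σ′ Z → Injective σ → Injective σ′ →
        n ≤ m + m + (length Z + # ((λ x → near e σ x ∧ near e′ σ′ x) ∖ Z))
      near-both e e′ σ σ′ Z inj inj′ = begin
        n                  ≡⟨ sym #-true ⟩
        # {n} (λ _ → true) ≤⟨ #-∨ {Q = both} {R = λ x → not (near e σ x) ∨ not (near e′ σ′ x)} (λ x → cover {near e σ x} {near e′ σ′ x}) ⟩
        # both + # (λ x → not (near e σ x) ∨ not (near e′ σ′ x))
          ≤⟨ +-mono-≤ (#-∖ both Z) (#-∨ {Q = not ∘ near e σ} {R = not ∘ near e′ σ′} (λ x → Equivalence.to (T-∨ {not (near e σ x)}))) ⟩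
        length Z + # (both ∖ Z) + (# (not ∘ near e σ) + # (not ∘ near e′ σ′))
          ≤⟨ +-monoʳ-≤ (length Z + # (both ∖ Z)) (few-far e σ inj ⊕ few-far e′ σ′ inj′) ⟩
        length Z + # (both ∖ Z) + (m + m)   ≡⟨ +-comm (length Z + # (both ∖ Z)) (m + m) ⟩
        m + m + (length Z + # (both ∖ Z))   ∎
        where
        open ≤-Reasoning
        both : V → Bool
        both x = near e σ x ∧ near e′ σ′ x
        cover : ∀ {a b} → T true → T (a ∧ b) ⊎ T (not a ∨ not b)
        cover {true}  {true}  _ = inj₁ tt
        cover {true}  {false} _ = inj₂ tt
        cover {false}         _ = inj₂ tt

      -- The search has no control over the ends of the walk it returns. It is therefore confined to
      -- vertices near both `σ`, a set of suitable neighbours of `u`, and `τ`, the same for `v`: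
      -- then any first vertex can be attached to `u` through `σ`, and any last one to `v` through
      -- `τ`.
      close-via : ∀ {F} i u v ℓ (σ τ : Fin m → V) → Unique F → length F + suc ℓ + 7 * m ≤ n →
        Injective σ → (∀ k → T ((dir R (o i) u ∖ F) (σ k))) →
        Injective τ → (∀ k → T (((λ y → dir R (o (suc (ℓ + (2 + i)))) y v) ∖ (tabulate σ ++ F)) (τ k))) →
        Closing F i u v (suc ℓ)
      close-via {F} i u v ℓ σ τ uF room σ-inj σ-mem τ-inj τ-mem =
        assemble (DepthFirst.long-walk (2 + i) ℓ M large)
        where
        e₁ e₂ : Bool
        e₁ = o (1 + i)
        e₂ = o (ℓ + (2 + i))
        Z : List V
        Z = tabulate τ ++ tabulate σ ++ F
        M : V → Bool
        M = (λ x → near e₁ σ x ∧ near (not e₂) τ x) ∖ Z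
        lZ : length Z ≡ m + (m + length F)
        lZ = trans (length-++ (tabulate τ)) (cong₂ _+_ (length-tabulate τ)
               (trans (length-++ (tabulate σ)) (cong (_+ length F) (length-tabulate σ))))
        large : suc ℓ + 3 * m ≤ # M
        -- The 7m of `room`: 2m vertices far from `σ` or `τ`, 2m for `σ` and `τ` themselves, and the
        -- margin 3m of the search.
        large = lin 0 (near-both e₁ (not e₂) σ τ Z σ-inj τ-inj ⊕ room ⊕ ≤-reflexive lZ)
                  (eq m ℓ (length F) (length Z) (# M) n)
          where
          eq : ∀ m ℓ f z M n → M + (n + (f + suc ℓ + 7 * m) + z)
               ≡ suc ℓ + 3 * m + (m + m + (z + M) + n + (m + (m + f))) + 0
          eq = solve-∀
        join : ∀ {p ps q} → Walk (2 + i) p ps (ℓ + (2 + i)) q → Unique (p ∷ ps) → (∀ {z} → z ∈ p ∷ ps → z ∉ Z) →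
          ∃[ k ] T (dir G e₁ (σ k) p) → ∃[ k ] T (dir G (not e₂) (τ k) q) → Closing F i u v (suc ℓ)
        join {q = q} mid upq ∉Z (k₁ , g₁) (k₂ , g₂) =
          glue uF mid upq (fromR (proj₁ x∈)) (fromG g₁) (fromG (subst T (dir-not G e₂ (τ k₂) q) g₂)) (fromR (proj₁ y∈))
            (proj₂ x∈) (λ h → proj₂ y∈ (∈-++⁺ʳ (tabulate σ) h))
            (λ e → proj₂ y∈ (∈-++⁺ˡ (subst (_∈ tabulate σ) (sym e) (∈-tabulate⁺ k₁))))
            (λ h → ∉-∷ (λ e → ∉Z h (∈-++⁺ˡ (subst (_∈ tabulate τ) (sym e) (∈-tabulate⁺ k₂))))
                     (∉-∷ (λ e → ∉Z h (∈-++⁺ʳ (tabulate τ) (∈-++⁺ˡ (subst (_∈ tabulate σ) (sym e) (∈-tabulate⁺ k₁)))))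
                       (∉Z h ∘ ∈-++⁺ʳ (tabulate τ) ∘ ∈-++⁺ʳ (tabulate σ))))
          where
          x∈ = ∖⁻ (σ-mem k₁)
          y∈ = ∖⁻ (τ-mem k₂)
        assemble : DepthFirst.Found (2 + i) ℓ M large → Closing F i u v (suc ℓ)
        assemble (p , ps , q , mid , upq , inM) = join mid upq (λ h → proj₂ (∖⁻ (inM h)))
          (near⁻ (proj₁ (∧⁻ {near e₁ σ p} (proj₁ (∖⁻ (inM (here refl)))))))
          (near⁻ (proj₂ (∧⁻ {near e₁ σ q} (proj₁ (∖⁻ (inM (last∈ mid)))))))

      close : ∀ {F} → Unique F → length F ≤ 2 * w → ∀ i u v L → length F + L + 7 * m ≤ n → Closing F i u v L
      close {F} uF lF i u v L room = go L room
        where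
        lF₄ : length F ≤ 4 * w
        lF₄ = ≤-trans lF (*-monoˡ-≤ w {2} {4} (s≤s (s≤s z≤n)))
        short : ∃[ x ] ∃[ y ] (x ∉ F × y ∉ (x ∷ F) × Walk i u (x ∷ y ∷ v ∷ []) (3 + i) v) → Closing F i u v 0
        short (x , y , x∉ , y∉ , walk) = x ∷ y ∷ [] , _ , refl , walk ,
          unique-↭ (shift x (y ∷ []) F) (unique-∷ y∉ (unique-∷ x∉ uF))
        go : ∀ L → length F + L + 7 * m ≤ n → Closing F i u v L
        go zero    room = short (link F i u v lF₄)
        go (suc ℓ) room =
          let σ , σ-inj , σ-mem = pick m (avoid₄ (dir R (o i) u) F (degree (o i) u) lF₄)
              τ , τ-inj , τ-mem = pick m (avoid₄ (λ y → dir R (o (suc (ℓ + (2 + i)))) y v) (tabulate σ ++ F)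
                                    (codegree (o (suc (ℓ + (2 + i)))) v) (lσF σ))
          in close-via i u v ℓ σ τ uF room σ-inj σ-mem τ-inj τ-mem
          where
          lσF : ∀ σ → length (tabulate σ ++ F) ≤ 4 * w
          lσF σ = subst (_≤ 4 * w) (sym (trans (length-++ (tabulate σ)) (cong (_+ length F) (length-tabulate σ))))
            (lin w (m≤w ⊕ lF) (eq w m (length F)))
            where
            eq : ∀ w m f → 4 * w + (m + f) ≡ m + f + (w + 2 * w) + w
            eq = solve-∀

      -- Walks with holes, and exchanges that widen what a hole accepts.

      module Holes (u₀ : V) where

        -- A walk from u₀ with k holes: F lists its fixed vertices, and acc i tells which vertices
        -- may be put into the i-th hole, possibly after rearranging the other vertices of the walk.
        record Holed {k} (F : List V) (acc : Fin k → V → Bool) : Set where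
          field
            end  : ℕ
            last : V
            fill : ∀ vs → (∀ i → T (acc i (vs i))) →
                   ∃[ xs ] (Walk 0 u₀ xs end last × u₀ ∷ xs ↭ tabulate vs ++ F)
            size : suc end ≡ k + length F

        trivial : Holed {0} (u₀ ∷ []) (λ ())
        trivial = record { end = 0 ; last = u₀ ; fill = λ vs _ → [] , [] , ↭-refl ; size = refl }

        Gap : ℕ → V → V → V → Bool
        Gap j a b v = E (o j) a v ∧ E (o (1 + j)) v b

        module _ {k F} {acc : Fin k → V → Bool} (H : Holed F acc) where
          open Holed H

          extend : ∀ {ys j v} → Walk end last ys j v → Holed (ys ++ F) acc
          extend {ys} {j} {v} walk = record
            { end = j ; last = v ; fill = fill′
            ; size = trans (cong suc (walk-length walk)) (trans (sym (+-suc (length ys) end))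
                (trans (cong (length ys +_) size) (trans (eq (length ys) k (length F)) (cong (k +_) (sym (length-++ ys))))))
            }
            where
            eq : ∀ y k f → y + (k + f) ≡ k + (y + f)
            eq = solve-∀
            fill′ : ∀ vs → (∀ i → T (acc i (vs i))) → ∃[ xs ] (Walk 0 u₀ xs j v × u₀ ∷ xs ↭ tabulate vs ++ (ys ++ F))
            fill′ vs fit with fill vs fit
            ... | xs , p , perm = xs ++ ys , p ++ʷ walk , ↭-trans (++⁺ʳ ys perm)
              (solve↭ 3 (λ t y f → ((t ⊞ f) ⊞ y) ⊜↭ (t ⊞ (y ⊞ f))) ↭-refl (tabulate vs) ys F)

          open-gap : ∀ b → Holed (b ∷ F) (Gap end last b ◂ acc)
          open-gap b = record
            { end = 2 + end ; last = b ; fill = fill′ ; size = cong suc (trans (cong suc size) (sym (+-suc k (length F)))) }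
            where
            fill′ : ∀ vs → (∀ i → T ((Gap end last b ◂ acc) i (vs i))) →
              ∃[ xs ] (Walk 0 u₀ xs (2 + end) b × u₀ ∷ xs ↭ tabulate vs ++ (b ∷ F))
            fill′ vs fit with fill (vs ∘ suc) (fit ∘ suc)
            ... | xs , p , perm = xs ++ vs zero ∷ b ∷ [] ,
              (p ++ʷ proj₁ (∧⁻ {E (o end) last (vs zero)} (fit zero)) ∷ proj₂ (∧⁻ {E (o end) last (vs zero)} (fit zero)) ∷ []) ,
              ↭-trans (++⁺ʳ (vs zero ∷ b ∷ []) perm)
                (solve↭ 4 (λ t f v b → ((t ⊞ f) ⊞ (v ⊞ b)) ⊜↭ (v ⊞ (t ⊞ (b ⊞ f)))) ↭-refl
                  (tabulate (vs ∘ suc)) F (vs zero ∷ []) (b ∷ []))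

        -- Since y fits both the first hole and the new gap, either of the two may be left to y.
        add-gap : ∀ {k F} {B : V → Bool} {acc : Fin k → V → Bool} (H : Holed F (B ◂ acc)) → ∀ {y} b →
          T (B y) → T (Gap (Holed.end H) (Holed.last H) b y) →
          Holed (b ∷ y ∷ F) ((λ v → B v ∨ Gap (Holed.end H) (Holed.last H) b v) ◂ acc)
        add-gap {k} {F} {B} {acc} H {y} b By gap = record
          { end = 2 + end ; last = b ; fill = λ vs fit → fill′ vs (fit ∘ suc) (Equivalence.to (T-∨ {B (vs zero)}) (fit zero))
          ; size = trans (cong (2 +_) size) (eq k (length F)) }
          where
          open Holed H
          eq : ∀ k f → 2 + (suc k + f) ≡ suc k + (2 + f)
          eq = solve-∀
          cons : ∀ {v} {vs : Fin k → V} → T (B v) → (∀ i → T (acc i (vs i))) → ∀ i → T ((B ◂ acc) i ((v ◂ vs) i))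
          cons h f zero    = h
          cons h f (suc i) = f i
          fill′ : ∀ vs → (∀ i → T (acc i (vs (suc i)))) → T (B (vs zero)) ⊎ T (Gap end last b (vs zero)) →
            ∃[ xs ] (Walk 0 u₀ xs (2 + end) b × u₀ ∷ xs ↭ tabulate vs ++ (b ∷ y ∷ F))
          fill′ vs fit (inj₁ h) with fill (vs zero ◂ vs ∘ suc) (cons h fit)
          ... | xs , p , perm = xs ++ y ∷ b ∷ [] ,
            (p ++ʷ proj₁ (∧⁻ {E (o end) last y} gap) ∷ proj₂ (∧⁻ {E (o end) last y} gap) ∷ []) ,
            ↭-trans (++⁺ʳ (y ∷ b ∷ []) perm)
              (solve↭ 5 (λ v t f y b → ((v ⊞ (t ⊞ f)) ⊞ (y ⊞ b)) ⊜↭ (v ⊞ (t ⊞ (b ⊞ (y ⊞ f))))) ↭-refl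
                (vs zero ∷ []) (tabulate (vs ∘ suc)) F (y ∷ []) (b ∷ []))
          fill′ vs fit (inj₂ g) with fill (y ◂ vs ∘ suc) (cons By fit)
          ... | xs , p , perm = xs ++ vs zero ∷ b ∷ [] ,
            (p ++ʷ proj₁ (∧⁻ {E (o end) last (vs zero)} g) ∷ proj₂ (∧⁻ {E (o end) last (vs zero)} g) ∷ []) ,
            ↭-trans (++⁺ʳ (vs zero ∷ b ∷ []) perm)
              (solve↭ 5 (λ v t f y b → ((y ⊞ (t ⊞ f)) ⊞ (v ⊞ b)) ⊜↭ (v ⊞ (t ⊞ (b ⊞ (y ⊞ f))))) ↭-refl
                (vs zero ∷ []) (tabulate (vs ∘ suc)) F (y ∷ []) (b ∷ []))

        -- Two exchanges in a row: `y` fits the current hole and the gap from `c` to `d`; `z` fits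
        -- that gap and the one from `a` to `b`. Here `Y` is accepted and `X` refused so far; the
        -- middle gap bridges the two when no vertex of `Y` fits between `a` and `b`.
        record Switch (F : List V) (X Y : V → Bool) (e₁ f₁ e₂ f₂ : Bool) (t : ℕ) : Set where
          field
            {a b c d y z} : V
            fresh : Unique F → Unique (z ∷ c ∷ y ∷ d ∷ b ∷ a ∷ F)
            Yy  : T (Y y)
            Xz  : T (X z)
            cy  : T (E e₁ c y)
            yd  : T (E f₁ y d)
            cz  : T (E e₁ c z)
            zd  : T (E f₁ z d)
            az  : T (E e₂ a z)
            zb  : T (E f₂ z b)
            many : t ≤ # (λ v → X v ∧ (dir R e₂ a v ∧ dir R f₂ v b))

        remaining : ∀ {s} {P : V → Bool} F → length F + s ≤ # P → s ≤ # (P ∖ F)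
        remaining {s} {P} F h = +-cancelˡ-≤ (length F) s _ (≤-trans h (#-∖ P F))

        -- The gap from c to d can be filled by y as well as by z: c → y and z → d come from the dense
        -- digraph, and as y and c run through large sets, y → d and c → z are found in the joined one.
        switch : ∀ {F X Y t} e₁ f₁ e₂ f₂ → (∀ {v} → T (X v) → v ∉ F) → (∀ {v} → T (Y v) → v ∉ F) →
          5 + length F ≤ 2 * w → A * (A * t) ≤ # X → A * (m + 12) ≤ t → 2 + m ≤ # Y →
          Switch F X Y e₁ f₁ e₂ f₂ t
        switch {F} {X} {Y} {t} e₁ f₁ e₂ f₂ X∉ Y∉ lF hX ht hY =
          gap-ab (good-gap {F} {X} {t} e₂ f₂ 1≤t (≤-trans (m≤n+m _ 4) lF) hX)
          where
          1≤t : 1 ≤ t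
          1≤t = ≤-trans (*-mono-≤ 1≤A (≤-trans 1≤m (m≤m+n m 12))) ht
          gap-ab : ∃[ a ] ∃[ b ] (a ∉ F × b ∉ (a ∷ F) × t ≤ # (λ v → X v ∧ (dir R e₂ a v ∧ dir R f₂ v b))) →
            Switch F X Y e₁ f₁ e₂ f₂ t
          gap-ab (a , b , a∉ , b∉ , many) = gap-yd
            (joined-dir f₁ (Y ∖ (b ∷ a ∷ [])) (D ∖ (b ∷ a ∷ F)) (remaining {P = Y} (b ∷ a ∷ []) hY)
              (dense f₁ {X₂} {m + 12} {b ∷ a ∷ F} (≤-trans 1≤m (m≤m+n m 12)) (≤-trans (m≤n+m _ 3) lF)
                (≤-trans ht many)))
            where
            X₂ D : V → Bool
            X₂ v = X v ∧ (dir R e₂ a v ∧ dir R f₂ v b)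
            -- The admissible `d` keep enough candidates for `z`. That they are many costs a third
            -- factor `A`, whence the cube in the lower bound on `κ`.
            D d = (m + 12) ≤ᵇ # (λ x → X₂ x ∧ dir R f₁ x d)
            gap-yd : ∃[ y ] ∃[ d ] (y ≢ d × T ((Y ∖ (b ∷ a ∷ [])) y) × T ((D ∖ (b ∷ a ∷ F)) d) × T (dir G f₁ y d)) →
              Switch F X Y e₁ f₁ e₂ f₂ t
            gap-yd (y , d , y≢d , Yy , Dd , yd) = gap-cz
              (joined-dir e₁ ((λ c → dir R e₁ c y) ∖ (y ∷ d ∷ b ∷ a ∷ F)) (X₃ ∖ (y ∷ d ∷ b ∷ a ∷ []))
                (avoid₄ (λ c → dir R e₁ c y) (y ∷ d ∷ b ∷ a ∷ F) (codegree e₁ y)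
                  (≤-trans (≤-trans (n≤1+n _) lF) (*-monoˡ-≤ w {2} {4} (s≤s (s≤s z≤n)))))
                (remaining {P = X₃} (y ∷ d ∷ b ∷ a ∷ [])
                  (≤-trans (≤-trans (≤-reflexive (+-comm 4 m)) (+-monoʳ-≤ m (m≤m+n 4 8)))
                     (≤ᵇ⇒≤ (m + 12) _ (proj₁ (∖⁻ Dd))))))
              where
              X₃ : V → Bool
              X₃ v = X₂ v ∧ dir R f₁ v d
              y∉ba = proj₂ (∖⁻ Yy)
              y∉F = Y∉ (proj₁ (∖⁻ Yy))
              gap-cz : ∃[ c ] ∃[ z ] (c ≢ z × T (((λ c → dir R e₁ c y) ∖ (y ∷ d ∷ b ∷ a ∷ F)) c) ×
                  T ((X₃ ∖ (y ∷ d ∷ b ∷ a ∷ [])) z) × T (dir G e₁ c z)) → Switch F X Y e₁ f₁ e₂ f₂ t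
              gap-cz (c , z , c≢z , hc , hz , cz) = record
                { fresh = λ uF → unique-∷ (∉-∷ (c≢z ∘ sym) (∉-++ (y ∷ d ∷ b ∷ a ∷ []) (proj₂ (∖⁻ hz)) (X∉ (proj₁ Xz))))
                    (unique-∷ (proj₂ (∖⁻ hc)) (unique-∷ (∉-∷ y≢d (∉-++ (b ∷ a ∷ []) y∉ba y∉F))
                      (unique-∷ (proj₂ (∖⁻ Dd)) (unique-∷ b∉ (unique-∷ a∉ uF)))))
                ; Yy = proj₁ (∖⁻ Yy) ; Xz = proj₁ Xz
                ; cy = fromR (proj₁ (∖⁻ hc)) ; yd = fromG yd ; cz = fromG cz ; zd = fromR (proj₂ X₂z)
                ; az = fromR (proj₁ (∧⁻ {dir R e₂ a z} (proj₂ Xz))) ; zb = fromR (proj₂ (∧⁻ {dir R e₂ a z} (proj₂ Xz)))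
                ; many = many }
                where
                X₂z = ∧⁻ {X₂ z} (proj₁ (∖⁻ hz))
                Xz = ∧⁻ {X z} (proj₁ X₂z)

        -- A round fixes ten vertices: the six of a `Switch` and two for each of the links leading
        -- to `c` and to `a`. The field `accepted` restores the precondition of the next round.
        record Growth {k} (F : List V) (B : V → Bool) (acc : Fin k → V → Bool) (t : ℕ) : Set where
          field
            {F′} : List V
            {B′} : V → Bool
            holed    : Holed F′ (B′ ◂ acc)
            uniq     : Unique F′
            incl     : ∀ {v} → v ∈ F → v ∈ F′
            size     : length F′ ≡ 10 + length F
            refused  : # ((not ∘ B′) ∖ F′) + t ≤ # ((not ∘ B) ∖ F)
            accepted : 2 + m ≤ # (B′ ∖ F′)

        grow : ∀ {k F B} {acc : Fin k → V → Bool} {t} → Holed F (B ◂ acc) → Unique F → 12 + length F ≤ 2 * w →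
          A * (A * t) ≤ # ((not ∘ B) ∖ F) → A * (m + 12) ≤ t → 2 + m ≤ # (B ∖ F) → Growth F B acc t
        grow {k} {F} {B} {acc} {t} H uF lF hX ht hY = via
            -- The positions are known beforehand: a link puts `c` at `3 + end`, the gap puts `d` at
            -- `5 + end`, and the next link puts `a` at `8 + end`.
            (switch {F} {(not ∘ B) ∖ F} {B ∖ F} (o (3 + end)) (o (4 + end)) (o (8 + end)) (o (9 + end))
              (proj₂ ∘ ∖⁻) (proj₂ ∘ ∖⁻) (≤-trans (m≤n+m _ 7) lF) hX ht hY)
          where
          open Holed H
          l₄ : ∀ {x} → x ≤ 2 * w → x ≤ 4 * w
          l₄ h = ≤-trans h (*-monoˡ-≤ w {2} {4} (s≤s (s≤s z≤n)))
          via : Switch F ((not ∘ B) ∖ F) (B ∖ F) (o (3 + end)) (o (4 + end)) (o (8 + end)) (o (9 + end)) t → Growth F B acc t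
          via S = links (link (z ∷ c ∷ y ∷ d ∷ b ∷ a ∷ F) end last c (l₄ (≤-trans (m≤n+m _ 6) lF)))
            where
            open Switch S
            links : ∃[ p ] ∃[ q ] (p ∉ z ∷ c ∷ y ∷ d ∷ b ∷ a ∷ F × q ∉ p ∷ z ∷ c ∷ y ∷ d ∷ b ∷ a ∷ F ×
              Walk end last (p ∷ q ∷ c ∷ []) (3 + end) c) → Growth F B acc t
            links (p , q , p∉ , q∉ , pqc) = finish
                (link (q ∷ p ∷ z ∷ c ∷ y ∷ d ∷ b ∷ a ∷ F) (5 + end) d a (l₄ (≤-trans (m≤n+m _ 4) lF)))
              where
              finish : ∃[ r ] ∃[ s ] (r ∉ q ∷ p ∷ z ∷ c ∷ y ∷ d ∷ b ∷ a ∷ F × s ∉ r ∷ q ∷ p ∷ z ∷ c ∷ y ∷ d ∷ b ∷ a ∷ F ×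
                Walk (5 + end) d (r ∷ s ∷ a ∷ []) (8 + end) a) → Growth F B acc t
              finish (r , s , r∉ , s∉ , rsa) = record
                { F′ = N ++ F
                ; B′ = B₂
                ; holed = add-gap (extend (add-gap (extend H pqc) {y} d (proj₁ (∖⁻ Yy)) (∧⁺ cy yd)) rsa) {z} b
                            (Equivalence.from (T-∨ {B z}) (inj₂ (∧⁺ cz zd))) (∧⁺ az zb)
                ; uniq = unique-↭ perm (unique-∷ s∉ (unique-∷ r∉ (unique-∷ q∉ (unique-∷ p∉ (fresh uF)))))
                ; incl = ∈-++⁺ʳ N
                ; size = refl
                ; refused = ≤-trans (+-monoʳ-≤ (# ((not ∘ B₂) ∖ (N ++ F))) many)
                    (#-split {P = (not ∘ B) ∖ F} {(not ∘ B₂) ∖ (N ++ F)} {X₂} sub₁ (λ v h → proj₁ (∧⁻ {((not ∘ B) ∖ F) v} h)) disjoint)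
                -- The origin of `m + 12`: ten newly fixed vertices may be lost, and `2 + m` must
                -- survive, so that a set of size `m` remains once `a` and `b` of the next round are
                -- excluded.
                ; accepted = ≤-trans (remaining {P = X₂} N (≤-trans (≤-trans (≤-reflexive (+-comm 12 m)) (≤-trans
                    (≤-trans (≤-reflexive (sym (*-identityˡ (m + 12)))) (*-monoˡ-≤ (m + 12) 1≤A)) ht)) many))
                    (#-mono λ v h → ∖⁺ (X₂⊆ v (proj₁ (∖⁻ h)))
                       (∉-++ N (proj₂ (∖⁻ h)) (proj₂ (∖⁻ (proj₁ (∧⁻ {((not ∘ B) ∖ F) v} (proj₁ (∖⁻ h))))))))
                }
                where
                N : List V
                N = b ∷ z ∷ r ∷ s ∷ a ∷ d ∷ y ∷ p ∷ q ∷ c ∷ []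
                B₁ B₂ X₂ : V → Bool
                B₁ v = B v ∨ Gap (3 + end) c d v
                B₂ v = B₁ v ∨ Gap (8 + end) a b v
                X₂ v = ((not ∘ B) ∖ F) v ∧ (dir R (o (8 + end)) a v ∧ dir R (o (9 + end)) v b)
                X₂⊆ : ∀ v → T (X₂ v) → T (B₂ v)
                X₂⊆ v h = let g = proj₂ (∧⁻ {((not ∘ B) ∖ F) v} h) ; g₁ , g₂ = ∧⁻ {dir R (o (8 + end)) a v} g
                  in Equivalence.from (T-∨ {B₁ v}) (inj₂ (∧⁺ (fromR g₁) (fromR g₂)))
                sub₁ : ∀ v → T (((not ∘ B₂) ∖ (N ++ F)) v) → T (((not ∘ B) ∖ F) v)
                sub₁ v h = ∖⁺ (T-not⁺ λ Bv → T-not⁻ (proj₁ (∖⁻ h)) (Equivalence.from (T-∨ {B₁ v}) (inj₁ (Equivalence.from (T-∨ {B v}) (inj₁ Bv)))))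
                              (λ v∈ → proj₂ (∖⁻ h) (∈-++⁺ʳ N v∈))
                disjoint : ∀ v → T (((not ∘ B₂) ∖ (N ++ F)) v) → T (X₂ v) → ⊥
                disjoint v h g = T-not⁻ (proj₁ (∖⁻ h)) (X₂⊆ v g)
                perm : s ∷ r ∷ q ∷ p ∷ z ∷ c ∷ y ∷ d ∷ b ∷ a ∷ F ↭ N ++ F
                perm = solve↭ 11 (λ s r q p z c y d b a F →
                    (s ⊞ (r ⊞ (q ⊞ (p ⊞ (z ⊞ (c ⊞ (y ⊞ (d ⊞ (b ⊞ (a ⊞ F)))))))))) ⊜↭
                    (b ⊞ (z ⊞ (r ⊞ (s ⊞ (a ⊞ (d ⊞ (y ⊞ (p ⊞ (q ⊞ (c ⊞ F))))))))))) ↭-refl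
                  (s ∷ []) (r ∷ []) (q ∷ []) (p ∷ []) (z ∷ []) (c ∷ []) (y ∷ []) (d ∷ []) (b ∷ []) (a ∷ []) F

        record Plugged {k} (F : List V) (acc : Fin k → V → Bool) (κ ℓ : ℕ) : Set where
          field
            {F′} : List V
            {B′} : V → Bool
            holed   : Holed F′ (B′ ◂ acc)
            uniq    : Unique F′
            incl    : ∀ {v} → v ∈ F → v ∈ F′
            size    : length F′ ≤ ℓ + length F
            refused : # ((not ∘ B′) ∖ F′) ≤ κ

        -- Widening one hole until it refuses at most `κ` vertices.

        module Plug (κ J s : ℕ) (suc-J : suc J ≡ 2 * (A * A)) (m≪κ : A * (A * (A * (m + 12))) ≤ κ)
          (κ≤w : κ ≤ w) (decay : J ^ s * n ≤ suc J ^ s * κ) where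

          -- `t` is the quotient of `u` by A². It is at least one, so rounding down loses at most a
          -- factor two: this is the 2 in `suc J = 2A²`.
          fraction : ∀ {u} → κ ≤ u → ∃[ t ] (A * (A * t) ≤ u × A * (m + 12) ≤ t × u ≤ suc J * t)
          fraction {u} κ≤u = t , AAt≤u , large , subst (λ j → u ≤ j * t) (sym suc-J) u≤
            where
            instance
              nz : NonZero (A * A)
              nz = >-nonZero (*-mono-≤ 1≤A 1≤A)
            Q = A * A
            t = u / Q
            u≡ : u ≡ u % Q + t * Q
            u≡ = m≡m%n+[m/n]*n u Q
            AAt≤u : A * (A * t) ≤ u
            AAt≤u = subst (_≤ u) (trans (*-comm t Q) (*-assoc A A t)) (m/n*n≤m u Q)
            large : A * (m + 12) ≤ t
            large = subst (_≤ t) (m*n/n≡m (A * (m + 12)) Q) (/-monoˡ-≤ Q (≤-trans (≤-reflexive (eq A (m + 12))) (≤-trans m≪κ κ≤u)))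
              where
              eq : ∀ a x → a * x * (a * a) ≡ a * (a * (a * x))
              eq = solve-∀
            u≤ : u ≤ 2 * Q * t
            u≤ = begin
              u               ≡⟨ u≡ ⟩
              u % Q + t * Q   ≤⟨ +-monoˡ-≤ (t * Q) (<⇒≤ (m%n<n u Q)) ⟩
              Q + t * Q       ≡⟨ cong (_+ t * Q) (sym (*-identityˡ Q)) ⟩
              1 * Q + t * Q   ≤⟨ +-monoˡ-≤ (t * Q) (*-monoˡ-≤ Q (≤-trans (*-mono-≤ 1≤A (≤-trans 1≤m (m≤m+n m 12))) large)) ⟩
              t * Q + t * Q   ≡⟨ eq t Q ⟩
              2 * Q * t       ∎
              where
              open ≤-Reasoning
              eq : ∀ t q → t * q + t * q ≡ 2 * q * t
              eq = solve-∀

          record Iterated {k} (r : ℕ) (F : List V) (B : V → Bool) (acc : Fin k → V → Bool) : Set where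
            field
              {F′} : List V
              {B′} : V → Bool
              holed   : Holed F′ (B′ ◂ acc)
              uniq    : Unique F′
              incl    : ∀ {v} → v ∈ F → v ∈ F′
              size    : length F′ ≤ 10 * r + length F
              refused : # ((not ∘ B′) ∖ F′) ≤ κ ⊎ suc J ^ r * # ((not ∘ B′) ∖ F′) ≤ J ^ r * # ((not ∘ B) ∖ F)

          -- A round newly accepts at least the fraction 1/(J+1) of the refused vertices, leaving at
          -- most J/(J+1) of them; the powers express this without division. It stops early at `κ`,
          -- where `grow` no longer has a large refused set to work on.
          iterate : ∀ {k} r {F B} {acc : Fin k → V → Bool} → Holed F (B ◂ acc) → Unique F →
            2 + 10 * suc r + length F ≤ 2 * w → 2 + m ≤ # (B ∖ F) → Iterated r F B acc
          iterate zero H u _ _ = record { holed = H ; uniq = u ; incl = id ; size = ≤-refl ; refused = inj₂ ≤-refl }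
          iterate {k} (suc r) {F} {B} {acc} H u lF hY with # ((not ∘ B) ∖ F) ≤? κ
          ... | yes done = record { holed = H ; uniq = u ; incl = id ; size = m≤n+m _ _ ; refused = inj₁ done }
          ... | no more = go (fraction (<⇒≤ (≰⇒> more)))
            where
            go : ∃[ t ] (A * (A * t) ≤ # ((not ∘ B) ∖ F) × A * (m + 12) ≤ t × # ((not ∘ B) ∖ F) ≤ suc J * t) →
              Iterated (suc r) F B acc
            go (t , h₁ , h₂ , h₃) = continue (grow H u (lin (10 * suc r) lF (eq₁ r (length F) (2 * w))) h₁ h₂ hY)
              where
              eq₁ : ∀ r f w → w + (2 + 10 * suc (suc r) + f) ≡ 12 + f + w + 10 * suc r
              eq₁ = solve-∀
              continue : Growth F B acc t → Iterated (suc r) F B acc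
              continue g = record
                { holed = I.holed ; uniq = I.uniq ; incl = I.incl ∘ g.incl
                ; size = ≤-trans I.size (≤-reflexive (trans (cong (10 * r +_) g.size) (eq₂ r (length F))))
                ; refused = [ inj₁ , inj₂ ∘ combine ]′ I.refused }
                where
                module g = Growth g
                eq₂ : ∀ r f → 10 * r + (10 + f) ≡ 10 * suc r + f
                eq₂ = solve-∀
                eq₃ : ∀ r f → 2 + 10 * suc r + (10 + f) ≡ 2 + 10 * suc (suc r) + f
                eq₃ = solve-∀
                I = iterate r g.holed g.uniq
                      (subst (_≤ 2 * w) (trans (sym (eq₃ r (length F))) (cong (2 + 10 * suc r +_) (sym g.size))) lF) g.accepted
                module I = Iterated I
                x = # ((not ∘ B) ∖ F)
                x′ = # ((not ∘ g.B′) ∖ g.F′)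
                drop : suc J * x′ ≤ J * x
                drop = lin 0 (*-monoʳ-≤ (suc J) g.refused ⊕ h₃) (eq J x x′ t)
                  where
                  eq : ∀ J x x′ t → J * x + (suc J * (x′ + t) + x) ≡ suc J * x′ + (suc J * x + suc J * t) + 0
                  eq = solve-∀
                combine : ∀ {y} → suc J ^ r * y ≤ J ^ r * x′ → suc J ^ suc r * y ≤ J ^ suc r * x
                combine {y} h = begin
                  suc J * suc J ^ r * y    ≡⟨ *-assoc (suc J) (suc J ^ r) y ⟩
                  suc J * (suc J ^ r * y)  ≤⟨ *-monoʳ-≤ (suc J) h ⟩
                  suc J * (J ^ r * x′)     ≡⟨ eq (suc J) (J ^ r) x′ ⟩
                  J ^ r * (suc J * x′)     ≤⟨ *-monoʳ-≤ (J ^ r) drop ⟩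
                  J ^ r * (J * x)          ≡⟨ eq′ J (J ^ r) x ⟩
                  J * J ^ r * x            ∎
                  where
                  open ≤-Reasoning
                  eq : ∀ a b c → a * (b * c) ≡ b * (a * c)
                  eq = solve-∀
                  eq′ : ∀ a b c → b * (a * c) ≡ a * b * c
                  eq′ = solve-∀

          -- The initial gap need only accept the `2 + m` vertices that the first round asks for. It
          -- fixes four vertices, its two ends and the two of a link; each round adds ten.
          plug : ∀ {k F} {acc : Fin k → V → Bool} → Holed F acc → Unique F → 16 + 10 * s + length F ≤ 2 * w →
            Plugged F acc κ (4 + 10 * s)
          plug {k} {F} {acc} H uF lF = begin-gap
              (good-gap {F} {X₀} {m + 12} (o (3 + end)) (o (4 + end)) (≤-trans 1≤m (m≤m+n m 12)) (≤-trans (m≤n+m _ (15 + 10 * s)) lF′) big)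
            where
            open Holed H
            lF′ : 15 + 10 * s + suc (length F) ≤ 2 * w
            lF′ = subst (_≤ 2 * w) (sym (+-suc (15 + 10 * s) (length F))) lF
            X₀ : V → Bool
            X₀ = (λ _ → true) ∖ F
            5w≤n : 5 * w ≤ # {n} (λ _ → true)
            5w≤n = ≤-trans (degree true u₀) (#-mono λ _ _ → tt)
            big : A * (A * (m + 12)) ≤ # X₀
            big = begin
              A * (A * (m + 12))        ≡⟨ sym (*-identityˡ _) ⟩
              1 * (A * (A * (m + 12)))  ≤⟨ *-monoˡ-≤ (A * (A * (m + 12))) 1≤A ⟩
              A * (A * (A * (m + 12)))  ≤⟨ m≪κ ⟩
              κ                         ≤⟨ κ≤w ⟩
              w                         ≤⟨ m≤m+n w _ ⟩
              3 * w                     ≤⟨ budget {λ _ → true} {F} 2 3 (≤-trans (m≤n+m _ (16 + 10 * s)) lF) 5w≤n ⟩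
              # X₀                      ∎
              where open ≤-Reasoning
            begin-gap : ∃[ a ] ∃[ b ] (a ∉ F × b ∉ (a ∷ F) × m + 12 ≤ # (λ v → X₀ v ∧ (dir R (o (3 + end)) a v ∧ dir R (o (4 + end)) v b))) →
              Plugged F acc κ (4 + 10 * s)
            begin-gap (a , b , a∉ , b∉ , many) = linked (link (b ∷ a ∷ F) end last a
                (≤-trans (≤-trans (m≤n+m _ (14 + 10 * s)) (subst (_≤ 2 * w) (sym (+-suc (14 + 10 * s) (suc (length F)))) lF′))
                   (*-monoˡ-≤ w {2} {4} (s≤s (s≤s z≤n)))))
              where
              linked : ∃[ p ] ∃[ q ] (p ∉ b ∷ a ∷ F × q ∉ p ∷ b ∷ a ∷ F × Walk end last (p ∷ q ∷ a ∷ []) (3 + end) a) →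
                Plugged F acc κ (4 + 10 * s)
              linked (p , q , p∉ , q∉ , walk) = finish (iterate s (open-gap (extend H walk) b)
                  (unique-↭ perm (unique-∷ q∉ (unique-∷ p∉ (unique-∷ b∉ (unique-∷ a∉ uF)))))
                  (subst (_≤ 2 * w) (eq s (length F)) lF)
                  accepted)
                where
                N : List V
                N = b ∷ p ∷ q ∷ a ∷ []
                B : V → Bool
                B = Gap (3 + end) a b
                X : V → Bool
                X v = X₀ v ∧ (dir R (o (3 + end)) a v ∧ dir R (o (4 + end)) v b)
                eq : ∀ s f → 16 + 10 * s + f ≡ 2 + 10 * suc s + (4 + f)
                eq = solve-∀
                perm : q ∷ p ∷ b ∷ a ∷ F ↭ N ++ F
                perm = solve↭ 5 (λ q p b a F → (q ⊞ (p ⊞ (b ⊞ (a ⊞ F)))) ⊜↭ (b ⊞ (p ⊞ (q ⊞ (a ⊞ F))))) ↭-refl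
                         (q ∷ []) (p ∷ []) (b ∷ []) (a ∷ []) F
                accepted : 2 + m ≤ # (B ∖ (N ++ F))
                accepted = ≤-trans (remaining {P = X} N (≤-trans (≤-trans (≤-reflexive (+-comm 6 m)) (+-monoʳ-≤ m (m≤m+n 6 6))) many))
                  (#-mono λ v h → let x₀ , g = ∧⁻ {X₀ v} (proj₁ (∖⁻ h)) ; g₁ , g₂ = ∧⁻ {dir R (o (3 + end)) a v} g in
                     ∖⁺ (∧⁺ (fromR g₁) (fromR g₂)) (∉-++ N (proj₂ (∖⁻ h)) (proj₂ (∖⁻ x₀))))
                finish : Iterated s (N ++ F) B acc → Plugged F acc κ (4 + 10 * s)
                finish I = record
                  { holed = I.holed ; uniq = I.uniq ; incl = I.incl ∘ ∈-++⁺ʳ N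
                  ; size = ≤-trans I.size (≤-reflexive (eq′ s (length F)))
                  ; refused = [ id , cancel ]′ I.refused }
                  where
                  module I = Iterated I
                  eq′ : ∀ s f → 10 * s + (4 + f) ≡ 4 + 10 * s + f
                  eq′ = solve-∀
                  cancel : suc J ^ s * # ((not ∘ I.B′) ∖ I.F′) ≤ J ^ s * # ((not ∘ B) ∖ (N ++ F)) → # ((not ∘ I.B′) ∖ I.F′) ≤ κ
                  cancel h = *-cancelˡ-≤ (suc J ^ s) ⦃ m^n≢0 (suc J) s ⦄ (≤-trans h (≤-trans
                    (*-monoʳ-≤ (J ^ s) (#-bound ((not ∘ B) ∖ (N ++ F)))) decay))

        -- The exchange argument: if σ j does not fit position j, some i can swap values with j.
        match : ∀ κ (acc : Fin (κ + κ) → V → Bool) (Q : V → Bool) →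
          (∀ v → T (Q v) → # (λ i → not (acc i v)) < κ) →
          (∀ i → # (λ v → Q v ∧ not (acc i v)) ≤ κ) →
          κ + κ ≤ # Q →
          ∃[ σ ] (Injective σ × (∀ i → T (Q (σ i))) × (∀ i → T (acc i (σ i))))
        match κ acc Q few-v few-i room =
          let σ , inj , mem , fit = fit-below (κ + κ) ≤-refl in σ , inj , mem , λ i → fit i (Fin.toℕ<n i)
          where
          k = κ + κ
          Fitted : ℕ → Set
          Fitted t = ∃[ σ ] (Injective {k} σ × (∀ i → T (Q (σ i))) × (∀ i → toℕ i < t → T (acc i (σ i))))
          start : Fitted 0
          start = let σ , inj , mem = pick k {Q} room in σ , inj , mem , λ _ ()
          advance : ∀ {t} → t < k → Fitted t → Fitted (suc t)
          advance {t} t<k (σ , inj , mem , fit) with T? (acc (fromℕ< t<k) (σ (fromℕ< t<k)))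
          ... | yes ok = σ , inj , mem , λ i i<st → split i (m≤n⇒m<n∨m≡n (≤-pred i<st))
            where
            split : ∀ i → (toℕ i < t) ⊎ (toℕ i ≡ t) → T (acc i (σ i))
            split i (inj₁ h) = fit i h
            split i (inj₂ h) = subst (λ i → T (acc i (σ i))) (sym (Fin.toℕ-injective (trans h (sym (Fin.toℕ-fromℕ< t<k))))) ok
          -- Fewer than κ positions refuse `σ j`, and at most κ positions carry a vertex that `j`
          -- refuses; one of the 2κ positions escapes both.
          ... | no  _  = swapped (avoid-both {P = λ i → not (acc i (σ j))} {Q = λ i → not (acc j (σ i))}
              (≤-trans (+-mono-<-≤ (few-v (σ j) (mem j))
                 (≤-trans (#-injective {P = λ i → not (acc j (σ i))} {Q = λ v → Q v ∧ not (acc j v)} inj (λ i h → ∧⁺ (mem i) h)) (few-i j))) ≤-refl))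
            where
            j = fromℕ< t<k
            swapped : ∃[ i ] (¬ T (not (acc i (σ j))) × ¬ T (not (acc j (σ i)))) → Fitted (suc t)
            swapped (i , ij , ji) = σ ∘ transpose i j , transpose-inj ∘ inj , mem ∘ transpose i j , λ l l<st → fits l (m≤n⇒m<n∨m≡n (≤-pred l<st))
              where
              transpose-inj : ∀ {x y} → transpose i j x ≡ transpose i j y → x ≡ y
              transpose-inj {x} {y} e = trans (sym (transpose-inverse j i)) (trans (cong (transpose j i) e) (transpose-inverse j i))
              pos : ∀ {b} → ¬ T (not b) → T b
              pos {true}  _ = tt
              pos {false} h = h tt
              fits : ∀ l → (toℕ l < t) ⊎ (toℕ l ≡ t) → T (acc l (σ (transpose i j l)))
              fits l h with l Fin.≟ i
              ... | yes refl = pos ij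
              ... | no _ with l Fin.≟ j
              ... | yes refl = pos ji
              fits l (inj₁ h) | no _ | no _ = fit l h
              fits l (inj₂ h) | no _ | no l≢j = contradiction (Fin.toℕ-injective (trans h (sym (Fin.toℕ-fromℕ< t<k)))) l≢j
          fit-below : ∀ t → t ≤ k → Fitted t
          fit-below zero    _ = start
          fit-below (suc t) h = advance h (fit-below t (≤-trans (n≤1+n t) h))

        record Patched {k} (F : List V) (acc : Fin k → V → Bool) (P : V → Bool) (t : ℕ) : Set where
          field
            {F′} : List V
            holed   : Holed F′ acc
            uniq    : Unique F′
            incl    : ∀ {v} → v ∈ F → v ∈ F′
            size    : length F′ ≤ 3 * t + length F
            covered : ∀ v → T (P v) → v ∈ F′

        patch : ∀ t {k F} {acc : Fin k → V → Bool} P → Holed F acc → Unique F → 3 * t + length F ≤ 2 * w →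
          # (P ∖ F) ≤ t → Patched F acc P t
        patch t {k} {F} {acc} P H uF lF few with any? (λ v → T? ((P ∖ F) v))
        ... | no none = record { holed = H ; uniq = uF ; incl = id ; size = m≤n+m _ _ ; covered = cov }
          where
          cov : ∀ v → T (P v) → v ∈ F
          cov v h with DecMembership._∈?_ Fin._≟_ v F
          ... | yes v∈ = v∈
          ... | no v∉ = contradiction (v , ∖⁺ h v∉) none
        patch zero {F = F} P H uF lF few | yes (v , h) = contradiction (≤-trans (#-remove h) few) (λ ())
        patch (suc t) {k} {F} {acc} P H uF lF few | yes (v , h) = linked (link (v ∷ F) end last v
            (≤-trans (lin (2 + 3 * t) lF (eq₀ t (length F) (2 * w))) (*-monoˡ-≤ w {2} {4} (s≤s (s≤s z≤n)))))
          where
          open Holed H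
          eq₀ : ∀ t f w → w + (3 * suc t + f) ≡ suc f + w + (2 + 3 * t)
          eq₀ = solve-∀
          linked : ∃[ p ] ∃[ q ] (p ∉ v ∷ F × q ∉ p ∷ v ∷ F × Walk end last (p ∷ q ∷ v ∷ []) (3 + end) v) → Patched F acc P (suc t)
          linked (p , q , p∉ , q∉ , walk) = done
            (patch t P (extend H walk) (unique-↭ perm (unique-∷ q∉ (unique-∷ p∉ (unique-∷ (proj₂ (∖⁻ h)) uF))))
              (≤-trans (≤-reflexive (eq t (length F))) lF)
              (≤-pred (≤-trans (s≤s (#-mono fewer)) (≤-trans (#-remove h) few))))
            where
            N : List V
            N = p ∷ q ∷ v ∷ []
            eq : ∀ t f → 3 * t + (3 + f) ≡ 3 * suc t + f
            eq = solve-∀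
            perm : q ∷ p ∷ v ∷ F ↭ N ++ F
            perm = solve↭ 4 (λ q p v F → (q ⊞ (p ⊞ (v ⊞ F))) ⊜↭ (p ⊞ (q ⊞ (v ⊞ F)))) ↭-refl (q ∷ []) (p ∷ []) (v ∷ []) F
            fewer : ∀ x → T ((P ∖ (N ++ F)) x) → T ((P ∖ F ∖ (v ∷ [])) x)
            fewer x g = ∖⁺ (∖⁺ (proj₁ (∖⁻ g)) (proj₂ (∖⁻ g) ∘ ∈-++⁺ʳ N))
              λ { (here refl) → proj₂ (∖⁻ g) (there (there (here refl))) ; (there ()) }
            done : Patched (N ++ F) acc P t → Patched F acc P (suc t)
            done R = record { holed = R.holed ; uniq = R.uniq ; incl = R.incl ∘ ∈-++⁺ʳ N
              ; size = ≤-trans R.size (≤-reflexive (eq t (length F))) ; covered = R.covered }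
              where module R = Patched R

        -- The absorber with 2κ holes, and its completion to a cycle.

        record Absorber (k κ ℓ : ℕ) : Set where
          field
            {F}   : List V
            {acc} : Fin k → V → Bool
            holed   : Holed F acc
            uniq    : Unique F
            size    : length F ≤ ℓ
            refused : ∀ i → # ((not ∘ acc i) ∖ F) ≤ κ

        module Build (κ J s : ℕ) (suc-J : suc J ≡ 2 * (A * A)) (m≪κ : A * (A * (A * (m + 12))) ≤ κ)
          -- `small` pays for 2κ holes at `4 + 10 * s` vertices each and for 2κ + 2 insertions at
          -- three vertices each, with some slack.
          (decay : J ^ s * n ≤ suc J ^ s * κ) (small : (κ + κ) * (4 + 10 * s) + 6 * κ + 30 ≤ 2 * w) where

          κ≤w : κ ≤ w
          κ≤w = *-cancelˡ-≤ 2 (lin (κ * 12 + (κ + κ) * (10 * s) + 30) small (eq κ s w))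
            where
            eq : ∀ κ s w → 2 * w + ((κ + κ) * (4 + 10 * s) + 6 * κ + 30) ≡ 2 * κ + 2 * w + (κ * 12 + (κ + κ) * (10 * s) + 30)
            eq = solve-∀

          open Plug κ J s suc-J m≪κ κ≤w decay

          refused-mono : ∀ {F F′} {B : V → Bool} → (∀ {v} → v ∈ F → v ∈ F′) → # ((not ∘ B) ∖ F) ≤ κ → # ((not ∘ B) ∖ F′) ≤ κ
          refused-mono sub h = ≤-trans (#-mono λ v g → ∖⁺ (proj₁ (∖⁻ g)) (proj₂ (∖⁻ g) ∘ sub)) h

          chain : ∀ k → k ≤ κ + κ → Absorber k κ (1 + k * (4 + 10 * s))
          chain zero _ = record { holed = trivial ; uniq = unique-∷ (λ ()) [] ; size = ≤-refl ; refused = λ () }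
          chain (suc k) k<2κ = continue (chain k (≤-trans (n≤1+n k) k<2κ))
            where
            continue : Absorber k κ (1 + k * (4 + 10 * s)) → Absorber (suc k) κ (1 + suc k * (4 + 10 * s))
            continue H = done (plug H.holed H.uniq
                (lin (17 + 6 * κ) (H.size ⊕ *-monoˡ-≤ (4 + 10 * s) k<2κ ⊕ small) (eq k s κ w (length H.F))))
              where
              module H = Absorber H
              eq : ∀ k s κ w f → 2 * w + (f + suc k * (4 + 10 * s) + ((κ + κ) * (4 + 10 * s) + 6 * κ + 30))
                ≡ 16 + 10 * s + f + (1 + k * (4 + 10 * s) + (κ + κ) * (4 + 10 * s) + 2 * w) + (17 + 6 * κ)
              eq = solve-∀
              done : Plugged H.F H.acc κ (4 + 10 * s) → Absorber (suc k) κ (1 + suc k * (4 + 10 * s))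
              done P = record
                { holed = P.holed ; uniq = P.uniq
                ; size = ≤-trans P.size (≤-trans (+-monoʳ-≤ (4 + 10 * s) H.size) (≤-reflexive (+-suc (4 + 10 * s) _)))
                ; refused = λ { zero → P.refused ; (suc i) → refused-mono {B = H.acc i} P.incl (H.refused i) } }
                where module P = Plugged P

          record Robust : Set where
            field
              {F}   : List V
              {acc} : Fin (κ + κ) → V → Bool
              holed   : Holed F acc
              uniq    : Unique F
              size    : length F ≤ 2 * w
              refused : ∀ i → # ((not ∘ acc i) ∖ F) ≤ κ
              good    : ∀ v → v ∉ F → # (λ i → not (acc i v)) < κ

          robust : Robust
          robust = patched (chain (κ + κ) ≤-refl)
            where
            patched : Absorber (κ + κ) κ (1 + (κ + κ) * (4 + 10 * s)) → Robust
            patched H = finish (patch (κ + κ + 2) bad H.holed H.uniq room few)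
              where
              module H = Absorber H
              bad : V → Bool
              bad v = κ ≤ᵇ # (λ i → not (H.acc i v))
              eq : ∀ s κ w f → 2 * w + (f + ((κ + κ) * (4 + 10 * s) + 6 * κ + 30))
                ≡ 3 * (κ + κ + 2) + f + (1 + (κ + κ) * (4 + 10 * s) + 2 * w) + 23
              eq = solve-∀
              room : 3 * (κ + κ + 2) + length H.F ≤ 2 * w
              room = lin 23 (H.size ⊕ small) (eq s κ w (length H.F))
              -- Double counting of refusals: a bad vertex takes part in at least κ, and no hole
              -- reaches `suc κ` of them, so κ|X| ≤ 2κ(κ + 1).
              few : # (bad ∖ H.F) ≤ κ + κ + 2
              few = *-cancelʳ-≤ _ _ κ ⦃ >-nonZero 1≤κ ⦄ (lin 0 (count ⊕ *-monoˡ-≤ (# X) none) (eq′ κ (# X) (# heavy-i)))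
                where
                1≤κ : 1 ≤ κ
                1≤κ = ≤-trans (*-mono-≤ 1≤A (*-mono-≤ 1≤A (*-mono-≤ 1≤A (≤-trans 1≤m (m≤m+n m 12))))) m≪κ
                X = bad ∖ H.F
                heavy-i : Fin (κ + κ) → Bool
                heavy-i i = suc κ ≤ᵇ # (λ v → X v ∧ not (H.acc i v))
                count : # X * κ ≤ (κ + κ) * suc κ + # heavy-i * # X
                count = heavy (λ v i → not (H.acc i v)) X {κ} {suc κ} (λ v h → ≤ᵇ⇒≤ κ _ (proj₁ (∖⁻ h)))
                none : # heavy-i ≤ 0
                none = ≮⇒≥ λ some → let i , h = #-witness some in
                  <⇒≱ (≤ᵇ⇒≤ (suc κ) _ h) (≤-trans (#-mono λ v g → let x , y = ∧⁻ {X v} g in ∖⁺ y (proj₂ (∖⁻ x))) (H.refused i))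
                eq′ : ∀ κ x h → (κ + κ + 2) * κ + (x * κ + h * x) ≡ x * κ + ((κ + κ) * suc κ + h * x + 0 * x) + 0
                eq′ = solve-∀
              finish : Patched H.F H.acc bad (κ + κ + 2) → Robust
              finish P = record { holed = P.holed ; uniq = P.uniq ; size = ≤-trans P.size room
                ; refused = λ i → refused-mono {B = H.acc i} P.incl (H.refused i)
                ; good = λ v v∉ → ≰⇒> λ h → v∉ (P.covered v (≤⇒≤ᵇ h)) }
                where module P = Patched P

          OrientedCycle : ℕ → Set
          OrientedCycle ℓ = ∃[ xs ] (suc (length xs) ≡ ℓ × Unique (u₀ ∷ xs) × Walk 0 u₀ (xs ++ u₀ ∷ []) ℓ u₀)

          -- The closing stretch is chosen while the holes are still empty, and the holes then take
          -- what it left over. As the cycle has at most n vertices, counting the `k` fillings, at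
          -- least `k` candidates remain.
          finish-cycle : ∀ {k F acc} (H : Holed {k} F acc) {L} → length F ≤ 2 * w → Unique F →
            length F + L + 7 * m ≤ n → 3 + L + Holed.end H ≤ n →
            (∀ Q → k ≤ # Q → (∀ v → T (Q v) → v ∉ F) → ∃[ σ ] (Injective {k} σ × (∀ i → T (Q (σ i))) × (∀ i → T (acc i (σ i))))) →
            OrientedCycle (3 + L + Holed.end H)
          finish-cycle {k} {F} {acc} H {L} lF uF room ℓ≤n fit = with-closing (close uF lF end last u₀ L room)
            where
            open Holed H
            with-closing : Closing F end last u₀ L → OrientedCycle (3 + L + end)
            with-closing (zs , j , lzs , walk , uzF) = with-fit
                (fit ((λ _ → true) ∖ (zs ++ F)) enough (λ v h → proj₂ (∖⁻ h) ∘ ∈-++⁺ʳ zs))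
              where
              enough : k ≤ # ((λ _ → true) ∖ (zs ++ F))
              enough = remaining {k} {λ _ → true} (zs ++ F) (subst₂ _≤_
                (trans (eq k L (length F)) (sym (cong (_+ k) (trans (length-++ zs) (cong (_+ length F) lzs))))) (sym #-true)
                (subst (λ e → 2 + L + e ≤ n) size (≤-trans (≤-reflexive (+-suc (2 + L) end)) ℓ≤n)))
                where
                eq : ∀ k L f → 2 + L + (k + f) ≡ 2 + L + f + k
                eq = solve-∀
              with-fit : ∃[ σ ] (Injective {k} σ × (∀ i → T (((λ _ → true) ∖ (zs ++ F)) (σ i))) × (∀ i → T (acc i (σ i)))) →
                OrientedCycle (3 + L + end)
              with-fit (σ , inj , mem , fits) = filled (fill σ fits)
                where
                filled : ∃[ xs ] (Walk 0 u₀ xs end last × u₀ ∷ xs ↭ tabulate σ ++ F) → OrientedCycle (3 + L + end)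
                filled (xs , p , perm) = xs ++ zs , len , uniq , subst (λ j → Walk 0 u₀ ((xs ++ zs) ++ u₀ ∷ []) j u₀) j≡
                    (subst (λ l → Walk 0 u₀ l j u₀) (sym (++-assoc xs zs (u₀ ∷ []))) (p ++ʷ walk))
                  where
                  lxs : length xs ≡ end
                  lxs = sym (trans (walk-length p) (+-identityʳ (length xs)))
                  len : suc (length (xs ++ zs)) ≡ 3 + L + end
                  len = trans (cong suc (trans (length-++ xs) (cong₂ _+_ lxs lzs))) (eq end L)
                    where
                    eq : ∀ e L → suc (e + (2 + L)) ≡ 3 + L + e
                    eq = solve-∀
                  j≡ : j ≡ 3 + L + end
                  j≡ = trans (walk-length walk) (cong (_+ end) (trans (length-++ zs) (trans (cong (_+ 1) lzs) (+-comm (2 + L) 1))))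
                  uniq : Unique (u₀ ∷ xs ++ zs)
                  uniq = unique-↭ (↭-trans (solve↭ 3 (λ t z f → (t ⊞ (z ⊞ f)) ⊜↭ ((t ⊞ f) ⊞ z)) ↭-refl (tabulate σ) zs F)
                             (++⁺ʳ zs (↭-sym perm)))
                    (unique-++ (Unique.tabulate⁺ inj) uzF λ v∈ → let i , e = ∈-tabulate⁻ v∈ in
                       subst (_∉ zs ++ F) (sym e) (proj₂ (∖⁻ (mem i))))

          -- Short cycles close the one-vertex walk onto itself. For long ones, `close` still
          -- demands 7m spare vertices, and the 2κ vertices reserved for the holes provide them,
          -- even when ℓ = n.
          all-cycles : 7 * m ≤ κ + κ → ∀ ℓ → 3 ≤ ℓ → ℓ ≤ n → OrientedCycle ℓ
          all-cycles 7m≤2κ ℓ 3≤ℓ ℓ≤n with ℓ + 7 * m ≤? 2 + n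
          ... | yes short = subst OrientedCycle (trans (+-identityʳ (3 + (ℓ ∸ 3))) (m+[n∸m]≡n 3≤ℓ))
              (finish-cycle trivial {ℓ ∸ 3} (≤-trans 1≤w (m≤m+n w _)) (unique-∷ (λ ()) [])
                (lin 0 (short ⊕ ≤-reflexive (m+[n∸m]≡n 3≤ℓ)) (eq (ℓ ∸ 3) ℓ m n)) (≤-trans (≤-reflexive (trans (+-identityʳ (3 + (ℓ ∸ 3))) (m+[n∸m]≡n 3≤ℓ))) ℓ≤n)
                (λ Q _ _ → (λ ()) , (λ { {()} }) , (λ ()) , (λ ())))
            where
            1≤w : 1 ≤ w
            1≤w = ≤-trans 1≤m m≤w
            eq : ∀ L ℓ m n → n + (ℓ + 7 * m + (3 + L)) ≡ 1 + L + 7 * m + (2 + n + ℓ) + 0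
            eq = solve-∀
          ... | no long = go robust
            where
            go : Robust → OrientedCycle ℓ
            go r = subst OrientedCycle ℓ≡ (finish-cycle r.holed {L} r.size r.uniq
                (lin 2 (≤-reflexive ℓ≡ ⊕ ℓ≤n ⊕ ≤-reflexive (sym size) ⊕ 7m≤2κ) (eq₂ L end ℓ m n κ (length r.F)))
                (≤-trans (≤-reflexive ℓ≡) ℓ≤n)
                λ Q room Q∉ → match κ r.acc Q (λ v h → r.good v (Q∉ v h))
                  (λ i → ≤-trans (#-mono λ v h → let q , a = ∧⁻ {Q v} h in ∖⁺ a (Q∉ v q)) (r.refused i)) room)
              where
              module r = Robust r
              open Holed r.holed
              5w≤n : 5 * w ≤ n
              5w≤n = ≤-trans (degree true u₀) (#-bound _)
              -- The absorber must fit into the cycle: it has at most 2κ + 2w vertices, whereas ℓ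
              -- exceeds n - 7m with n ≥ 5w and 7m ≤ 2κ ≤ w/2.
              end+3≤ℓ : 3 + end ≤ ℓ
              end+3≤ℓ = lin (2 * w + 1) (≰⇒> long ⊕ 5w≤n ⊕ ≤-reflexive size ⊕ r.size ⊕ 7m≤2κ ⊕ 4κ≤w) (eq₁ end ℓ m n κ (length r.F) w)
                where
                4κ≤w : 4 * κ ≤ w
                4κ≤w = *-cancelˡ-≤ 2 (lin (6 * κ + (κ + κ) * (10 * s) + 30) small (eq κ s w))
                  where
                  eq : ∀ κ s w → 2 * w + ((κ + κ) * (4 + 10 * s) + 6 * κ + 30) ≡ 2 * (4 * κ) + 2 * w + (6 * κ + (κ + κ) * (10 * s) + 30)
                  eq = solve-∀
                eq₁ : ∀ e ℓ m n κ f w → ℓ + (suc (2 + n) + 5 * w + suc e + f + 7 * m + 4 * κ) ≡ 3 + e + (ℓ + 7 * m + n + (κ + κ + f) + 2 * w + (κ + κ) + w) + (2 * w + 1)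
                eq₁ = solve-∀
              L = ℓ ∸ (3 + end)
              ℓ≡ : 3 + L + end ≡ ℓ
              ℓ≡ = trans (eq L end) (m+[n∸m]≡n end+3≤ℓ)
                where
                eq : ∀ L e → 3 + L + e ≡ 3 + e + L
                eq = solve-∀
              eq₂ : ∀ L e ℓ m n κ f → n + (3 + L + e + ℓ + (κ + κ + f) + 7 * m) ≡ f + L + 7 * m + (ℓ + n + suc e + (κ + κ)) + 2
              eq₂ = solve-∀

  -- From closed walks to vectors tracing oriented cycles.

  at : ∀ {A : Set} → A → List A → ℕ → A
  at u xs       zero    = u
  at u []       (suc t) = u
  at u (x ∷ xs) (suc t) = at x xs t

  at-++ : ∀ {A : Set} (u : A) xs ys {t} → t ≤ length xs → at u (xs ++ ys) t ≡ at u xs t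
  at-++ u xs       ys {zero}  _       = refl
  at-++ u (x ∷ xs) ys {suc t} (s≤s h) = at-++ x xs ys h

  at-last : ∀ {A : Set} (u : A) xs v → at u (xs ++ v ∷ []) (suc (length xs)) ≡ v
  at-last u []       v = refl
  at-last u (x ∷ xs) v = at-last x xs v

  at-∈ : ∀ {A : Set} (u : A) xs t → at u xs t ∈ u ∷ xs
  at-∈ u xs       zero    = here refl
  at-∈ u []       (suc t) = here refl
  at-∈ u (x ∷ xs) (suc t) = there (at-∈ x xs t)

  at-injective : ∀ {A : Set} {u : A} {xs s t} → Unique (u ∷ xs) → s ≤ length xs → t ≤ length xs →
    at u xs s ≡ at u xs t → s ≡ t
  at-injective {s = zero}  {zero}  _ _ _ _ = refl
  at-injective {u = u} {x ∷ xs} {zero}  {suc t} (a ∷ _) _ _ e = contradiction e (All.lookup a (at-∈ x xs t))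
  at-injective {u = u} {x ∷ xs} {suc s} {zero}  (a ∷ _) _ _ e = contradiction (sym e) (All.lookup a (at-∈ x xs s))
  at-injective {xs = x ∷ xs} {suc s} {suc t} (_ ∷ u) (s≤s p) (s≤s q) e = cong suc (at-injective u p q e)

  toℕ-next : ∀ {k} (i : Fin (suc k)) → toℕ (next i) ≡ suc (toℕ i) ⊎ (next i ≡ zero × toℕ i ≡ k)
  toℕ-next {k} i with suc (toℕ i) <? suc k
  ... | yes p = inj₁ (Fin.toℕ-fromℕ< p)
  ... | no ¬p = inj₂ (refl , ≤-antisym (≤-pred (Fin.toℕ<n i)) (≤-pred (≮⇒≥ ¬p)))

  -- Walks index orientations by all of ℕ. The default `true` concerns positions from ℓ on, and a
  -- closed walk from position 0 to ℓ has no edge there.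
  pattern-of : ∀ {ℓ} → Vec Bool ℓ → ℕ → Bool
  pattern-of {ℓ} o t with t <? ℓ
  ... | yes p = lookup o (fromℕ< p)
  ... | no  _ = true

  pattern-of-toℕ : ∀ {ℓ} (o : Vec Bool ℓ) i → pattern-of o (toℕ i) ≡ lookup o i
  pattern-of-toℕ {ℓ} o i with toℕ i <? ℓ
  ... | yes p = cong (lookup o) (Fin.fromℕ<-toℕ i p)
  ... | no ¬p = contradiction (Fin.toℕ<n i) ¬p

  module Embedding {n : ℕ} (D : Digraph n) (G : Fin n → Fin n → Bool) (w A m : ℕ)
    (1≤A : 1 ≤ A) (1≤m : 1 ≤ m) (m≤w : m ≤ w) (n≤Aw : n ≤ A * w)
    (degree : ∀ e v → 5 * w ≤ # (dir (adj D) e v))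
    (joined : ∀ P Q → m ≤ # P → m ≤ # Q → ∃[ u ] ∃[ v ] (u ≢ v × T (P u) × T (Q v) × T (G u v)))
    where
      open Perturbed (adj D) G w A m 1≤A 1≤m m≤w n≤Aw degree joined

      edge : ∀ e {u v} → T (E e u v) → T (if e then (D ∪ G) u v else (D ∪ G) v u)
      edge true  h = toUnion h
      edge false h = toUnion h

      module _ (o : ℕ → Bool) where
        open Pattern o

        walk-at : ∀ {i u xs j v t} → Walk i u xs j v → t < length xs →
          T (E (o (t + i)) (at u xs t) (at u xs (suc t)))
        walk-at {t = zero} (_∷_ {xs = []}    e p) _ = e
        walk-at {t = zero} (_∷_ {xs = _ ∷ _} e p) _ = e
        walk-at {i = i} {t = suc t} (_∷_ {x = x} {xs = xs} e p) (s≤s h) =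
          subst (λ z → T (E (o z) (at x xs t) (at x xs (suc t)))) (+-suc t i) (walk-at p h)

      module _ {k} (o : Vec Bool (suc k)) {u₀ : Fin n} where
        open Pattern (pattern-of o)

        contains : ∀ xs → suc (length xs) ≡ suc k → Unique (u₀ ∷ xs) → Walk 0 u₀ (xs ++ u₀ ∷ []) (suc k) u₀ →
          ContainsOrientedCycle (D ∪ G) o
        contains xs len uniq walk = f , injective , edges
          where
          c : ℕ → Fin n
          c = at u₀ (xs ++ u₀ ∷ [])
          f = Vec.tabulate (c ∘ toℕ)
          f≡ : ∀ i → lookup f i ≡ c (toℕ i)
          f≡ = Vec.lookup∘tabulate (c ∘ toℕ)
          bound : ∀ (i : Fin (suc k)) → toℕ i ≤ length xs
          bound i = ≤-trans (≤-pred (Fin.toℕ<n i)) (≤-reflexive (sym (suc-injective len)))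
          injective : InjectiveVec f
          injective i j e = Fin.toℕ-injective (at-injective uniq (bound i) (bound j)
            (trans (sym (at-++ u₀ xs (u₀ ∷ []) (bound i))) (trans (sym (f≡ i)) (trans e (trans (f≡ j) (at-++ u₀ xs (u₀ ∷ []) (bound j)))))))
          c-next : ∀ i → c (toℕ (next i)) ≡ c (suc (toℕ i))
          c-next i with toℕ-next i
          ... | inj₁ e = cong c e
          -- The wrap-around: `c` lists `u₀` once more at its end, so stepping past the last
          -- position agrees with returning to position zero.
          ... | inj₂ (e , e′) = trans (cong (c ∘ toℕ) e) (sym (trans (cong (c ∘ suc) (trans e′ (sym (suc-injective len)))) (at-last u₀ xs u₀)))
          edges : ∀ i → T (EdgeOK (D ∪ G) o f i)
          edges i = subst₂ (λ a b → T (if lookup o i then (D ∪ G) a b else (D ∪ G) b a))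
            (sym (f≡ i)) (sym (trans (f≡ (next i)) (c-next i)))
            (edge (lookup o i) (subst (λ b → T (E b (c (toℕ i)) (c (suc (toℕ i)))))
              (trans (cong (pattern-of o) (+-identityʳ (toℕ i))) (pattern-of-toℕ o i))
              (walk-at (pattern-of o) walk (≤-trans (s≤s (bound i)) (≤-reflexive (sym (trans (length-++ xs) (+-comm (length xs) 1))))))))

      module _ (κ J s : ℕ) (suc-J : suc J ≡ 2 * (A * A)) (m≪κ : A * (A * (A * (m + 12))) ≤ κ)
        (decay : J ^ s * n ≤ suc J ^ s * κ) (small : (κ + κ) * (4 + 10 * s) + 6 * κ + 30 ≤ 2 * w)
        (7m≤2κ : 7 * m ≤ κ + κ) (u₀ : Fin n) where

        all-orientations : ∀ k → 3 ≤ suc k → suc k ≤ n → (o : Vec Bool (suc k)) → ContainsOrientedCycle (D ∪ G) o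
        all-orientations k 3≤ ≤n o =
          let xs , len , uniq , walk = B.all-cycles 7m≤2κ (suc k) 3≤ ≤n in contains o xs len uniq walk
          where
          module B = Pattern.Holes.Build (pattern-of o) u₀ κ J s suc-J m≪κ decay small

-- Expectations over independent pairs, and the union bound.

module Probability where

  open Combinatorics
  open import Data.Nat using (ℕ; zero; suc; _+_; _*_; _^_; _≤_; _≤ᵇ_; z≤n; s≤s)
  open import Data.Rational as ℚ using (ℚ; 0ℚ; 1ℚ)

  module _ where
    open ℚSolver.+-*-Solver

    convex-const : ∀ p c → p ℚ.* c ℚ.+ (1ℚ ℚ.- p) ℚ.* c ≡ c
    convex-const = solve 2 (λ p c → p :* c :+ (con 1ℚ :- p) :* c := c) refl

    convex-+ : ∀ p a b c d → p ℚ.* (a ℚ.+ b) ℚ.+ (1ℚ ℚ.- p) ℚ.* (c ℚ.+ d)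
      ≡ (p ℚ.* a ℚ.+ (1ℚ ℚ.- p) ℚ.* c) ℚ.+ (p ℚ.* b ℚ.+ (1ℚ ℚ.- p) ℚ.* d)
    convex-+ = solve 5 (λ p a b c d → p :* (a :+ b) :+ (con 1ℚ :- p) :* (c :+ d)
      := (p :* a :+ (con 1ℚ :- p) :* c) :+ (p :* b :+ (con 1ℚ :- p) :* d)) refl

  pow : ℚ → ℕ → ℚ
  pow q zero    = 1ℚ
  pow q (suc k) = q ℚ.* pow q k

  times : ℕ → ℚ → ℚ
  times zero    x = 0ℚ
  times (suc k) x = x ℚ.+ times k x

  *-monoˡ : ∀ {r x y} → 0ℚ ℚ.≤ r → x ℚ.≤ y → r ℚ.* x ℚ.≤ r ℚ.* y
  *-monoˡ {r} 0≤r = ℚ.*-monoˡ-≤-nonNeg r ⦃ ℚ.nonNegative 0≤r ⦄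

  *-monoʳ : ∀ {r x y} → 0ℚ ℚ.≤ r → x ℚ.≤ y → x ℚ.* r ℚ.≤ y ℚ.* r
  *-monoʳ {r} 0≤r = ℚ.*-monoʳ-≤-nonNeg r ⦃ ℚ.nonNegative 0≤r ⦄

  0≤* : ∀ {x y} → 0ℚ ℚ.≤ x → 0ℚ ℚ.≤ y → 0ℚ ℚ.≤ x ℚ.* y
  0≤* {x} {y} p q = subst (ℚ._≤ x ℚ.* y) (ℚ.*-zeroʳ x) (*-monoˡ p q)

  0≤1 : 0ℚ ℚ.≤ 1ℚ
  0≤1 = ℚ.nonNegative⁻¹ 1ℚ

  pow-nonNeg : ∀ {q} k → 0ℚ ℚ.≤ q → 0ℚ ℚ.≤ pow q k
  pow-nonNeg zero    h = 0≤1
  pow-nonNeg (suc k) h = 0≤* h (pow-nonNeg k h)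

  hits : ∀ {n} → Rel n → List (Fin n × Fin n) → Rel n → Bool
  hits S []             G = false
  hits S ((u , v) ∷ es) G = (S u v ∧ G u v) ∨ hits S es G

  hits⁺ : ∀ {n} {S G : Rel n} {es u v} → (u , v) ∈ es → T (S u v) → T (G u v) → T (hits S es G)
  hits⁺ {S = S} {G} (here refl) s g = Equivalence.from T-∨ (inj₁ (∧⁺ s g))
  hits⁺ {S = S} {G} {(x , y) ∷ _} (there h) s g = Equivalence.from (T-∨ {S x y ∧ G x y}) (inj₂ (hits⁺ h s g))

  hits⁻ : ∀ {n} {S G : Rel n} es → T (hits S es G) → ∃[ u ] ∃[ v ] ((u , v) ∈ es × T (S u v) × T (G u v))
  hits⁻ {S = S} {G} ((u , v) ∷ es) h with Equivalence.to (T-∨ {S u v ∧ G u v}) h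
  ... | inj₁ p = let a , b = ∧⁻ {S u v} p in u , v , here refl , a , b
  ... | inj₂ p = let u , v , m , s , g = hits⁻ es p in u , v , there m , s , g

  cnt : ∀ {n} → Rel n → List (Fin n × Fin n) → ℕ
  cnt S []             = 0
  cnt S ((u , v) ∷ es) = ind (S u v) Data.Nat.+ cnt S es

  module Expectation {n : ℕ} (p : ℚ) (0≤p : 0ℚ ℚ.≤ p) (p≤1 : p ℚ.≤ 1ℚ) where

    q : ℚ
    q = 1ℚ ℚ.- p

    0≤q : 0ℚ ℚ.≤ q
    0≤q = subst (ℚ._≤ q) (ℚ.+-inverseʳ p) (ℚ.+-monoˡ-≤ (ℚ.- p) p≤1)

    Exp : List (Fin n × Fin n) → Rel n → (Rel n → ℚ) → ℚ
    Exp = expect p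

    Exp-mono : ∀ es G {f g} → (∀ H → f H ℚ.≤ g H) → Exp es G f ℚ.≤ Exp es G g
    Exp-mono []             G h = h G
    Exp-mono ((u , v) ∷ es) G h = ℚ.+-mono-≤ (*-monoˡ 0≤p (Exp-mono es _ h)) (*-monoˡ 0≤q (Exp-mono es _ h))

    Exp-+ : ∀ es G f g → Exp es G (λ H → f H ℚ.+ g H) ≡ Exp es G f ℚ.+ Exp es G g
    Exp-+ []             G f g = refl
    Exp-+ ((u , v) ∷ es) G f g = trans
      (cong₂ (λ a b → p ℚ.* a ℚ.+ q ℚ.* b) (Exp-+ es (setEdge G u v true) f g) (Exp-+ es (setEdge G u v false) f g))
      (convex-+ p _ _ _ _)

    -- Holds for every outcome `H` that is still possible when only the pairs in `es` remain to be
    -- drawn.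
    Agree : List (Fin n × Fin n) → Rel n → Rel n → Set
    Agree es G H = ∀ x y → (x , y) ∉ es → H x y ≡ G x y

    setEdge-other : ∀ (G : Rel n) u v b x y → (x , y) ≢ (u , v) → setEdge G u v b x y ≡ G x y
    setEdge-other G u v b x y ne with x Fin.≟ u | y Fin.≟ v
    ... | yes refl | yes refl = contradiction refl ne
    ... | yes _    | no _     = refl
    ... | no _     | _        = refl

    setEdge-same : ∀ (G : Rel n) u v b → setEdge G u v b u v ≡ b
    setEdge-same G u v b with u Fin.≟ u | v Fin.≟ v
    ... | yes _ | yes _ = refl
    ... | yes _ | no ¬p = contradiction refl ¬p
    ... | no ¬p | _     = contradiction refl ¬p

    agree-∷ : ∀ {es G u v b H} → Agree es (setEdge G u v b) H → Agree ((u , v) ∷ es) G H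
    agree-∷ {G = G} {u} {v} {b} a x y ∉ = trans (a x y (∉ ∘ there)) (setEdge-other G u v b x y (∉ ∘ here))

    Exp-bound : ∀ es G {f c} → (∀ H → Agree es G H → f H ℚ.≤ c) → Exp es G f ℚ.≤ c
    Exp-bound []             G         h = h G (λ _ _ _ → refl)
    Exp-bound ((u , v) ∷ es) G {f} {c} h = subst (Exp ((u , v) ∷ es) G f ℚ.≤_) (convex-const p c)
      (ℚ.+-mono-≤ (*-monoˡ 0≤p (Exp-bound es _ λ H a → h H (agree-∷ {es} {G} {u} {v} {true} a)))
                  (*-monoˡ 0≤q (Exp-bound es _ λ H a → h H (agree-∷ {es} {G} {u} {v} {false} a))))

    -- Each pair of `S` contributes a factor `q`: once drawn as an edge it is never drawn again, by
    -- uniqueness, so the expectation in that branch is at most 0. At a pair outside `S`, both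
    -- branches obey the same bound.
    Exp-miss : ∀ S es G {f} → Unique es → (∀ H → f H ℚ.≤ 1ℚ) →
      (∀ H {u v} → (u , v) ∈ es → T (S u v) → T (H u v) → f H ℚ.≤ 0ℚ) →
      Exp es G f ℚ.≤ pow q (cnt S es)
    Exp-miss S []             G     _        h₁ h₀ = h₁ G
    Exp-miss S ((u , v) ∷ es) G {f} (a ∷ uq) h₁ h₀ with S u v in eq
    ... | true  = subst (Exp ((u , v) ∷ es) G f ℚ.≤_) (trans (cong (ℚ._+ q ℚ.* pow q (cnt S es)) (ℚ.*-zeroʳ p)) (ℚ.+-identityˡ (q ℚ.* pow q (cnt S es))))
      (ℚ.+-mono-≤
        (*-monoˡ 0≤p (Exp-bound es (setEdge G u v true) λ H ag → h₀ H (here refl) (subst T (sym eq) tt)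
          (subst T (sym (trans (ag u v (λ m → All.lookup a m refl)) (setEdge-same G u v true))) tt)))
        (*-monoˡ 0≤q (Exp-miss S es (setEdge G u v false) uq h₁ (λ H → h₀ H ∘ there))))
    ... | false = subst (Exp ((u , v) ∷ es) G f ℚ.≤_) (convex-const p (pow q (cnt S es)))
      (ℚ.+-mono-≤
        (*-monoˡ 0≤p (Exp-miss S es (setEdge G u v true) uq h₁ (λ H → h₀ H ∘ there)))
        (*-monoˡ 0≤q (Exp-miss S es (setEdge G u v false) uq h₁ (λ H → h₀ H ∘ there))))

    module Union (es : List (Fin n × Fin n)) (uq : Unique es) where

      missed : Rel n → Rel n → ℚ
      missed S H = if hits S es H then 0ℚ else 1ℚ

      missed≥0 : ∀ S H → 0ℚ ℚ.≤ missed S H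
      missed≥0 S H with hits S es H
      ... | true  = ℚ.≤-refl
      ... | false = 0≤1

      Exp-missed : ∀ S G → Exp es G (missed S) ℚ.≤ pow q (cnt S es)
      Exp-missed S G = Exp-miss S es G uq ≤1 ≤0
        where
        ≤1 : ∀ H → missed S H ℚ.≤ 1ℚ
        ≤1 H with hits S es H
        ... | true  = 0≤1
        ... | false = ℚ.≤-refl
        ≤0 : ∀ H {u v} → (u , v) ∈ es → T (S u v) → T (H u v) → missed S H ℚ.≤ 0ℚ
        ≤0 H m s h with hits S es H | hits⁺ {S = S} {G = H} m s h
        ... | true | _ = ℚ.≤-refl

      total : List (Rel n) → Rel n → ℚ
      total []      H = 0ℚ
      total (S ∷ Ss) H = missed S H ℚ.+ total Ss H

      total≥0 : ∀ Ss H → 0ℚ ℚ.≤ total Ss H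
      total≥0 []       H = ℚ.≤-refl
      total≥0 (S ∷ Ss) H = ℚ.+-mono-≤ (missed≥0 S H) (total≥0 Ss H)

      total≥1 : ∀ {Ss H} → Any (λ S → ¬ T (hits S es H)) Ss → 1ℚ ℚ.≤ total Ss H
      total≥1 {S ∷ Ss} {H} (here ¬h) with hits S es H
      ... | true  = ⊥-elim (¬h tt)
      ... | false = ℚ.+-mono-≤ ℚ.≤-refl (total≥0 Ss H)
      total≥1 {S ∷ Ss} {H} (there a) = ℚ.+-mono-≤ (missed≥0 S H) (total≥1 a)

      Exp-total : ∀ {B} Ss G → All (λ S → pow q (cnt S es) ℚ.≤ B) Ss → Exp es G (total Ss) ℚ.≤ times (length Ss) B
      Exp-total []       G []       = Exp-bound es G λ _ _ → ℚ.≤-refl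
      Exp-total {B} (S ∷ Ss) G (h ∷ hs) = subst (ℚ._≤ times (suc (length Ss)) B) (sym (Exp-+ es G (missed S) (total Ss)))
        (ℚ.+-mono-≤ (ℚ.≤-trans (Exp-missed S G) h) (Exp-total Ss G hs))

      -- An outcome violating `E` misses some member of `Ss`, so the indicator of `E` plus the
      -- number of missed members is at least 1 pointwise; then take expectations.
      union-bound : ∀ {B} Ss G (E : Rel n → Set) (E? : ∀ H → Dec (E H)) →
        All (λ S → pow q (cnt S es) ℚ.≤ B) Ss → (∀ H → All (λ S → T (hits S es H)) Ss → E H) →
        1ℚ ℚ.≤ Exp es G (λ H → if ⌊ E? H ⌋ then 1ℚ else 0ℚ) ℚ.+ times (length Ss) B
      union-bound {B} Ss G E E? small suff = begin
        1ℚ                                             ≡⟨ sym (Exp-const es G) ⟩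
        Exp es G (λ _ → 1ℚ)                            ≤⟨ Exp-mono es G pointwise ⟩
        Exp es G (λ H → holds H ℚ.+ total Ss H)        ≡⟨ Exp-+ es G holds (total Ss) ⟩
        Exp es G holds ℚ.+ Exp es G (total Ss)         ≤⟨ ℚ.+-monoʳ-≤ (Exp es G holds) (Exp-total Ss G small) ⟩
        Exp es G holds ℚ.+ times (length Ss) B         ∎
        where
        open ℚ.≤-Reasoning
        holds : Rel n → ℚ
        holds H = if ⌊ E? H ⌋ then 1ℚ else 0ℚ
        Exp-const : ∀ es G → Exp es G (λ _ → 1ℚ) ≡ 1ℚ
        Exp-const []             G = refl
        Exp-const ((u , v) ∷ es) G = trans
          (cong₂ (λ a b → p ℚ.* a ℚ.+ q ℚ.* b) (Exp-const es (setEdge G u v true)) (Exp-const es (setEdge G u v false)))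
          (convex-const p 1ℚ)
        pointwise : ∀ H → 1ℚ ℚ.≤ holds H ℚ.+ total Ss H
        pointwise H with E? H
        ... | yes _ = ℚ.+-mono-≤ (ℚ.≤-refl {1ℚ}) (total≥0 Ss H)
        ... | no ¬E with All.all? (λ S → T? (hits S es H)) Ss
        ... | yes all = contradiction (suff H all) ¬E
        ... | no ¬all = ℚ.+-mono-≤ (ℚ.≤-refl {0ℚ}) (total≥1 (All.¬All⇒Any¬ (λ S → T? (hits S es H)) Ss ¬all))

  -- Counting potential edges and enumerating vertex sets.

  concatMap-pairs : ∀ {A B : Set} (xs : List A) (ys : List B) →
    concatMap (λ u → map (u ,_) ys) xs ≡ cartesianProduct xs ys
  concatMap-pairs []       ys = refl
  concatMap-pairs (x ∷ xs) ys = cong (map (x ,_) ys ++_) (concatMap-pairs xs ys)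

  length-cartesianProductWith : ∀ {A B C : Set} (f : A → B → C) xs ys →
    length (cartesianProductWith f xs ys) ≡ length xs * length ys
  length-cartesianProductWith f []       ys = refl
  length-cartesianProductWith f (x ∷ xs) ys = trans (length-++ (map (f x) ys))
    (cong₂ _+_ (length-map (f x) ys) (length-cartesianProductWith f xs ys))

  distinct? : ∀ {n} (e : Fin n × Fin n) → Dec (proj₁ e ≢ proj₂ e)
  distinct? e = ¬? (proj₁ e Fin.≟ proj₂ e)

  potentialEdges-unique : ∀ n → Unique (potentialEdges n)
  potentialEdges-unique n = Unique.filter⁺ distinct?
    (subst Unique (sym (concatMap-pairs (allFin n) (allFin n))) (Unique.cartesianProduct⁺ (Unique.allFin⁺ n) (Unique.allFin⁺ n)))

  potentialEdges-distinct : ∀ {n} {u v : Fin n} → (u , v) ∈ potentialEdges n → u ≢ v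
  potentialEdges-distinct {n} h = proj₂ (∈-filter⁻ distinct? {xs = concatMap (λ u → map (u ,_) (allFin n)) (allFin n)} h)

  cnt-++ : ∀ {n} (S : Rel n) xs ys → cnt S (xs ++ ys) ≡ cnt S xs + cnt S ys
  cnt-++ S []             ys = refl
  cnt-++ S ((u , v) ∷ xs) ys = trans (cong (ind (S u v) +_) (cnt-++ S xs ys)) (sym (+-assoc (ind (S u v)) _ _))

  cnt-row : ∀ {n k} (S : Rel n) u (g : Fin k → Fin n) → cnt S (map (u ,_) (tabulate g)) ≡ ∑ (λ j → ind (S u (g j)))
  cnt-row {k = zero}  S u g = refl
  cnt-row {k = suc k} S u g = cong (ind (S u (g zero)) +_) (cnt-row S u (g ∘ suc))

  cnt-product : ∀ {n k l} (S : Rel n) (f : Fin k → Fin n) (g : Fin l → Fin n) →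
    cnt S (cartesianProduct (tabulate f) (tabulate g)) ≡ ∑ (λ i → ∑ (λ j → ind (S (f i) (g j))))
  cnt-product {k = zero}  S f g = refl
  cnt-product {k = suc k} S f g = trans (cnt-++ S (map (f zero ,_) (tabulate g)) _)
    (cong₂ _+_ (cnt-row S (f zero) g) (cnt-product S (f ∘ suc) g))

  offDiagonal : ∀ {n} → Rel n → Rel n
  offDiagonal S u v = S u v ∧ not (does (u Fin.≟ v))

  cnt-filter : ∀ {n} (S : Rel n) es → cnt S (filter distinct? es) ≡ cnt (offDiagonal S) es
  cnt-filter S []             = refl
  cnt-filter S ((u , v) ∷ es) with u Fin.≟ v
  ... | yes _ = trans (cnt-filter S es) (cong (λ b → ind b + cnt (offDiagonal S) es) (sym (∧-zeroʳ (S u v))))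
  ... | no  _ = cong₂ _+_ (cong ind (sym (∧-identityʳ (S u v)))) (cnt-filter S es)

  opaque
    unfolding #

    cnt-rows : ∀ {n} (S : Rel n) (X : Fin n → Bool) {c} → (∀ u → T (X u) → c ≤ # (offDiagonal S u)) →
      # X * c ≤ cnt S (potentialEdges n)
    cnt-rows {n} S X {c} rows = begin
      # X * c                             ≡⟨ *-comm (# X) c ⟩
      c * # X                             ≡⟨ sym (∑-*ˡ c (ind ∘ X)) ⟩
      ∑ (λ u → c * ind (X u))             ≤⟨ ∑-mono row ⟩
      ∑ (λ u → # (offDiagonal S u))       ≡⟨ sym (cnt-product (offDiagonal S) id id) ⟩
      cnt (offDiagonal S) (cartesianProduct (allFin n) (allFin n))
                                          ≡⟨ cong (cnt (offDiagonal S)) (sym (concatMap-pairs (allFin n) (allFin n))) ⟩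
      cnt (offDiagonal S) (concatMap (λ u → map (u ,_) (allFin n)) (allFin n))
                                          ≡⟨ sym (cnt-filter S (concatMap (λ u → map (u ,_) (allFin n)) (allFin n))) ⟩
      cnt S (potentialEdges n)            ∎
      where
      open ≤-Reasoning
      row : ∀ u → c * ind (X u) ≤ # (offDiagonal S u)
      row u with X u | rows u
      ... | true  | h = ≤-trans (≤-reflexive (*-identityʳ c)) (h tt)
      ... | false | _ = ≤-trans (≤-reflexive (*-zeroʳ c)) z≤n

  -- A subset is represented only up to pointwise agreement; counting and hitting depend on nothing
  -- more.
  preds : ∀ n → List (Fin n → Bool)
  preds zero    = (λ ()) ∷ []
  preds (suc n) = map (true ◂_) (preds n) ++ map (false ◂_) (preds n)

  length-preds : ∀ n → length (preds n) ≡ 2 ^ n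
  length-preds zero    = refl
  length-preds (suc n) = trans (length-++ (map (true ◂_) (preds n))) (cong₂ _+_
    (trans (length-map (true ◂_) (preds n)) (length-preds n))
    (trans (trans (length-map (false ◂_) (preds n)) (length-preds n)) (sym (+-identityʳ (2 ^ n)))))

  preds-complete : ∀ {n} (P : Fin n → Bool) → ∃[ Q ] (Q ∈ preds n × (∀ i → Q i ≡ P i))
  preds-complete {zero}  P = (λ ()) , here refl , λ ()
  preds-complete {suc n} P with preds-complete (P ∘ suc) | P zero in eq
  ... | Q , Q∈ , Q≗P | true  = true ◂ Q , ∈-++⁺ˡ (∈-map⁺ (true ◂_) Q∈) , λ { zero → sym eq ; (suc i) → Q≗P i }
  ... | Q , Q∈ , Q≗P | false = false ◂ Q , ∈-++⁺ʳ (map (true ◂_) (preds n)) (∈-map⁺ (false ◂_) Q∈) , λ { zero → sym eq ; (suc i) → Q≗P i }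

  -- The edge sets that the random digraph has to hit.

  module Family {n : ℕ} (D : Digraph n) (m w : ℕ) (degree : ∀ e v → 5 * w ≤ # (dir (adj D) e v))
    (m<5w : m ≤ 5 * w) (m<n : suc m ≤ n) where

    reversed : Rel n
    reversed u v = adj D v u

    -- Pairs of sets below the size threshold are replaced by the reversed digraph, so that every
    -- member of the family has many potential edges.
    box : (Fin n → Bool) → (Fin n → Bool) → Rel n
    box P Q = if (suc m ≤ᵇ # P) ∧ (suc m ≤ᵇ # Q) then (λ u v → P u ∧ Q v) else reversed

    family : List (Rel n)
    family = reversed ∷ cartesianProductWith box (preds n) (preds n)

    length-family : length family ≡ suc (2 ^ n * 2 ^ n)
    length-family = cong suc (trans (length-cartesianProductWith box (preds n) (preds n)) (cong₂ _*_ (length-preds n) (length-preds n)))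

    -- A box of two large sets has at least m + 1 rows of at least m + 1 entries, and each row loses
    -- at most one entry to the diagonal.
    c : ℕ
    c = suc m * m

    cnt-reversed : c ≤ cnt reversed (potentialEdges n)
    cnt-reversed = ≤-trans (*-mono-≤ m<n m<5w) (subst (λ k → k * (5 * w) ≤ cnt reversed (potentialEdges n)) #-true
      (cnt-rows reversed (λ _ → true) (λ u _ → ≤-trans (degree false u) (#-mono λ v h → ∧⁺ h (T-not⁺ λ u≡v → loop h (does⁻ (u Fin.≟ v) u≡v))))))
      where
      loop : ∀ {u v} → T (adj D v u) → u ≡ v → ⊥
      loop {u} h refl = subst T (loopless D u) h

    cnt-box : ∀ P Q → c ≤ cnt (box P Q) (potentialEdges n)
    cnt-box P Q with suc m ≤ᵇ # P in eP | suc m ≤ᵇ # Q in eQ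
    ... | true  | false = cnt-reversed
    ... | false | _     = cnt-reversed
    ... | true  | true  = ≤-trans (*-monoˡ-≤ m (≤ᵇ⇒≤ (suc m) (# P) (subst T (sym eP) tt)))
      (cnt-rows (λ u v → P u ∧ Q v) P λ u Pu → ≤-trans
        (≤-pred (≤-trans (≤ᵇ⇒≤ (suc m) (# Q) (subst T (sym eQ) tt)) (#-∖ Q (u ∷ []))))
        (#-mono λ v h → ∧⁺ (∧⁺ Pu (proj₁ (∖⁻ h))) (T-not⁺ λ e → proj₂ (∖⁻ h) (here (sym (does⁻ (u Fin.≟ v) e))))))

    cnt-family : All (λ S → c ≤ cnt S (potentialEdges n)) family
    cnt-family = cnt-reversed ∷ All.tabulate λ {S} h →
      let P , Q , _ , _ , e = ∈-cartesianProductWith⁻ box (preds n) (preds n) h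
      in subst (λ S → c ≤ cnt S (potentialEdges n)) (sym e) (cnt-box P Q)

    module Hit (H : Rel n) (hit : All (λ S → T (hits S (potentialEdges n) H)) family) where

      joined : ∀ P Q → suc m ≤ # P → suc m ≤ # Q → ∃[ u ] ∃[ v ] (u ≢ v × T (P u) × T (Q v) × T (H u v))
      joined P Q p q with preds-complete P | preds-complete Q
      ... | P′ , P′∈ , eP | Q′ , Q′∈ , eQ with hits⁻ {S = box P′ Q′} {H} (potentialEdges n)
              (All.lookup hit (there (∈-cartesianProductWith⁺ box P′∈ Q′∈)))
      ... | u , v , uv∈ , s , h = let a , b = ∧⁻ {P′ u} (unbox s) in
        u , v , potentialEdges-distinct uv∈ , subst T (eP u) a , subst T (eQ v) b , h
        where
        large : ∀ {P P′ : Fin n → Bool} → (∀ i → P′ i ≡ P i) → suc m ≤ # P → T (suc m ≤ᵇ # P′)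
        large e h = ≤⇒≤ᵇ (≤-trans h (#-mono λ i → subst T (sym (e i))))
        unbox : ∀ {u v} → T (box P′ Q′ u v) → T (P′ u ∧ Q′ v)
        unbox s with suc m ≤ᵇ # P′ | suc m ≤ᵇ # Q′ | large eP p | large eQ q
        ... | true | true | _ | _ = s

      two-cycle : Contains2Cycle (D ∪ H)
      two-cycle with hits⁻ {S = reversed} {H} (potentialEdges n) (All.lookup hit (here refl))
      ... | u , v , uv∈ , s , h = u , v , potentialEdges-distinct uv∈ ,
        Equivalence.from (T-∨ {adj D u v}) (inj₂ h) , Equivalence.from T-∨ (inj₁ s)

  pow-antitone : ∀ {q k l} → 0ℚ ℚ.≤ q → q ℚ.≤ 1ℚ → k ≤ l → pow q l ℚ.≤ pow q k
  pow-antitone {q} {zero}  {zero}  0≤q q≤1 z≤n = ℚ≤-refl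
    where open import Data.Rational.Properties renaming (≤-refl to ℚ≤-refl)
  pow-antitone {q} {zero}  {suc l} 0≤q q≤1 z≤n = ℚ≤-trans (*-monoʳ (pow-nonNeg l 0≤q) q≤1)
      (subst (ℚ._≤ 1ℚ) (sym (ℚ*-identityˡ (pow q l))) (pow-antitone {q} {zero} {l} 0≤q q≤1 z≤n))
    where open import Data.Rational.Properties renaming (≤-trans to ℚ≤-trans; *-identityˡ to ℚ*-identityˡ)
  pow-antitone {q} {suc k} {suc l} 0≤q q≤1 (s≤s h) = *-monoˡ 0≤q (pow-antitone 0≤q q≤1 h)

  module Likely {n : ℕ} (D : Digraph n) (m w A : ℕ)
    (1≤A : 1 ≤ A) (m≤w : suc m ≤ w) (n≤Aw : n ≤ A * w) (m<n : suc m ≤ n)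
    (degree : ∀ e v → 5 * w ≤ # (dir (adj D) e v))
    (κ J s : ℕ) (suc-J : suc J ≡ 2 * (A * A)) (m≪κ : A * (A * (A * (suc m + 12))) ≤ κ)
    (decay : J ^ s * n ≤ suc J ^ s * κ) (small : (κ + κ) * (4 + 10 * s) + 6 * κ + 30 ≤ 2 * w)
    (7m≤2κ : 7 * suc m ≤ κ + κ) (u₀ : Fin n) where

    open Family D m w degree (≤-trans (n≤1+n m) (≤-trans m≤w (m≤m+n w _))) m<n

    likely : ∀ p → 0ℚ ℚ.≤ p → p ℚ.≤ 1ℚ →
      1ℚ ℚ.≤ Pr n p (λ G → ContainsAllOrientedCycles (D ∪ G)) (λ G → containsAll? (D ∪ G))
             ℚ.+ times (suc (2 ^ n * 2 ^ n)) (pow (1ℚ ℚ.- p) (suc m * m))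
    likely p 0≤p p≤1 = subst (λ k → 1ℚ ℚ.≤ Pr n p (λ G → ContainsAllOrientedCycles (D ∪ G)) (λ G → containsAll? (D ∪ G))
             ℚ.+ times k (pow (1ℚ ℚ.- p) (suc m * m))) length-family
      (union-bound family emptyRel (λ G → ContainsAllOrientedCycles (D ∪ G)) (λ G → containsAll? (D ∪ G))
        (All.map (pow-antitone 0≤q q≤1) cnt-family) contains-all)
      where
      open Expectation {n} p 0≤p p≤1
      open Union (potentialEdges n) (potentialEdges-unique n)
      q≤1 : q ℚ.≤ 1ℚ
      q≤1 = subst (q ℚ.≤_) (ℚP.+-identityʳ 1ℚ) (ℚP.+-monoʳ-≤ 1ℚ (ℚP.neg-antimono-≤ 0≤p))
        where import Data.Rational.Properties as ℚP
      contains-all : ∀ H → All (λ S → T (hits S (potentialEdges n) H)) family → ContainsAllOrientedCycles (D ∪ H)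
      contains-all H hit = two-cycle , Embedding.all-orientations D H w A (suc m) 1≤A (s≤s z≤n) m≤w n≤Aw degree joined
          κ J s suc-J m≪κ decay small 7m≤2κ u₀
        where open Hit H hit

-- Rational estimates and the choice of the constants.

module Asymptotics where

  open Combinatorics
  open Probability
  open import Data.Nat as ℕ using (ℕ; zero; suc; _+_; _*_; _^_; _/_; _≤_; _<_; z≤n; s≤s; NonZero; >-nonZero)
  open import Data.Integer as ℤ using (+_; +≤+)
  import Data.Integer.Properties as ℤ
  open import Data.Rational as ℚ using (ℚ; 0ℚ; 1ℚ; toℚᵘ; mkℚ)
  open import Data.Rational.Unnormalised as ℚᵘ using (mkℚᵘ; *≡*; *≤*)
  import Data.Rational.Unnormalised.Properties as ℚᵘ

  bernoulli : ∀ J r → J ^ r * (J + r) ≤ suc J ^ r * J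
  bernoulli J zero    = ≤-reflexive (cong (λ z → z + 0) (+-identityʳ J))
  bernoulli J (suc r) = lin (J ^ r * r) (*-monoʳ-≤ (suc J) (bernoulli J r)) (eq J r (J ^ r) (suc J ^ r))
    where
    eq : ∀ J r x y → suc J * y * J + suc J * (x * (J + r)) ≡ J * x * (J + suc r) + suc J * (y * J) + x * r
    eq = solve-∀

  -- Bernoulli's inequality alone gives (1 + 1/J)^r only linear growth, too little against the
  -- linear factor; its square grows quadratically, hence s = 2r. The 420 is 220 + 200: the factor
  -- times J² is 220aJ² + 200aJ²r, at most 420aJ²r = r².
  decay-steps : ∀ a J → 1 ≤ a → 1 ≤ J → ∃[ s ] (J ^ s * (10 * a * (22 + 10 * s)) ≤ suc J ^ s)
  decay-steps a J 1≤a 1≤J = r + r , *-cancelʳ-≤ _ _ (J * J) ⦃ >-nonZero (*-mono-≤ 1≤J 1≤J) ⦄ (begin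
    J ^ (r + r) * B * (J * J)                       ≡⟨ cong (λ z → z * B * (J * J)) (^-distribˡ-+-* J r r) ⟩
    J ^ r * J ^ r * B * (J * J)                     ≡⟨ *-assoc (J ^ r * J ^ r) B (J * J) ⟩
    J ^ r * J ^ r * (B * (J * J))                   ≤⟨ *-monoʳ-≤ (J ^ r * J ^ r) B≤ ⟩
    J ^ r * J ^ r * ((J + r) * (J + r))             ≡⟨ eq (J ^ r) (J + r) ⟩
    J ^ r * (J + r) * (J ^ r * (J + r))             ≤⟨ *-mono-≤ (bernoulli J r) (bernoulli J r) ⟩
    suc J ^ r * J * (suc J ^ r * J)                 ≡⟨ sym (eq (suc J ^ r) J) ⟩
    suc J ^ r * suc J ^ r * (J * J)                 ≡⟨ cong (_* (J * J)) (sym (^-distribˡ-+-* (suc J) r r)) ⟩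
    suc J ^ (r + r) * (J * J)                       ∎)
    where
    open ≤-Reasoning
    r = 420 * a * (J * J)
    B = 10 * a * (22 + 10 * (r + r))
    1≤r : 1 ≤ r
    1≤r = *-mono-≤ (*-mono-≤ {1} {420} (s≤s z≤n) 1≤a) (*-mono-≤ 1≤J 1≤J)
    eq : ∀ x y → x * x * (y * y) ≡ x * y * (x * y)
    eq = solve-∀
    B≤ : B * (J * J) ≤ (J + r) * (J + r)
    B≤ = ≤-trans (expand r 1≤r refl) (*-mono-≤ (m≤n+m r J) (m≤n+m r J))
      where
      expand : ∀ x → 1 ≤ x → x ≡ 420 * a * (J * J) → 10 * a * (22 + 10 * (x + x)) * (J * J) ≤ x * x
      expand x 1≤x x≡ = subst (λ z → 10 * a * (22 + 10 * (x + x)) * (J * J) ≤ x * z) (sym x≡)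
        (lin 0 (*-monoʳ-≤ (220 * (a * (J * J))) 1≤x) (eq′ a (J * J) x))
        where
        eq′ : ∀ a j x → x * (420 * a * j) + 220 * (a * j) * 1 ≡ 10 * a * (22 + 10 * (x + x)) * j + 220 * (a * j) * x + 0
        eq′ = solve-∀

  ι : ℕ → ℚ
  ι = ℕtoℚ

  toℚᵘ-ι : ∀ k → toℚᵘ (ι k) ℚᵘ.≃ mkℚᵘ (+ k) 0
  toℚᵘ-ι k = ℚ.toℚᵘ-fromℚᵘ (mkℚᵘ (+ k) 0)

  ι-+ : ∀ a b → ι (a + b) ≡ ι a ℚ.+ ι b
  ι-+ a b = ℚ.toℚᵘ-injective (ℚᵘ.≃-trans (toℚᵘ-ι (a + b)) (ℚᵘ.≃-sym (ℚᵘ.≃-trans (ℚ.toℚᵘ-homo-+ (ι a) (ι b))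
    (ℚᵘ.≃-trans (ℚᵘ.+-cong (toℚᵘ-ι a) (toℚᵘ-ι b))
      (*≡* (cong (ℤ._* + 1) (cong₂ ℤ._+_ (ℤ.*-identityʳ (+ a)) (ℤ.*-identityʳ (+ b)))))))))

  ι-* : ∀ a b → ι (a * b) ≡ ι a ℚ.* ι b
  ι-* a b = ℚ.toℚᵘ-injective (ℚᵘ.≃-trans (toℚᵘ-ι (a * b)) (ℚᵘ.≃-sym (ℚᵘ.≃-trans (ℚ.toℚᵘ-homo-* (ι a) (ι b))
    (ℚᵘ.≃-trans (ℚᵘ.*-cong (toℚᵘ-ι a) (toℚᵘ-ι b)) (*≡* (cong (ℤ._* + 1) (sym (ℤ.pos-* a b))))))))

  ι-mono : ∀ {a b} → a ≤ b → ι a ℚ.≤ ι b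
  ι-mono {a} {b} h = ℚ.toℚᵘ-cancel-≤ (ℚᵘ.≤-respˡ-≃ (ℚᵘ.≃-sym (toℚᵘ-ι a)) (ℚᵘ.≤-respʳ-≃ (ℚᵘ.≃-sym (toℚᵘ-ι b))
    (*≤* (subst₂ ℤ._≤_ (sym (ℤ.*-identityʳ (+ a))) (sym (ℤ.*-identityʳ (+ b))) (+≤+ h)))))

  ι-reflect : ∀ {a b} → ι a ℚ.≤ ι b → a ≤ b
  ι-reflect {a} {b} h with ℚᵘ.≤-respˡ-≃ (toℚᵘ-ι a) (ℚᵘ.≤-respʳ-≃ (toℚᵘ-ι b) (ℚ.toℚᵘ-mono-≤ h))
  ... | *≤* g = ℤ.drop‿+≤+ (subst₂ ℤ._≤_ (ℤ.*-identityʳ (+ a)) (ℤ.*-identityʳ (+ b)) g)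

  ι≥0 : ∀ a → 0ℚ ℚ.≤ ι a
  ι≥0 a = ι-mono {0} {a} z≤n

  ι-inverse : ∀ k → ι (suc k) ℚ.* (+ 1 ℚ./ suc k) ≡ 1ℚ
  ι-inverse k = ℚ.toℚᵘ-injective (ℚᵘ.≃-trans (ℚ.toℚᵘ-homo-* (ι (suc k)) (+ 1 ℚ./ suc k))
    (ℚᵘ.≃-trans (ℚᵘ.*-cong (toℚᵘ-ι (suc k)) (ℚ.toℚᵘ-fromℚᵘ (mkℚᵘ (+ 1) k)))
      (*≡* (cong +_ (eq k)))))
    where
    eq : ∀ k → suc k * 1 * 1 ≡ 1 * (1 * suc k)
    eq = solve-∀

  archimedean : ∀ ε → 0ℚ ℚ.< ε → ∃[ d ] (1 ≤ d × 1ℚ ℚ.≤ ε ℚ.* ι d)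
  archimedean ε@(mkℚ (+ zero) d c) h = contradiction h λ { (ℚ.*<* (ℤ.+<+ ())) }
  archimedean ε@(mkℚ ℤ.-[1+ n ] d c) h = contradiction h λ { (ℚ.*<* ()) }
  archimedean ε@(mkℚ (+ suc k) d c) _ = suc d , s≤s z≤n ,
    ℚ.toℚᵘ-cancel-≤ (ℚᵘ.≤-respʳ-≃ (ℚᵘ.≃-sym (ℚᵘ.≃-trans (ℚ.toℚᵘ-homo-* ε (ι (suc d))) (ℚᵘ.*-cong (ℚᵘ.≃-refl {toℚᵘ ε}) (toℚᵘ-ι (suc d)))))
      (*≤* (+≤+ (lin (k * suc d) (≤-refl {0}) (eq k d)))))
    where
    eq : ∀ k d → suc k * suc d * 1 + 0 ≡ 1 * (suc d * 1) + 0 + k * suc d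
    eq = solve-∀

  times-ι : ∀ k x → times k x ≡ ι k ℚ.* x
  times-ι zero    x = sym (ℚ.*-zeroˡ x)
  times-ι (suc k) x = trans (cong (x ℚ.+_) (times-ι k x)) (sym (trans (cong (ℚ._* x) (ι-+ 1 k))
    (trans (ℚ.*-distribʳ-+ x (ι 1) (ι k)) (cong (ℚ._+ ι k ℚ.* x) (ℚ.*-identityˡ x)))))

  pow-* : ∀ x y k → pow (x ℚ.* y) k ≡ pow x k ℚ.* pow y k
  pow-* x y zero    = sym (ℚ.*-identityˡ 1ℚ)
  pow-* x y (suc k) = trans (cong ((x ℚ.* y) ℚ.*_) (pow-* x y k)) (eq x y (pow x k) (pow y k))
    where
    open ℚSolver.+-*-Solver renaming (solve to solveℚ)
    eq : ∀ x y a b → (x ℚ.* y) ℚ.* (a ℚ.* b) ≡ (x ℚ.* a) ℚ.* (y ℚ.* b)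
    eq = solveℚ 4 (λ x y a b → (x :* y) :* (a :* b) := (x :* a) :* (y :* b)) refl

  pow-+ : ∀ x k l → pow x (k + l) ≡ pow x k ℚ.* pow x l
  pow-+ x zero    l = sym (ℚ.*-identityˡ (pow x l))
  pow-+ x (suc k) l = trans (cong (x ℚ.*_) (pow-+ x k l)) (sym (ℚ.*-assoc x (pow x k) (pow x l)))

  pow-pow : ∀ x k l → pow x (k * l) ≡ pow (pow x l) k
  pow-pow x zero    l = refl
  pow-pow x (suc k) l = trans (pow-+ x l (k * l)) (cong (pow x l ℚ.*_) (pow-pow x k l))

  pow-≤1 : ∀ {x} k → 0ℚ ℚ.≤ x → x ℚ.≤ 1ℚ → pow x k ℚ.≤ 1ℚ
  pow-≤1 zero    _ _ = ℚ.≤-refl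
  pow-≤1 {x} (suc k) p q = ℚ.≤-trans (*-monoʳ (pow-nonNeg k p) q) (subst (ℚ._≤ 1ℚ) (sym (ℚ.*-identityˡ (pow x k))) (pow-≤1 k p q))

  pow-ι : ∀ z k → pow (ι z) k ≡ ι (z ^ k)
  pow-ι z zero    = refl
  pow-ι z (suc k) = trans (cong (ι z ℚ.*_) (pow-ι z k)) (sym (ι-* z (z ^ k)))

  bernoulliℚ : ∀ x k → 0ℚ ℚ.≤ x → 1ℚ ℚ.+ ι k ℚ.* x ℚ.≤ pow (1ℚ ℚ.+ x) k
  bernoulliℚ x zero    0≤x = ℚ.≤-reflexive (trans (cong (1ℚ ℚ.+_) (ℚ.*-zeroˡ x)) (ℚ.+-identityʳ 1ℚ))
  bernoulliℚ x (suc k) 0≤x = begin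
    1ℚ ℚ.+ ι (suc k) ℚ.* x                                   ≡⟨ cong (λ z → 1ℚ ℚ.+ z ℚ.* x) (ι-+ 1 k) ⟩
    1ℚ ℚ.+ (1ℚ ℚ.+ ι k) ℚ.* x                                ≡⟨ sym (ℚ.+-identityʳ (1ℚ ℚ.+ (1ℚ ℚ.+ ι k) ℚ.* x)) ⟩
    1ℚ ℚ.+ (1ℚ ℚ.+ ι k) ℚ.* x ℚ.+ 0ℚ                         ≤⟨ ℚ.+-monoʳ-≤ (1ℚ ℚ.+ (1ℚ ℚ.+ ι k) ℚ.* x) (0≤* (ι≥0 k) (0≤* 0≤x 0≤x)) ⟩
    1ℚ ℚ.+ (1ℚ ℚ.+ ι k) ℚ.* x ℚ.+ ι k ℚ.* (x ℚ.* x)          ≡⟨ eq x (ι k) ⟩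
    (1ℚ ℚ.+ x) ℚ.* (1ℚ ℚ.+ ι k ℚ.* x)                        ≤⟨ *-monoˡ (ℚ.+-mono-≤ 0≤1 0≤x) (bernoulliℚ x k 0≤x) ⟩
    (1ℚ ℚ.+ x) ℚ.* pow (1ℚ ℚ.+ x) k                          ∎
    where
    open ℚ.≤-Reasoning
    open ℚSolver.+-*-Solver renaming (solve to solveℚ)
    eq : ∀ x k → 1ℚ ℚ.+ (1ℚ ℚ.+ k) ℚ.* x ℚ.+ k ℚ.* (x ℚ.* x) ≡ (1ℚ ℚ.+ x) ℚ.* (1ℚ ℚ.+ k ℚ.* x)
    eq = solveℚ 2 (λ x k → con 1ℚ :+ (con 1ℚ :+ k) :* x :+ k :* (x :* x) := (con 1ℚ :+ x) :* (con 1ℚ :+ k :* x)) refl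

  module Capped (x : ℚ) (0≤x : 0ℚ ℚ.≤ x) where
    p q : ℚ
    p = 1ℚ ℚ.⊓ x
    q = 1ℚ ℚ.- p

    p≤1 : p ℚ.≤ 1ℚ
    p≤1 = ℚ.p⊓q≤p 1ℚ x

    0≤p : 0ℚ ℚ.≤ p
    0≤p = ℚ.⊓-glb 0≤1 0≤x

    0≤q : 0ℚ ℚ.≤ q
    0≤q = subst (ℚ._≤ q) (ℚ.+-inverseʳ p) (ℚ.+-monoˡ-≤ (ℚ.- p) p≤1)

    -- A rational substitute for 1 - x ≤ e^(-x): below the cap, (1 - x)(1 + x) = 1 - x²; at the cap,
    -- q = 0.
    q[1+x]≤1 : q ℚ.* (1ℚ ℚ.+ x) ℚ.≤ 1ℚ
    q[1+x]≤1 with ℚ.≤-total 1ℚ x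
    ... | inj₁ 1≤x = subst (ℚ._≤ 1ℚ) (sym (trans (cong (λ z → (1ℚ ℚ.- z) ℚ.* (1ℚ ℚ.+ x)) (ℚ.p≤q⇒p⊓q≡p 1≤x))
                       (ℚ.*-zeroˡ (1ℚ ℚ.+ x)))) 0≤1
    ... | inj₂ x≤1 = subst (ℚ._≤ 1ℚ) (sym (cong (λ z → (1ℚ ℚ.- z) ℚ.* (1ℚ ℚ.+ x)) (ℚ.p≥q⇒p⊓q≡q x≤1)))
      (subst₂ ℚ._≤_ (ℚ.+-identityʳ _) (eq x) (ℚ.+-monoʳ-≤ ((1ℚ ℚ.- x) ℚ.* (1ℚ ℚ.+ x)) (0≤* 0≤x 0≤x)))
      where
      open ℚSolver.+-*-Solver renaming (solve to solveℚ)
      eq : ∀ x → (1ℚ ℚ.- x) ℚ.* (1ℚ ℚ.+ x) ℚ.+ x ℚ.* x ≡ 1ℚ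
      eq = solveℚ 1 (λ x → (con 1ℚ :- x) :* (con 1ℚ :+ x) :+ x :* x := con 1ℚ) refl

    pow-small : ∀ t Z → ι Z ℚ.≤ ι t ℚ.* x → pow q t ℚ.* ι Z ℚ.≤ 1ℚ
    pow-small t Z h = begin
      pow q t ℚ.* ι Z                    ≤⟨ *-monoˡ (pow-nonNeg t 0≤q) (ℚ.≤-trans h
                                              (subst (ℚ._≤ 1ℚ ℚ.+ ι t ℚ.* x) (ℚ.+-identityˡ (ι t ℚ.* x)) (ℚ.+-monoˡ-≤ (ι t ℚ.* x) 0≤1))) ⟩
      pow q t ℚ.* (1ℚ ℚ.+ ι t ℚ.* x)     ≤⟨ *-monoˡ (pow-nonNeg t 0≤q) (bernoulliℚ x t 0≤x) ⟩
      pow q t ℚ.* pow (1ℚ ℚ.+ x) t       ≡⟨ sym (pow-* q (1ℚ ℚ.+ x) t) ⟩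
      pow (q ℚ.* (1ℚ ℚ.+ x)) t           ≤⟨ pow-≤1 t (0≤* 0≤q (ℚ.+-mono-≤ 0≤1 0≤x)) q[1+x]≤1 ⟩
      1ℚ                                 ∎
      where open ℚ.≤-Reasoning

    -- The t·m pairs form m blocks of size t. Bernoulli yields only q^t ≤ 1/Z for one block, but the
    -- m blocks together give 1/Z^m, which beats the number `L` of events and the factor `d ≥ 1/ε`.
    tail-small : ∀ {ε d L m t Z} → 1ℚ ℚ.≤ ε ℚ.* ι d → 1 ≤ d → ι Z ℚ.≤ ι t ℚ.* x → L * d ≤ Z ^ m →
      times L (pow q (t * m)) ℚ.≤ ε
    tail-small {ε} {d} {L} {m} {t} {Z} hε 1≤d hZ hL = ℚ.*-cancelʳ-≤-pos (ι d) ⦃ ℚ.positive (ℚ.<-≤-trans (ℚ.positive⁻¹ 1ℚ) (ι-mono 1≤d)) ⦄ (begin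
      times L (pow q (t * m)) ℚ.* ι d               ≡⟨ cong (ℚ._* ι d) (times-ι L (pow q (t * m))) ⟩
      ι L ℚ.* pow q (t * m) ℚ.* ι d                 ≡⟨ eq (ι L) (pow q (t * m)) (ι d) ⟩
      pow q (t * m) ℚ.* (ι L ℚ.* ι d)               ≡⟨ cong₂ ℚ._*_ (trans (cong (pow q) (*-comm t m)) (pow-pow q m t)) (sym (ι-* L d)) ⟩
      pow (pow q t) m ℚ.* ι (L * d)                 ≤⟨ *-monoˡ (pow-nonNeg m (pow-nonNeg t 0≤q)) (ι-mono hL) ⟩
      pow (pow q t) m ℚ.* ι (Z ^ m)                 ≡⟨ cong (pow (pow q t) m ℚ.*_) (sym (pow-ι Z m)) ⟩
      pow (pow q t) m ℚ.* pow (ι Z) m               ≡⟨ sym (pow-* (pow q t) (ι Z) m) ⟩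
      pow (pow q t ℚ.* ι Z) m                       ≤⟨ pow-≤1 m (0≤* (pow-nonNeg t 0≤q) (ι≥0 Z)) (pow-small t Z hZ) ⟩
      1ℚ                                            ≤⟨ hε ⟩
      ε ℚ.* ι d                                     ∎)
      where
      open ℚ.≤-Reasoning
      open ℚSolver.+-*-Solver renaming (solve to solveℚ)
      eq : ∀ a b c → a ℚ.* b ℚ.* c ≡ b ℚ.* (a ℚ.* c)
      eq = solveℚ 3 (λ a b c → a :* b :* c := b :* (a :* c)) refl

  m<2^m : ∀ m → m < 2 ^ m
  m<2^m zero    = s≤s z≤n
  m<2^m (suc m) = lin 0 (m<2^m m ⊕ ≤-trans (s≤s z≤n) (m<2^m m)) (eq m (2 ^ m))
    where
    eq : ∀ m x → 2 * x + (suc m + 1) ≡ suc (suc m) + (x + x) + 0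
    eq = solve-∀

  ^-distrib-* : ∀ x y k → (x * y) ^ k ≡ x ^ k * y ^ k
  ^-distrib-* x y zero    = refl
  ^-distrib-* x y (suc k) = trans (cong (x * y *_) (^-distrib-* x y k)) (eq x y (x ^ k) (y ^ k))
    where
    eq : ∀ x y a b → x * y * (a * b) ≡ x * a * (y * b)
    eq = solve-∀

  -- The source of `Z`: the number of events is at most the m-th power of 4^(3Q), and 2^m > m ≥ d
  -- absorbs `d`.
  union-size : ∀ {n m d Q} → n < 3 * Q * m → d ≤ m → suc (2 ^ n * 2 ^ n) * d ≤ (2 * 4 ^ (3 * Q)) ^ m
  union-size {n} {m} {d} {Q} n<3Qm d≤m = begin
    suc (2 ^ n * 2 ^ n) * d        ≡⟨ *-comm _ d ⟩
    d * suc (2 ^ n * 2 ^ n)        ≤⟨ *-mono-≤ (≤-trans d≤m (<⇒≤ (m<2^m m))) 4^ ⟩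
    2 ^ m * 4 ^ (3 * Q * m)        ≡⟨ cong (2 ^ m *_) (sym (^-*-assoc 4 (3 * Q) m)) ⟩
    2 ^ m * (4 ^ (3 * Q)) ^ m      ≡⟨ sym (^-distrib-* 2 (4 ^ (3 * Q)) m) ⟩
    (2 * 4 ^ (3 * Q)) ^ m          ∎
    where
    open ≤-Reasoning
    4^ : suc (2 ^ n * 2 ^ n) ≤ 4 ^ (3 * Q * m)
    4^ = begin
      suc (2 ^ n * 2 ^ n)          ≡⟨ cong suc (sym (^-distrib-* 2 2 n)) ⟩
      suc (4 ^ n)                  ≤⟨ +-monoˡ-≤ (4 ^ n) (m^n>0 4 n) ⟩
      4 ^ n + 4 ^ n                ≤⟨ m≤m+n (4 ^ n + 4 ^ n) (4 ^ n + 4 ^ n) ⟩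
      4 ^ n + 4 ^ n + (4 ^ n + 4 ^ n) ≡⟨ eq (4 ^ n) ⟩
      4 ^ suc n                    ≤⟨ ^-monoʳ-≤ 4 n<3Qm ⟩
      4 ^ (3 * Q * m)              ∎
      where
      eq : ∀ x → x + x + (x + x) ≡ 4 * x
      eq = solve-∀

  sum-tabulate : ∀ {A : Set} {k} (f : A → ℕ) (g : Fin k → A) → sum (map f (tabulate g)) ≡ ∑ (f ∘ g)
  sum-tabulate {k = zero}  f g = refl
  sum-tabulate {k = suc k} f g = cong (λ z → f (g zero) + z) (sum-tabulate f (g ∘ suc))

  opaque
    unfolding #

    outdeg≤# : ∀ {n} (D : Digraph n) v → outdeg D v ≤ # (adj D v)
    outdeg≤# {n} D v = ≤-trans (≤-reflexive (sum-tabulate (λ u → if ⌊ ¬? (u Fin.≟ v) ⌋ ∧ adj D v u then 1 else 0) id)) (∑-mono pt)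
      where
      pt : ∀ u → (if ⌊ ¬? (u Fin.≟ v) ⌋ ∧ adj D v u then 1 else 0) ≤ ind (adj D v u)
      pt u with ⌊ ¬? (u Fin.≟ v) ⌋ | adj D v u
      ... | true  | true  = ≤-refl
      ... | true  | false = ≤-refl
      ... | false | _     = z≤n

    indeg≤# : ∀ {n} (D : Digraph n) v → indeg D v ≤ # (λ u → adj D u v)
    indeg≤# {n} D v = ≤-trans (≤-reflexive (sum-tabulate (λ u → if ⌊ ¬? (u Fin.≟ v) ⌋ ∧ adj D u v then 1 else 0) id)) (∑-mono pt)
      where
      pt : ∀ u → (if ⌊ ¬? (u Fin.≟ v) ⌋ ∧ adj D u v then 1 else 0) ≤ ind (adj D u v)
      pt u with ⌊ ¬? (u Fin.≟ v) ⌋ | adj D u v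
      ... | true  | true  = ≤-refl
      ... | true  | false = ≤-refl
      ... | false | _     = z≤n

  degree-bound : ∀ {α a n d} → 1ℚ ℚ.≤ α ℚ.* ι a → α ℚ.* ι n ℚ.≤ ι d → n ≤ a * d
  degree-bound {α} {a} {n} {d} hα hd = ι-reflect (begin
    ι n                       ≡⟨ sym (ℚ.*-identityˡ (ι n)) ⟩
    1ℚ ℚ.* ι n                ≤⟨ *-monoʳ (ι≥0 n) hα ⟩
    α ℚ.* ι a ℚ.* ι n         ≡⟨ eq α (ι a) (ι n) ⟩
    ι a ℚ.* (α ℚ.* ι n)       ≤⟨ *-monoˡ (ι≥0 a) hd ⟩
    ι a ℚ.* ι d               ≡⟨ sym (ι-* a d) ⟩
    ι (a * d)                 ∎)
    where
    open ℚ.≤-Reasoning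
    open ℚSolver.+-*-Solver renaming (solve to solveℚ)
    eq : ∀ x y z → x ℚ.* y ℚ.* z ≡ y ℚ.* (x ℚ.* z)
    eq = solveℚ 3 (λ x y z → x :* y :* z := y :* (x :* z)) refl

  complement : ∀ {x y ε} → 1ℚ ℚ.≤ x ℚ.+ y → y ℚ.≤ ε → 1ℚ ℚ.- ε ℚ.≤ x
  complement {x} {y} {ε} h y≤ε = subst (1ℚ ℚ.- ε ℚ.≤_) (eq x ε)
    (ℚ.+-monoˡ-≤ (ℚ.- ε) (ℚ.≤-trans h (ℚ.+-monoʳ-≤ x y≤ε)))
    where
    open ℚSolver.+-*-Solver renaming (solve to solveℚ)
    eq : ∀ x e → x ℚ.+ e ℚ.- e ≡ x
    eq = solveℚ 2 (λ x e → x :+ e :- e := x) refl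

  -- The parameters of the construction, as functions of a ≥ 1/α and, for those growing linearly
  -- with the number of vertices, of the unit t.
  module Parameters (a J s : ℕ) (1≤a : 1 ≤ a) (suc-J : suc J ≡ 2 * (10 * a * (10 * a)))
    (steps : J ^ s * (10 * a * (22 + 10 * s)) ≤ suc J ^ s) where

    A K W Q Z : ℕ
    A = 10 * a
    -- 13 because t + 12 ≤ 13t. `W` is what `small` requires for κ = Kt and w = Wt, with 30 ≤ 30t.
    -- `Q` makes 5aw = Qt ≤ n, so that semi-degrees of at least n/a reach 5w.
    K = 13 * (A * (A * A))
    W = K * (4 + 10 * s) + 3 * K + 15
    Q = 5 * a * W
    Z = 2 * 4 ^ (3 * Q)

    1≤A : 1 ≤ A
    1≤A = *-mono-≤ {1} {10} (s≤s z≤n) 1≤a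

    1≤A³ : 1 ≤ A * (A * A)
    1≤A³ = *-mono-≤ 1≤A (*-mono-≤ 1≤A 1≤A)

    1≤W : 1 ≤ W
    1≤W = ≤-trans (s≤s z≤n) (m≤n+m 15 (K * (4 + 10 * s) + 3 * K))

    1≤Q : 1 ≤ Q
    1≤Q = *-mono-≤ (*-mono-≤ {1} {5} (s≤s z≤n) 1≤a) 1≤W

    -- As n ≤ 2Qt, this gives t·C/n ≥ Z, so a block of t pairs is missed with probability at most
    -- 1/Z. It depends on `a` alone; ε enters only through `d`.
    C : ℚ
    C = ι (2 * Q * Z)

    -- d bounds 1/ε, so that t = ⌊n/Q⌋ > d makes the failure probability at most ε.
    module AtScale {α ε : ℚ} {k m d : ℕ} (n≥ : Q * suc m ≤ suc k) (n< : suc k < Q * suc m + Q)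
      (1≤d : 1 ≤ d) (d≤m : d ≤ m) (hα : 1ℚ ℚ.≤ α ℚ.* ι a) (hε : 1ℚ ℚ.≤ ε ℚ.* ι d)
      (D : Digraph (suc k)) (semidegree : MinSemiDegreeAtLeast D (α ℚ.* ι (suc k))) where

      n t w κ : ℕ
      n = suc k
      t = suc m
      w = W * t
      κ = K * t

      t≤ : ∀ {x} → 1 ≤ x → t ≤ x * t
      t≤ h = ≤-trans (≤-reflexive (sym (*-identityˡ t))) (*-monoˡ-≤ t h)

      n≤2Qt : n ≤ 2 * Q * t
      n≤2Qt = lin 0 (<⇒≤ n< ⊕ *-monoʳ-≤ Q {1} {t} (s≤s z≤n)) (eq n Q t)
        where
        eq : ∀ n Q t → 2 * Q * t + (n + Q * 1) ≡ n + (Q * t + Q + Q * t) + 0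
        eq = solve-∀

      n<3Qm : n < 3 * Q * m
      n<3Qm = ≤-trans n< (lin 0 (*-monoʳ-≤ (2 * Q) (≤-trans 1≤d d≤m)) (eq Q m))
        where
        eq : ∀ Q m → 3 * Q * m + 2 * Q * 1 ≡ Q * suc m + Q + 2 * Q * m + 0
        eq = solve-∀

      degree : ∀ e v → 5 * w ≤ # (dir (adj D) e v)
      degree true  v = ≤-trans (*-cancelˡ-≤ a ⦃ >-nonZero 1≤a ⦄ (≤-trans (≤-reflexive (eq a W t))
        (≤-trans n≥ (degree-bound {α} {a} {n} {outdeg D v} hα (proj₁ (semidegree v)))))) (outdeg≤# D v)
        where
        eq : ∀ a W t → a * (5 * (W * t)) ≡ 5 * a * W * t
        eq = solve-∀
      degree false v = ≤-trans (*-cancelˡ-≤ a ⦃ >-nonZero 1≤a ⦄ (≤-trans (≤-reflexive (eq a W t))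
        (≤-trans n≥ (degree-bound {α} {a} {n} {indeg D v} hα (proj₂ (semidegree v)))))) (indeg≤# D v)
        where
        eq : ∀ a W t → a * (5 * (W * t)) ≡ 5 * a * W * t
        eq = solve-∀

      n≤Aw : n ≤ A * w
      n≤Aw = ≤-trans n≤2Qt (≤-reflexive (eq a W t))
        where
        eq : ∀ a W t → 2 * (5 * a * W) * t ≡ 10 * a * (W * t)
        eq = solve-∀

      m≪κ : A * (A * (A * (t + 12))) ≤ κ
      m≪κ = lin 0 (*-monoʳ-≤ (12 * (A * (A * A))) {1} {t} (s≤s z≤n)) (eq A t)
        where
        eq : ∀ A t → 13 * (A * (A * A)) * t + 12 * (A * (A * A)) * 1 ≡ A * (A * (A * (t + 12))) + 12 * (A * (A * A)) * t + 0
        eq = solve-∀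

      7t≤2κ : 7 * t ≤ κ + κ
      7t≤2κ = lin (19 * t) (*-monoʳ-≤ (26 * t) 1≤A³) (eq (A * (A * A)) t)
        where
        eq : ∀ x t → 13 * x * t + 13 * x * t + 26 * t * 1 ≡ 7 * t + 26 * t * x + 19 * t
        eq = solve-∀

      small : (κ + κ) * (4 + 10 * s) + 6 * κ + 30 ≤ 2 * w
      small = lin 0 (*-monoʳ-≤ 30 {1} {t} (s≤s z≤n)) (eq K s t)
        where
        eq : ∀ K s t → 2 * ((K * (4 + 10 * s) + 3 * K + 15) * t) + 30 * 1
          ≡ (K * t + K * t) * (4 + 10 * s) + 6 * (K * t) + 30 + 30 * t + 0
        eq = solve-∀

      decay : J ^ s * n ≤ suc J ^ s * κ
      decay = begin
        J ^ s * n                                 ≤⟨ *-monoʳ-≤ (J ^ s) n≤ ⟩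
        J ^ s * (10 * a * (22 + 10 * s) * κ)      ≡⟨ sym (*-assoc (J ^ s) (10 * a * (22 + 10 * s)) κ) ⟩
        J ^ s * (10 * a * (22 + 10 * s)) * κ      ≤⟨ *-monoˡ-≤ κ steps ⟩
        suc J ^ s * κ                             ∎
        where
        open ≤-Reasoning
        1≤K : 1 ≤ K
        1≤K = *-mono-≤ {1} {13} (s≤s z≤n) 1≤A³
        eq : ∀ a K s t → 10 * a * (22 + 10 * s) * (K * t) + 150 * a * t * 1
          ≡ 10 * a * ((K * (4 + 10 * s) + 3 * K + 15) * t) + 150 * a * t * K + 0
        eq = solve-∀
        -- The 22 is 4 + 3 + 15, the last term of `W` being bounded by 15K.
        n≤ : n ≤ 10 * a * (22 + 10 * s) * κ
        n≤ = ≤-trans n≤Aw (lin 0 (*-monoʳ-≤ (150 * a * t) 1≤K) (eq a K s t))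

      0≤1/n : 0ℚ ℚ.≤ ℤ.+ 1 ℚ./ n
      0≤1/n = ℚ.nonNegative⁻¹ (ℤ.+ 1 ℚ./ n) ⦃ ℚ.normalize-nonNeg 1 n ⦄

      Z≤ : ι Z ℚ.≤ ι t ℚ.* (C ℚ.* (ℤ.+ 1 ℚ./ n))
      Z≤ = begin
        ι Z                                       ≡⟨ sym (ℚ.*-identityʳ (ι Z)) ⟩
        ι Z ℚ.* 1ℚ                                ≡⟨ cong (ι Z ℚ.*_) (sym (ι-inverse k)) ⟩
        ι Z ℚ.* (ι n ℚ.* (ℤ.+ 1 ℚ./ n))           ≡⟨ sym (ℚ.*-assoc (ι Z) (ι n) (ℤ.+ 1 ℚ./ n)) ⟩
        ι Z ℚ.* ι n ℚ.* (ℤ.+ 1 ℚ./ n)             ≡⟨ cong (ℚ._* (ℤ.+ 1 ℚ./ n)) (sym (ι-* Z n)) ⟩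
        ι (Z * n) ℚ.* (ℤ.+ 1 ℚ./ n)               ≤⟨ *-monoʳ 0≤1/n (ι-mono (≤-trans (*-monoʳ-≤ Z n≤2Qt) (≤-reflexive (eq Z Q t)))) ⟩
        ι (t * (2 * Q * Z)) ℚ.* (ℤ.+ 1 ℚ./ n)     ≡⟨ cong (ℚ._* (ℤ.+ 1 ℚ./ n)) (ι-* t (2 * Q * Z)) ⟩
        ι t ℚ.* C ℚ.* (ℤ.+ 1 ℚ./ n)               ≡⟨ ℚ.*-assoc (ι t) C (ℤ.+ 1 ℚ./ n) ⟩
        ι t ℚ.* (C ℚ.* (ℤ.+ 1 ℚ./ n))             ∎
        where
        open ℚ.≤-Reasoning
        eq : ∀ Z Q t → Z * (2 * Q * t) ≡ t * (2 * Q * Z)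
        eq = solve-∀

      open Capped (C ℚ.* (ℤ.+ 1 ℚ./ n)) (0≤* (ι≥0 (2 * Q * Z)) 0≤1/n) using (p; 0≤p; p≤1; tail-small)

      failure : times (suc (2 ^ n * 2 ^ n)) (pow (1ℚ ℚ.- p) (t * m)) ℚ.≤ ε
      failure = tail-small {ε} {d} {suc (2 ^ n * 2 ^ n)} {m} {t} {Z} hε 1≤d Z≤ (union-size {n} {m} {d} {Q} n<3Qm d≤m)

      success : 1ℚ ℚ.≤ PrAllCycles D C ℚ.+ times (suc (2 ^ n * 2 ^ n)) (pow (1ℚ ℚ.- p) (t * m))
      success = Likely.likely D m w A 1≤A (t≤ 1≤W) n≤Aw (≤-trans (t≤ 1≤Q) n≥) degree κ J s suc-J m≪κ decay small 7t≤2κ zero p 0≤p p≤1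

      bound : 1ℚ ℚ.- ε ℚ.≤ PrAllCycles D C
      bound = complement {PrAllCycles D C} {times (suc (2 ^ n * 2 ^ n)) (pow (1ℚ ℚ.- p) (t * m))} {ε} success failure

  PerturbedCycles : ℚ → Set
  PerturbedCycles α = ∃[ C ] (0ℚ ℚ.< C × (∀ (ε : ℚ) → 0ℚ ℚ.< ε → ∃[ N ] ∀ (n : ℕ) → N ≤ n →
    (D₀ : Digraph n) → MinSemiDegreeAtLeast D₀ (α ℚ.* ι n) → 1ℚ ℚ.- ε ℚ.≤ PrAllCycles D₀ C))

  perturbed-cycles : ∀ α → ∃[ a ] (1 ≤ a × 1ℚ ℚ.≤ α ℚ.* ι a) → PerturbedCycles α
  perturbed-cycles α (a , 1≤a , hα) = C , 0<C , large
    where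
    A² : ℕ
    A² = 10 * a * (10 * a)
    J : ℕ
    J = ℕ.pred (2 * A²)
    2≤2A² : 2 ≤ 2 * A²
    2≤2A² = *-monoʳ-≤ 2 {1} {A²} (*-mono-≤ (*-mono-≤ {1} {10} (s≤s z≤n) 1≤a) (*-mono-≤ {1} {10} (s≤s z≤n) 1≤a))
    suc-J : suc J ≡ 2 * A²
    suc-J = suc-pred (2 * A²) ⦃ >-nonZero (≤-trans (s≤s z≤n) 2≤2A²) ⦄
    S : ∃[ s ] (J ^ s * (10 * a * (22 + 10 * s)) ≤ suc J ^ s)
    S = decay-steps a J 1≤a (≤-pred (≤-trans 2≤2A² (≤-reflexive (sym suc-J))))
    open Parameters a J (proj₁ S) 1≤a suc-J (proj₂ S)
    0<C : 0ℚ ℚ.< C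
    0<C = ℚ.<-≤-trans (ℚ.positive⁻¹ 1ℚ) (ι-mono {1} (*-mono-≤ (*-mono-≤ {1} {2} (s≤s z≤n) 1≤Q) (*-mono-≤ {1} {2} (s≤s z≤n) (m^n>0 4 (3 * Q)))))
    at-least : ∀ n ε (δ : ∃[ d ] (1 ≤ d × 1ℚ ℚ.≤ ε ℚ.* ι d)) → Q * suc (suc (proj₁ δ)) ≤ n →
      (D : Digraph n) → MinSemiDegreeAtLeast D (α ℚ.* ι n) → 1ℚ ℚ.- ε ℚ.≤ PrAllCycles D C
    at-least zero    ε (d , _)         N≤n D deg = contradiction (≤-trans (*-mono-≤ 1≤Q (s≤s (z≤n {suc d}))) N≤n) λ ()
    at-least (suc k) ε (d , 1≤d , hε) N≤n D deg = with-quotient (suc k / Q) refl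
      where
      instance
        Q≢0 : NonZero Q
        Q≢0 = >-nonZero 1≤Q
      d<t : suc (suc d) ≤ suc k / Q
      d<t = subst (_≤ suc k / Q) (trans (cong (_/ Q) (*-comm Q (suc (suc d)))) (m*n/n≡m (suc (suc d)) Q)) (/-monoˡ-≤ Q N≤n)
      with-quotient : ∀ t → t ≡ suc k / Q → 1ℚ ℚ.- ε ℚ.≤ PrAllCycles D C
      with-quotient zero    e = contradiction (subst (suc (suc d) ≤_) (sym e) d<t) λ ()
      with-quotient (suc m) e = AtScale.bound {α} {ε} {k} {m} {d}
        (subst (_≤ suc k) (trans (cong (_* Q) (sym e)) (*-comm (suc m) Q)) (m/n*n≤m (suc k) Q))
        (subst₂ _<_ (sym (m≡m%n+[m/n]*n (suc k) Q)) (trans (+-comm Q _) (cong (_+ Q) (trans (cong (_* Q) (sym e)) (*-comm (suc m) Q))))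
          (+-monoˡ-< (suc k / Q * Q) (m%n<n (suc k) Q)))
        1≤d (≤-trans (n≤1+n d) (≤-pred (subst (suc (suc d) ≤_) (sym e) d<t))) hα hε D deg
    large : ∀ ε → 0ℚ ℚ.< ε → ∃[ N ] ∀ n → N ≤ n → (D : Digraph n) → MinSemiDegreeAtLeast D (α ℚ.* ι n) → 1ℚ ℚ.- ε ℚ.≤ PrAllCycles D C
    -- With N = Q(d + 2), the unit t = ⌊n/Q⌋ is at least d + 2, so it is the successor of some m ≥
    -- d.
    large ε 0<ε = Q * suc (suc (proj₁ (archimedean ε 0<ε))) , λ n → at-least n ε (archimedean ε 0<ε)

open import Data.Nat using (ℕ; _≤_)
open import Data.Rational using (ℚ; 0ℚ; 1ℚ; _-_; _*_; _<_)

theorem1p3 : ∀ (α : ℚ) → 0ℚ < α →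
    ∃[ C ] (0ℚ < C ×
    (∀ (ε : ℚ) → 0ℚ < ε → ∃[ N ] ∀ (n : ℕ) → N ≤ n →
    (D₀ : Digraph n) → MinSemiDegreeAtLeast D₀ (α * ℕtoℚ n) →
    (1ℚ - ε) Data.Rational.≤ PrAllCycles D₀ C))
theorem1p3 α 0<α = Asymptotics.perturbed-cycles α (Asymptotics.archimedean α 0<α)
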